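{- Let $q\in\mathbb{C}$ with $|q|<1$. Then $$\sum_{n=0}^\infty \frac{q^{n(n+1)}(-q^3;q^3)_{n}}{(-q;q)_n(q;q)_{2n+1}} = \frac{(q^3;q^3)_\infty(q^3;q^{18})_\infty(q^{15};q^{18})_\infty}{(q;q)_\infty}.$$
   Context: For $|q|<1$, $x\in\mathbb{C}$ and an integer $n\ge 0$: $(x;q)_n=\prod_{j=0}^{n-1}(1-xq^j)$ (so $(x;q)_0=1$) and $(x;q)_\infty=\prod_{j=0}^{\infty}(1-xq^j)$. The same notation is used with base $q^m$ in place of $q$. -}

module Defs where

open import Algebra.Bundles.Raw using (RawRing)
import Algebra.Definitions.RawSemiring as RawSemiringDefinitions
open import Data.Fin.Base using (toℕ)
open import Data.Nat.Base as ℕ using (ℕ)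
import Data.Nat.Properties as ℕ
open import Data.Product.Base using (Σ-syntax; ∃-syntax; _×_; _,_)
open import Data.Rational.Base as ℚ
  using (ℚ; 0ℚ; 1ℚ; ½; ∣_∣; 1/_; Positive; positive; nonNegative)
import Data.Rational.Properties as ℚ
open import Data.Rational.Solver using (module +-*-Solver)
open import Level using (0ℓ)
open import Relation.Binary.PropositionalEquality
open import Relation.Nullary using (yes; no; contradiction)

------------------------------------------------------------------------
-- Real numbers: Cauchy sequences of rationals, with operations acting
-- termwise; sequences with the same limit are identified by Real._≈_

IsCauchy : (ℕ → ℚ) → Set
IsCauchy x = ∀ ε → 0ℚ ℚ.< ε →
  ∃[ N ] (∀ m n → N ℕ.≤ m → N ℕ.≤ n → ∣ x m ℚ.- x n ∣ ℚ.< ε)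

record ℝ : Set where
  constructor mkℝ
  field
    seq    : ℕ → ℚ
    cauchy : IsCauchy seq

open ℝ public

private
  pos : ∀ {p} → 0ℚ ℚ.< p → Positive p
  pos = positive

  half : ∀ {ε} → 0ℚ ℚ.< ε → 0ℚ ℚ.< ε ℚ.* ½
  half {ε} 0<ε = subst (ℚ._< ε ℚ.* ½) (ℚ.*-zeroˡ ½) (ℚ.*-monoˡ-<-pos ½ 0<ε)

  half+half : ∀ ε → ε ℚ.* ½ ℚ.+ ε ℚ.* ½ ≡ ε
  half+half ε = trans (sym (ℚ.*-distribˡ-+ ε ½ ½)) (ℚ.*-identityʳ ε)

  mul-pos : ∀ {p r} → 0ℚ ℚ.< p → 0ℚ ℚ.< r → 0ℚ ℚ.< p ℚ.* r
  mul-pos {p} {r} 0<p 0<r = subst (ℚ._< p ℚ.* r) (ℚ.*-zeroˡ r)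
    (ℚ.*-monoˡ-<-pos r {{pos 0<r}} 0<p)

  sum-close : ∀ a b c d {η θ} → ∣ a ℚ.- c ∣ ℚ.< η → ∣ b ℚ.- d ∣ ℚ.< θ →
    ∣ (a ℚ.+ b) ℚ.- (c ℚ.+ d) ∣ ℚ.< η ℚ.+ θ
  sum-close a b c d {η} {θ} ac bd = begin-strict
    ∣ (a ℚ.+ b) ℚ.- (c ℚ.+ d) ∣        ≡⟨ cong ∣_∣ (regroup a b c d) ⟩
    ∣ (a ℚ.- c) ℚ.+ (b ℚ.- d) ∣        ≤⟨ ℚ.∣p+q∣≤∣p∣+∣q∣ (a ℚ.- c) (b ℚ.- d) ⟩
    ∣ a ℚ.- c ∣ ℚ.+ ∣ b ℚ.- d ∣        <⟨ ℚ.+-mono-< ac bd ⟩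
    η ℚ.+ θ                            ∎
    where
    open ℚ.≤-Reasoning
    open +-*-Solver
    regroup : ∀ a b c d → (a ℚ.+ b) ℚ.- (c ℚ.+ d) ≡ (a ℚ.- c) ℚ.+ (b ℚ.- d)
    regroup = solve 4 (λ a b c d → (a :+ b) :- (c :+ d) := (a :- c) :+ (b :- d)) refl

  ∣-∣-neg : ∀ a b → ∣ a ℚ.- b ∣ ≡ ∣ ℚ.- a ℚ.- ℚ.- b ∣
  ∣-∣-neg a b = trans (sym (ℚ.∣-p∣≡∣p∣ (a ℚ.- b))) (cong ∣_∣ (negate a b))
    where
    open +-*-Solver
    negate : ∀ a b → ℚ.- (a ℚ.- b) ≡ ℚ.- a ℚ.- ℚ.- b
    negate = solve 2 (λ a b → :- (a :- b) := (:- a) :- (:- b)) refl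

  product-difference : ∀ a b c d →
    a ℚ.* b ℚ.- c ℚ.* d ≡ a ℚ.* (b ℚ.- d) ℚ.+ (a ℚ.- c) ℚ.* d
  product-difference = solve 4 (λ a b c d →
    a :* b :- c :* d := a :* (b :- d) :+ (a :- c) :* d) refl
    where open +-*-Solver

  ∣*∣-< : ∀ a d {A η} → 0ℚ ℚ.< A → ∣ a ∣ ℚ.≤ A → ∣ d ∣ ℚ.< η → ∣ a ℚ.* d ∣ ℚ.< A ℚ.* η
  ∣*∣-< a d {A} {η} 0<A a≤A d<η = begin-strict
    ∣ a ℚ.* d ∣          ≡⟨ ℚ.∣p*q∣≡∣p∣*∣q∣ a d ⟩
    ∣ a ∣ ℚ.* ∣ d ∣      ≤⟨ ℚ.*-monoʳ-≤-nonNeg ∣ d ∣ {{ℚ.∣-∣-nonNeg d}} a≤A ⟩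
    A ℚ.* ∣ d ∣          <⟨ ℚ.*-monoʳ-<-pos A {{pos 0<A}} d<η ⟩
    A ℚ.* η              ∎
    where open ℚ.≤-Reasoning

  product-close : ∀ a b c d {A B η} → 0ℚ ℚ.< A → 0ℚ ℚ.< B →
    ∣ a ∣ ℚ.≤ A → ∣ d ∣ ℚ.≤ B → ∣ a ℚ.- c ∣ ℚ.< η → ∣ b ℚ.- d ∣ ℚ.< η →
    ∣ a ℚ.* b ℚ.- c ℚ.* d ∣ ℚ.< A ℚ.* η ℚ.+ η ℚ.* B
  product-close a b c d {A} {B} {η} 0<A 0<B a≤A d≤B ac bd = begin-strict
    ∣ a ℚ.* b ℚ.- c ℚ.* d ∣                        ≡⟨ cong ∣_∣ (product-difference a b c d) ⟩
    ∣ a ℚ.* (b ℚ.- d) ℚ.+ (a ℚ.- c) ℚ.* d ∣        ≤⟨ ℚ.∣p+q∣≤∣p∣+∣q∣ (a ℚ.* (b ℚ.- d)) ((a ℚ.- c) ℚ.* d) ⟩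
    ∣ a ℚ.* (b ℚ.- d) ∣ ℚ.+ ∣ (a ℚ.- c) ℚ.* d ∣    <⟨ ℚ.+-mono-< (∣*∣-< a (b ℚ.- d) 0<A a≤A bd) right ⟩
    A ℚ.* η ℚ.+ η ℚ.* B                            ∎
    where
    open ℚ.≤-Reasoning
    right : ∣ (a ℚ.- c) ℚ.* d ∣ ℚ.< η ℚ.* B
    right = subst₂ ℚ._<_ (cong ∣_∣ (ℚ.*-comm d (a ℚ.- c))) (ℚ.*-comm B η)
      (∣*∣-< d (a ℚ.- c) 0<B d≤B ac)

  ∣∣-close : ∀ a b {η} → ∣ a ℚ.- b ∣ ℚ.≤ η → ∣ a ∣ ℚ.≤ η ℚ.+ ∣ b ∣
  ∣∣-close a b {η} ab = begin
    ∣ a ∣                          ≡⟨ cong ∣_∣ (split a b) ⟩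
    ∣ (a ℚ.- b) ℚ.+ b ∣            ≤⟨ ℚ.∣p+q∣≤∣p∣+∣q∣ (a ℚ.- b) b ⟩
    ∣ a ℚ.- b ∣ ℚ.+ ∣ b ∣          ≤⟨ ℚ.+-monoˡ-≤ ∣ b ∣ ab ⟩
    η ℚ.+ ∣ b ∣                    ∎
    where
    open ℚ.≤-Reasoning
    open +-*-Solver
    split : ∀ a b → a ≡ (a ℚ.- b) ℚ.+ b
    split = solve 2 (λ a b → a := (a :- b) :+ b) refl

  pos-inverse : ∀ {p} → 0ℚ ℚ.< p → ∃[ r ] (0ℚ ℚ.< r × p ℚ.* r ≡ 1ℚ)
  pos-inverse {p} 0<p = 1/ p , ℚ.positive⁻¹ (1/ p) {{ℚ.1/pos⇒pos p}} , ℚ.*-inverseʳ p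
    where
    instance
      _ = pos 0<p
      _ = ℚ.pos⇒nonZero p

  weight : ∀ {a b ε} → 0ℚ ℚ.< a → 0ℚ ℚ.< b → 0ℚ ℚ.< ε →
    ∃[ η ] (0ℚ ℚ.< η × a ℚ.* η ℚ.+ η ℚ.* b ≡ ε)
  weight {a} {b} {ε} 0<a 0<b 0<ε =
    let r , 0<r , inv = pos-inverse (ℚ.+-mono-< 0<a 0<b)
    in ε ℚ.* r , mul-pos 0<ε 0<r , (begin
      a ℚ.* (ε ℚ.* r) ℚ.+ (ε ℚ.* r) ℚ.* b      ≡⟨ collect a b ε r ⟩
      ε ℚ.* ((a ℚ.+ b) ℚ.* r)                  ≡⟨ cong (ε ℚ.*_) inv ⟩
      ε ℚ.* 1ℚ                                 ≡⟨ ℚ.*-identityʳ ε ⟩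
      ε                                        ∎)
    where
    open ≡-Reasoning
    open +-*-Solver
    collect : ∀ a b e i → a ℚ.* (e ℚ.* i) ℚ.+ (e ℚ.* i) ℚ.* b ≡ e ℚ.* ((a ℚ.+ b) ℚ.* i)
    collect = solve 4 (λ a b e i →
      a :* (e :* i) :+ (e :* i) :* b := e :* ((a :+ b) :* i)) refl

  bounded : ∀ {x} → IsCauchy x →
    ∃[ B ] (0ℚ ℚ.< B × ∃[ N ] (∀ n → N ℕ.≤ n → ∣ x n ∣ ℚ.≤ B))
  bounded {x} cx =
    let N , h = cx 1ℚ (ℚ.positive⁻¹ 1ℚ)
    in 1ℚ ℚ.+ ∣ x N ∣
       , ℚ.+-mono-<-≤ (ℚ.positive⁻¹ 1ℚ) (ℚ.0≤∣p∣ (x N))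
       , N , λ n N≤n → ∣∣-close (x n) (x N) (ℚ.<⇒≤ (h n N N≤n ℕ.≤-refl))

abstract
  const-cauchy : ∀ p → IsCauchy (λ _ → p)
  const-cauchy p ε 0<ε = 0 , λ _ _ _ _ →
    subst (λ d → ∣ d ∣ ℚ.< ε) (sym (ℚ.+-inverseʳ p)) 0<ε

  +-cauchy : ∀ {x y} → IsCauchy x → IsCauchy y → IsCauchy (λ n → x n ℚ.+ y n)
  +-cauchy {x} {y} cx cy ε 0<ε =
    let M , f = cx (ε ℚ.* ½) (half 0<ε)
        N , g = cy (ε ℚ.* ½) (half 0<ε)
    in M ℕ.⊔ N , λ m n p r →
      subst (∣ (x m ℚ.+ y m) ℚ.- (x n ℚ.+ y n) ∣ ℚ.<_) (half+half ε)
        (sum-close (x m) (y m) (x n) (y n)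
          (f m n (ℕ.m⊔n≤o⇒m≤o M N p) (ℕ.m⊔n≤o⇒m≤o M N r))
          (g m n (ℕ.m⊔n≤o⇒n≤o M N p) (ℕ.m⊔n≤o⇒n≤o M N r)))

  neg-cauchy : ∀ {x} → IsCauchy x → IsCauchy (λ n → ℚ.- x n)
  neg-cauchy {x} cx ε 0<ε =
    let N , f = cx ε 0<ε
    in N , λ m n p r → subst (ℚ._< ε) (∣-∣-neg (x m) (x n)) (f m n p r)

  *-cauchy : ∀ {x y} → IsCauchy x → IsCauchy y → IsCauchy (λ n → x n ℚ.* y n)
  *-cauchy {x} {y} cx cy ε 0<ε =
    let A , 0<A , K , hA  = bounded cx
        B , 0<B , L , hB  = bounded cy
        η , 0<η , Aη+ηB≡ε = weight 0<A 0<B 0<ε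
        M , f             = cx η 0<η
        N , g             = cy η 0<η
    in (K ℕ.⊔ L) ℕ.⊔ (M ℕ.⊔ N) , λ m n p r →
    let KL≤m = ℕ.m⊔n≤o⇒m≤o (K ℕ.⊔ L) (M ℕ.⊔ N) p
        KL≤n = ℕ.m⊔n≤o⇒m≤o (K ℕ.⊔ L) (M ℕ.⊔ N) r
        MN≤m = ℕ.m⊔n≤o⇒n≤o (K ℕ.⊔ L) (M ℕ.⊔ N) p
        MN≤n = ℕ.m⊔n≤o⇒n≤o (K ℕ.⊔ L) (M ℕ.⊔ N) r
    in subst (∣ x m ℚ.* y m ℚ.- x n ℚ.* y n ∣ ℚ.<_) Aη+ηB≡ε
         (product-close (x m) (y m) (x n) (y n) 0<A 0<B
           (hA m (ℕ.m⊔n≤o⇒m≤o K L KL≤m))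
           (hB n (ℕ.m⊔n≤o⇒n≤o K L KL≤n))
           (f m n (ℕ.m⊔n≤o⇒m≤o M N MN≤m) (ℕ.m⊔n≤o⇒m≤o M N MN≤n))
           (g m n (ℕ.m⊔n≤o⇒n≤o M N MN≤m) (ℕ.m⊔n≤o⇒n≤o M N MN≤n)))

-- Total reciprocal on ℚ.  A real x > 0 may have finitely many entries
-- equal to 0; the junk value there does not affect the real 1 / x.
recip : ℚ → ℚ
recip p with p ℚ.≟ 0ℚ
... | yes _   = 0ℚ
... | no  p≢0 = (1/ p) {{ℚ.≢-nonZero p≢0}}

recip-inverseʳ : ∀ {p} → p ≢ 0ℚ → p ℚ.* recip p ≡ 1ℚ
recip-inverseʳ {p} p≢0 with p ℚ.≟ 0ℚ
... | yes p≡0 = contradiction p≡0 p≢0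
... | no  p≢0 = ℚ.*-inverseʳ p {{ℚ.≢-nonZero p≢0}}

private
  recip-difference : ∀ a b u v → a ℚ.* u ≡ 1ℚ → b ℚ.* v ≡ 1ℚ →
    (u ℚ.- v) ℚ.* (a ℚ.* b) ≡ ℚ.- (a ℚ.- b)
  recip-difference a b u v au bv = begin
    (u ℚ.- v) ℚ.* (a ℚ.* b)               ≡⟨ regroup a b u v ⟩
    (a ℚ.* u) ℚ.* b ℚ.- (b ℚ.* v) ℚ.* a   ≡⟨ cong₂ (λ s t → s ℚ.* b ℚ.- t ℚ.* a) au bv ⟩
    1ℚ ℚ.* b ℚ.- 1ℚ ℚ.* a                 ≡⟨ cong₂ ℚ._-_ (ℚ.*-identityˡ b) (ℚ.*-identityˡ a) ⟩
    b ℚ.- a                               ≡⟨ swap a b ⟩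
    ℚ.- (a ℚ.- b)                         ∎
    where
    open ≡-Reasoning
    open +-*-Solver
    regroup : ∀ a b u v →
      (u ℚ.- v) ℚ.* (a ℚ.* b) ≡ (a ℚ.* u) ℚ.* b ℚ.- (b ℚ.* v) ℚ.* a
    regroup = solve 4 (λ a b u v →
      (u :- v) :* (a :* b) := (a :* u) :* b :- (b :* v) :* a) refl
    swap : ∀ a b → b ℚ.- a ≡ ℚ.- (a ℚ.- b)
    swap = solve 2 (λ a b → b :- a := :- (a :- b)) refl

  recip-close : ∀ a b {δ ε} → 0ℚ ℚ.< δ → δ ℚ.≤ a → δ ℚ.≤ b →
    ∣ a ℚ.- b ∣ ℚ.< ε ℚ.* (δ ℚ.* δ) → ∣ recip a ℚ.- recip b ∣ ℚ.< ε
  recip-close a b {δ} {ε} 0<δ δ≤a δ≤b ab = ℚ.*-cancelʳ-<-nonNeg (δ ℚ.* δ)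
    {{ℚ.pos⇒nonNeg (δ ℚ.* δ) {{pos (mul-pos 0<δ 0<δ)}}}} (begin-strict
      ∣ w ∣ ℚ.* (δ ℚ.* δ)       ≤⟨ ℚ.*-monoˡ-≤-nonNeg ∣ w ∣ {{ℚ.∣-∣-nonNeg w}} δδ≤ab ⟩
      ∣ w ∣ ℚ.* (a ℚ.* b)       ≡⟨ cong (∣ w ∣ ℚ.*_) (ℚ.0≤p⇒∣p∣≡p (ℚ.<⇒≤ (mul-pos 0<a 0<b))) ⟨
      ∣ w ∣ ℚ.* ∣ a ℚ.* b ∣     ≡⟨ ℚ.∣p*q∣≡∣p∣*∣q∣ w (a ℚ.* b) ⟨
      ∣ w ℚ.* (a ℚ.* b) ∣       ≡⟨ cong ∣_∣ (recip-difference a b _ _ (inv a 0<a) (inv b 0<b)) ⟩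
      ∣ ℚ.- (a ℚ.- b) ∣         ≡⟨ ℚ.∣-p∣≡∣p∣ (a ℚ.- b) ⟩
      ∣ a ℚ.- b ∣               <⟨ ab ⟩
      ε ℚ.* (δ ℚ.* δ)           ∎)
    where
    open ℚ.≤-Reasoning

    w : ℚ
    w = recip a ℚ.- recip b

    0<a : 0ℚ ℚ.< a
    0<a = ℚ.<-≤-trans 0<δ δ≤a

    0<b : 0ℚ ℚ.< b
    0<b = ℚ.<-≤-trans 0<δ δ≤b

    inv : ∀ p → 0ℚ ℚ.< p → p ℚ.* recip p ≡ 1ℚ
    inv p 0<p = recip-inverseʳ (λ p≡0 → ℚ.<-irrefl (sym p≡0) 0<p)

    δδ≤ab : δ ℚ.* δ ℚ.≤ a ℚ.* b
    δδ≤ab = ℚ.≤-trans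
      (ℚ.*-monoˡ-≤-nonNeg δ {{nonNegative (ℚ.<⇒≤ 0<δ)}} δ≤b)
      (ℚ.*-monoʳ-≤-nonNeg b {{nonNegative (ℚ.<⇒≤ 0<b)}} δ≤a)

abstract
  recip-cauchy : ∀ {x δ K} → IsCauchy x → 0ℚ ℚ.< δ →
    (∀ n → K ℕ.≤ n → δ ℚ.≤ x n) → IsCauchy (λ n → recip (x n))
  recip-cauchy {x} {δ} {K} cx 0<δ δ≤x ε 0<ε =
    let N , f = cx (ε ℚ.* (δ ℚ.* δ)) (mul-pos 0<ε (mul-pos 0<δ 0<δ))
    in K ℕ.⊔ N , λ m n p r →
      recip-close (x m) (x n) 0<δ
        (δ≤x m (ℕ.m⊔n≤o⇒m≤o K N p)) (δ≤x n (ℕ.m⊔n≤o⇒m≤o K N r))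
        (f m n (ℕ.m⊔n≤o⇒n≤o K N p) (ℕ.m⊔n≤o⇒n≤o K N r))

module Real where
  infix  8 -_
  infixl 7 _*_
  infixl 6 _+_ _-_
  infix  4 _≈_ _<_

  _≈_ : ℝ → ℝ → Set
  x ≈ y = ∀ ε → 0ℚ ℚ.< ε → ∃[ N ] (∀ n → N ℕ.≤ n → ∣ seq x n ℚ.- seq y n ∣ ℚ.< ε)

  _<_ : ℝ → ℝ → Set
  x < y = ∃[ δ ] (0ℚ ℚ.< δ × ∃[ N ] (∀ n → N ℕ.≤ n → seq x n ℚ.+ δ ℚ.≤ seq y n))

  fromℚ : ℚ → ℝ
  fromℚ p = mkℝ (λ _ → p) (const-cauchy p)

  _+_ _*_ : ℝ → ℝ → ℝ
  x + y = mkℝ (λ n → seq x n ℚ.+ seq y n) (+-cauchy {seq x} {seq y} (cauchy x) (cauchy y))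
  x * y = mkℝ (λ n → seq x n ℚ.* seq y n) (*-cauchy {seq x} {seq y} (cauchy x) (cauchy y))

  -_ : ℝ → ℝ
  - x = mkℝ (λ n → ℚ.- seq x n) (neg-cauchy {seq x} (cauchy x))

  _-_ : ℝ → ℝ → ℝ
  x - y = x + (- y)

  0# 1# : ℝ
  0# = fromℚ 0ℚ
  1# = fromℚ 1ℚ

  inverse : (x : ℝ) → 0# < x → ℝ
  inverse x (δ , 0<δ , N , h) = mkℝ (λ n → recip (seq x n))
    (recip-cauchy {seq x} (cauchy x) 0<δ
      (λ n N≤n → subst (ℚ._≤ seq x n) (ℚ.+-identityˡ δ) (h n N≤n)))

------------------------------------------------------------------------
-- Complex numbers

record ℂ : Set where
  constructor _+i_
  field
    re im : ℝ

open ℂ public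

infix  8 -_
infixl 7 _*_
infixl 6 _+_ _-_
infix  4 _≈_ _#0 ∣_∣<_

_≈_ : ℂ → ℂ → Set
z ≈ w = (re z Real.≈ re w) × (im z Real.≈ im w)

_+_ _*_ : ℂ → ℂ → ℂ
(a +i b) + (c +i d) = (a Real.+ c) +i (b Real.+ d)
(a +i b) * (c +i d) = (a Real.* c Real.- b Real.* d) +i (a Real.* d Real.+ b Real.* c)

-_ : ℂ → ℂ
- (a +i b) = (Real.- a) +i (Real.- b)

_-_ : ℂ → ℂ → ℂ
z - w = z + (- w)

0# 1# : ℂ
0# = Real.0# +i Real.0#
1# = Real.1# +i Real.0#

rawRing : RawRing 0ℓ 0ℓ
rawRing = record
  { Carrier = ℂ ; _≈_ = _≈_ ; _+_ = _+_ ; _*_ = _*_ ; -_ = -_ ; 0# = 0# ; 1# = 1# }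

open RawSemiringDefinitions (RawRing.rawSemiring rawRing) public
  using (_^_; sum; product)

normSq : ℂ → ℝ
normSq (a +i b) = a Real.* a Real.+ b Real.* b

-- |z| < r, with both sides squared so that no square root is needed.
∣_∣<_ : ℂ → ℚ → Set
∣ z ∣< r = 0ℚ ℚ.< r × normSq z Real.< Real.fromℚ (r ℚ.* r)

-- Being nonzero, in the positive (constructive) sense needed to divide.
_#0 : ℂ → Set
z #0 = Real.0# Real.< normSq z

inverse : (z : ℂ) → z #0 → ℂ
inverse (a +i b) z#0 = (a Real.* r) +i (Real.- b Real.* r)
  where r = Real.inverse (normSq (a +i b)) z#0

infixl 7 _/_[_]
_/_[_] : ℂ → (w : ℂ) → w #0 → ℂ
z / w [ w#0 ] = z * inverse w w#0

------------------------------------------------------------------------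
-- Limits, series and q-Pochhammer symbols

infix 4 _⟶_
_⟶_ : (ℕ → ℂ) → ℂ → Set
s ⟶ l = ∀ ε → 0ℚ ℚ.< ε → ∃[ N ] (∀ n → N ℕ.≤ n → ∣ s n - l ∣< ε)

Series_≔_ : (ℕ → ℂ) → ℂ → Set
Series f ≔ l = (λ N → sum {N} (λ i → f (toℕ i))) ⟶ l

infix 4 Series_≔_ ⟨_⨾_⟩∞≔_

⟨_⨾_⟩_ : ℂ → ℂ → ℕ → ℂ
⟨ x ⨾ q ⟩ n = product {n} (λ j → 1# - x * q ^ toℕ j)

-- P is the value of the infinite product (x;q)_∞.
⟨_⨾_⟩∞≔_ : ℂ → ℂ → ℂ → Set
⟨ x ⨾ q ⟩∞≔ P = (λ n → ⟨ x ⨾ q ⟩ n) ⟶ P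

{-# OPTIONS --safe #-}
module Submission where

-- Let Φ₆(x) = 1 - x + x² = (1 - zx)(1 - x/z) with z a primitive sixth root of
-- unity, let c_r = (-1)^r (z^{-r} + ... + z^r) = 1, -2, 1, 1, -2, 1, ... and
-- t_r = r(r+1)/2.  Since (-q³;q³)_n / (-q;q)_n = ∏_{j≤n} Φ₆(q^j), the finite
-- Jacobi triple product gives
--   ∏_{j≤n} Φ₆(q^j) / (q;q)_{2n+1} = ∑_r c_r q^{t_r} / ((q;q)_{n-r} (q;q)_{n+r+1}),
-- a Bailey pair relative to q.  Letting n → ∞ yields
--   ∑_r c_r q^{t_r} = (q;q)_∞ ∏_j Φ₆(q^j),
-- while inserting the pair into the Bailey lemma turns the left-hand side of the
-- theorem into ∑_r c_r q^{3t_r} / (q;q)_∞, which is the same theta series at q³.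
-- Finally ∏_j Φ₆(q^j) = (q;q⁶)_∞ (q⁵;q⁶)_∞ by sorting exponents modulo 6.

open import Algebra.Bundles using (CommutativeRing; Semiring)
import Algebra.Definitions.RawSemiring
open import Algebra.Solver.Ring.AlmostCommutativeRing
  using (fromCommutativeRing; _-Raw-AlmostCommutative⟶_)
open import Data.Fin.Base using (toℕ)
open import Data.Integer.Base as ℤ using (ℤ; -[1+_]; _⊖_)
import Data.Integer.Properties as ℤ
open import Data.Maybe.Base using (Maybe; just; nothing)
open import Data.Nat.Base as ℕ using (ℕ; zero; suc)
import Data.Nat.Properties as ℕ
import Data.Nat.Solver as ℕ
open import Data.Product.Base using (Σ-syntax; ∃-syntax; _×_; _,_; proj₁; proj₂)
open import Data.Rational.Base as ℚ using (ℚ; 0ℚ; 1ℚ; ½; ∣_∣)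
import Data.Rational.Literals as Literals
import Data.Rational.Properties as ℚ
open import Data.Rational.Solver using (module +-*-Solver)
import Data.Rational.Unnormalised.Base as ℚᵘ
import Data.Rational.Unnormalised.Properties as ℚᵘ
open import Data.Sum.Base using (inj₁; inj₂)
open import Level using (Level; 0ℓ)
import Relation.Binary.PropositionalEquality as ≡
open ≡ using (_≡_)
import Relation.Binary.Reasoning.Setoid
open import Relation.Nullary using (yes; no; contradiction)

-- The sixth root z never enters: since z + 1/z = 1, the coefficients satisfy c_(r+1) + c_(r-1) =
-- -c_r, and this together with c_(-1) = c_0 carries an induction on n in any commutative ring.
-- Denominators occur only as a sequence `I` with (1 - p^(n+1)) I_(n+1) = I_n, so the finite
-- identities are free of division and include p = 0.
--
-- The obstacle is analytic: on Cauchy sequences of rationals equality is undecidable, square roots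
-- are not at hand, and every limit needs a witness. Limits are therefore taken at a fixed rate σ^n,
-- so that they combine by arithmetic on constants, and sizes are bounded by rationals through the
-- ℓ¹ norm of ℂ. The infinite product (p;p)_∞ comes with its inverse, the limit of `I`, so
-- nonvanishing never rests on lower bounds for partial products. Sums over r are convolutions over
-- r + l = n with a kernel converging in l uniformly in r; extra decay in r justifies the passage to
-- the limit.

module Exponents where
  open ℕ.+-*-Solver
  open ≡ using (refl; trans; cong)

  vandermonde-exponent₁ : ∀ i k → i ℕ.* (i ℕ.+ suc k) ℕ.+ suc (i ℕ.+ k) ≡ suc i ℕ.* (suc i ℕ.+ k)
  vandermonde-exponent₁ = solve 2 (λ i k →
    i :* (i :+ (con 1 :+ k)) :+ (con 1 :+ (i :+ k)) := (con 1 :+ i) :* ((con 1 :+ i) :+ k)) refl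

  vandermonde-exponent₂ : ∀ i k → i ℕ.* (i ℕ.+ k) ℕ.+ i ≡ i ℕ.* (i ℕ.+ suc k)
  vandermonde-exponent₂ = solve 2 (λ i k →
    i :* (i :+ k) :+ i := i :* (i :+ (con 1 :+ k))) refl

  split-exponent : ∀ r l n → (r ℕ.+ l) ℕ.+ suc n ≡ l ℕ.+ suc (r ℕ.+ n)
  split-exponent = solve 3 (λ r l n →
    (r :+ l) :+ (con 1 :+ n) := l :+ (con 1 :+ (r :+ n))) refl

  upper-exponent : ∀ r m → suc (suc (r ℕ.+ suc m)) ≡ suc r ℕ.+ suc (suc m)
  upper-exponent = solve 2 (λ r m →
    con 2 :+ (r :+ (con 1 :+ m)) := (con 1 :+ r) :+ (con 2 :+ m)) refl

  bailey-exponent : ∀ r m →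
    (r ℕ.+ m) ℕ.* ((r ℕ.+ m) ℕ.+ 1) ≡ r ℕ.* (r ℕ.+ 1) ℕ.+ m ℕ.* (m ℕ.+ suc (r ℕ.+ r))
  bailey-exponent = solve 2 (λ r m →
    (r :+ m) :* ((r :+ m) :+ con 1) := r :* (r :+ con 1) :+ m :* (m :+ (con 1 :+ (r :+ r)))) refl

  bailey-index : ∀ r m → suc (r ℕ.+ (r ℕ.+ m)) ≡ m ℕ.+ suc (r ℕ.+ r)
  bailey-index = solve 2 (λ r m → con 1 :+ (r :+ (r :+ m)) := m :+ (con 1 :+ (r :+ r))) refl

  tri-step : ∀ r t → (suc r ℕ.+ t) ℕ.+ suc r ℕ.* (suc r ℕ.+ 1) ≡
    (t ℕ.+ r ℕ.* (r ℕ.+ 1)) ℕ.+ 3 ℕ.* suc r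
  tri-step = solve 2 (λ r t →
    ((con 1 :+ r) :+ t) :+ (con 1 :+ r) :* ((con 1 :+ r) :+ con 1) :=
    (t :+ r :* (r :+ con 1)) :+ con 3 :* (con 1 :+ r)) refl

  residue₁ : ∀ i n → suc (i ℕ.+ n ℕ.* 6) ≡ suc i ℕ.+ 6 ℕ.* n
  residue₁ = solve 2 (λ i n → con 1 :+ (i :+ n :* con 6) := (con 1 :+ i) :+ con 6 :* n) refl

  residue₂ : ∀ i n → 2 ℕ.* suc (i ℕ.+ n ℕ.* 3) ≡ 2 ℕ.* suc i ℕ.+ 6 ℕ.* n
  residue₂ = solve 2 (λ i n →
    con 2 :* (con 1 :+ (i :+ n :* con 3)) := con 2 :* (con 1 :+ i) :+ con 6 :* n) refl

  residue₃ : ∀ i n → 3 ℕ.* suc (i ℕ.+ n ℕ.* 2) ≡ 3 ℕ.* suc i ℕ.+ 6 ℕ.* n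
  residue₃ = solve 2 (λ i n →
    con 3 :* (con 1 :+ (i :+ n :* con 2)) := con 3 :* (con 1 :+ i) :+ con 6 :* n) refl

  residue₆ : ∀ n → 6 ℕ.* suc n ≡ 6 ℕ.+ 6 ℕ.* n
  residue₆ = solve 1 (λ n → con 6 :* (con 1 :+ n) := con 6 :+ con 6 :* n) refl

  tri : ℕ → ℕ
  tri zero    = 0
  tri (suc n) = suc n ℕ.+ tri n

  -- As r(r+1) is twice `tri r`, the Bailey weight p^(r(r+1)) triples the theta exponent; this is
  -- where p turns into p³.
  tri-triple : ∀ r → tri r ℕ.+ r ℕ.* (r ℕ.+ 1) ≡ 3 ℕ.* tri r
  tri-triple zero    = refl
  tri-triple (suc r) = trans (tri-step r (tri r)) (trans
    (cong (ℕ._+ 3 ℕ.* suc r) (tri-triple r))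
    (solve 2 (λ a b → con 3 :* a :+ con 3 :* b := con 3 :* (b :+ a)) refl (tri r) (suc r)))

  odd-index : ∀ n → 2 ℕ.* n ℕ.+ 1 ≡ suc (n ℕ.+ n)
  odd-index = solve 1 (λ n → con 2 :* n :+ con 1 := con 1 :+ (n :+ n)) refl

open Exponents

-- Rational arithmetic

module RationalBounds where
  open import Data.Rational.Base
  open import Data.Rational.Properties
  open +-*-Solver
  open import Relation.Binary.PropositionalEquality
  open import Algebra.Properties.Semiring.Exp (CommutativeRing.semiring +-*-commutativeRing) public
    using () renaming (_^_ to _^ℚ_; ^-homo-* to ^ℚ-homo-*)
  open ≤-Reasoning

  *-mono₂-≤ : ∀ {p q r s} → 0ℚ ≤ r → 0ℚ ≤ q → p ≤ q → r ≤ s → p * r ≤ q * s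
  *-mono₂-≤ {p} {q} {r} {s} 0≤r 0≤q p≤q r≤s = ≤-trans
    (*-monoʳ-≤-nonNeg r {{nonNegative 0≤r}} p≤q) (*-monoˡ-≤-nonNeg q {{nonNegative 0≤q}} r≤s)

  0≤* : ∀ {p q} → 0ℚ ≤ p → 0ℚ ≤ q → 0ℚ ≤ p * q
  0≤* {p} {q} 0≤p 0≤q = subst (_≤ p * q) (*-zeroʳ p) (*-monoˡ-≤-nonNeg p {{nonNegative 0≤p}} 0≤q)

  0<* : ∀ {p q} → 0ℚ < p → 0ℚ < q → 0ℚ < p * q
  0<* {p} {q} 0<p 0<q = subst (_< p * q) (*-zeroʳ p) (*-monoʳ-<-pos p {{positive 0<p}} 0<q)

  0≤+ : ∀ {p q} → 0ℚ ≤ p → 0ℚ ≤ q → 0ℚ ≤ p + q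
  0≤+ 0≤p 0≤q = +-mono-≤ 0≤p 0≤q

  ≤⇒0≤- : ∀ {p q} → p ≤ q → 0ℚ ≤ q - p
  ≤⇒0≤- {p} {q} p≤q = subst (_≤ q - p) (+-inverseʳ p) (+-monoˡ-≤ (- p) p≤q)

  <⇒0<- : ∀ {p q} → p < q → 0ℚ < q - p
  <⇒0<- {p} {q} p<q = subst (_< q - p) (+-inverseʳ p) (+-monoˡ-< (- p) p<q)

  p≤p+q : ∀ p {q} → 0ℚ ≤ q → p ≤ p + q
  p≤p+q p {q} 0≤q = subst (_≤ p + q) (+-identityʳ p) (+-monoʳ-≤ p 0≤q)

  ≤-fromε : ∀ {p q} → (∀ ε → 0ℚ < ε → p ≤ q + ε) → p ≤ q
  ≤-fromε {p} {q} h with p ≤? q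
  ... | yes p≤q = p≤q
  ... | no  p≰q = contradiction (≤-<-trans (h ε 0<ε) q+ε<p) (<-irrefl refl)
    where
    ε : ℚ
    ε = (p - q) * ½
    0<ε : 0ℚ < ε
    0<ε = 0<* (<⇒0<- (≰⇒> p≰q)) (positive⁻¹ ½)
    q+ε<p : q + ε < p
    q+ε<p = begin-strict
      q + ε        <⟨ +-monoʳ-< q (subst (_< ε + ε) (+-identityʳ ε) (+-monoʳ-< ε 0<ε)) ⟩
      q + (ε + ε)  ≡⟨ cong (q +_) (trans (sym (*-distribˡ-+ (p - q) ½ ½)) (*-identityʳ (p - q))) ⟩
      q + (p - q)  ≡⟨ solve 2 (λ p q → q :+ (p :- q) := p) refl p q ⟩
      p            ∎

  abstract
    reciprocal : ∀ {p} → 0ℚ < p → ∃[ r ] (0ℚ < r × p * r ≡ 1ℚ)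
    reciprocal {p} 0<p = 1/ p , positive⁻¹ (1/ p) {{1/pos⇒pos p}} , *-inverseʳ p
      where
      instance
        p-positive : Positive p
        p-positive = positive 0<p
        p-nonZero : NonZero p
        p-nonZero = pos⇒nonZero p

  fromℕ : ℕ → ℚ
  fromℕ n = Literals.fromℤ (ℤ.+ n)

  fromℕ-suc : ∀ n → fromℕ (suc n) ≡ 1ℚ + fromℕ n
  fromℕ-suc n = toℚᵘ-injective (ℚᵘ.≃-sym (ℚᵘ.≃-trans (toℚᵘ-homo-+ 1ℚ (fromℕ n))
    (ℚᵘ.*≡* (cong (λ z → (ℤ.1ℤ ℤ.+ z) ℤ.* ℤ.1ℤ) (ℤ.*-identityʳ (ℤ.+ n))))))

  abstract
    archimedean : ∀ p → ∃[ n ] p ≤ fromℕ n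
    -- The denominator is at least 1, so the absolute value of the numerator already bounds `p`.
    archimedean p = ℤ.∣ ↥ p ∣ , *≤* (ℤ.≤-trans
      (ℤ.≤-reflexive (ℤ.*-identityʳ (↥ p)))
      (ℤ.≤-trans (≤-abs (↥ p)) (subst (ℤ._≤ a ℤ.* ↧ p) (ℤ.*-identityʳ a)
        (ℤ.*-monoˡ-≤-nonNeg a {ℤ.1ℤ} {↧ p} (ℤ.+≤+ (ℕ.s≤s ℕ.z≤n))))))
      where
      a : ℤ.ℤ
      a = ℤ.+ ℤ.∣ ↥ p ∣
      ≤-abs : ∀ i → i ℤ.≤ ℤ.+ ℤ.∣ i ∣
      ≤-abs (ℤ.+ n)    = ℤ.≤-refl
      ≤-abs ℤ.-[1+ n ] = ℤ.-≤+

  ^-nonNeg : ∀ {σ} → 0ℚ ≤ σ → ∀ n → 0ℚ ≤ σ ^ℚ n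
  ^-nonNeg 0≤σ zero    = nonNegative⁻¹ 1ℚ
  ^-nonNeg 0≤σ (suc n) = 0≤* 0≤σ (^-nonNeg 0≤σ n)

  ^-≤1 : ∀ {σ} → 0ℚ ≤ σ → σ ≤ 1ℚ → ∀ n → σ ^ℚ n ≤ 1ℚ
  ^-≤1 0≤σ σ≤1 zero    = ≤-refl
  ^-≤1 0≤σ σ≤1 (suc n) = *-mono₂-≤ (^-nonNeg 0≤σ n) (nonNegative⁻¹ 1ℚ) σ≤1 (^-≤1 0≤σ σ≤1 n)

  ^-antimono : ∀ {σ} → 0ℚ ≤ σ → σ ≤ 1ℚ → ∀ {m n} → m ℕ.≤ n → σ ^ℚ n ≤ σ ^ℚ m
  ^-antimono {σ} 0≤σ σ≤1 {m} {n} m≤n = begin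
    σ ^ℚ n                    ≡⟨ cong (σ ^ℚ_) (ℕ.m+[n∸m]≡n m≤n) ⟨
    σ ^ℚ (m ℕ.+ (n ℕ.∸ m))    ≡⟨ ^ℚ-homo-* σ m (n ℕ.∸ m) ⟩
    σ ^ℚ m * σ ^ℚ (n ℕ.∸ m)    ≤⟨ *-monoˡ-≤-nonNeg (σ ^ℚ m) {{nonNegative (^-nonNeg 0≤σ m)}}
                                  (^-≤1 0≤σ σ≤1 (n ℕ.∸ m)) ⟩
    σ ^ℚ m * 1ℚ               ≡⟨ *-identityʳ (σ ^ℚ m) ⟩
    σ ^ℚ m                    ∎

  -- Bernoulli's inequality for 1 / σ, cleared of denominators.
  bernoulli : ∀ {σ} → 0ℚ ≤ σ → σ ≤ 1ℚ → ∀ n → σ ^ℚ n * (1ℚ + fromℕ n * (1ℚ - σ)) ≤ 1ℚ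
  bernoulli {σ} 0≤σ σ≤1 zero = ≤-reflexive
    (solve 1 (λ h → con 1ℚ :* (con 1ℚ :+ con 0ℚ :* h) := con 1ℚ) refl (1ℚ - σ))
  bernoulli {σ} 0≤σ σ≤1 (suc n) = begin
    σ * σ ^ℚ n * (1ℚ + fromℕ (suc n) * (1ℚ - σ))
      ≡⟨ cong (λ k → σ * σ ^ℚ n * (1ℚ + k * (1ℚ - σ))) (fromℕ-suc n) ⟩
    σ * σ ^ℚ n * (1ℚ + (1ℚ + k) * (1ℚ - σ))
      ≡⟨ solve 3 (λ s x k →
           s :* x :* (con 1ℚ :+ (con 1ℚ :+ k) :* (con 1ℚ :- s)) :=
           x :* (con 1ℚ :+ k :* (con 1ℚ :- s)) :-
           x :* ((con 1ℚ :- s) :* (con 1ℚ :- s) :* (con 1ℚ :+ k))) refl σ (σ ^ℚ n) k ⟩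
    σ ^ℚ n * (1ℚ + k * (1ℚ - σ)) - σ ^ℚ n * ((1ℚ - σ) * (1ℚ - σ) * (1ℚ + k))
      ≤⟨ +-monoʳ-≤ (σ ^ℚ n * (1ℚ + k * (1ℚ - σ))) (neg-antimono-≤ nonneg) ⟩
    σ ^ℚ n * (1ℚ + k * (1ℚ - σ)) - 0ℚ
      ≡⟨ +-identityʳ _ ⟩
    σ ^ℚ n * (1ℚ + k * (1ℚ - σ))
      ≤⟨ bernoulli 0≤σ σ≤1 n ⟩
    1ℚ
      ∎
    where
    k : ℚ
    k = fromℕ n
    nonneg : 0ℚ ≤ σ ^ℚ n * ((1ℚ - σ) * (1ℚ - σ) * (1ℚ + k))
    nonneg = 0≤* (^-nonNeg 0≤σ n) (0≤* (0≤* (≤⇒0≤- σ≤1) (≤⇒0≤- σ≤1))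
      (0≤+ (nonNegative⁻¹ 1ℚ) (nonNegative⁻¹ k)))

  abstract
    -- An N above C / (ε (1 - σ)) works: `bernoulli` bounds σ^N by 1 / (1 + N (1 - σ)), and later
    -- powers are smaller.
    ^-small : ∀ {σ C ε} → 0ℚ ≤ σ → σ < 1ℚ → 0ℚ ≤ C → 0ℚ < ε → ∃[ N ] (∀ n → N ℕ.≤ n → C * σ ^ℚ n ≤ ε)
    ^-small {σ} {C} {ε} 0≤σ σ<1 0≤C 0<ε =
      let r , 0<r , hr≡1 = reciprocal (<⇒0<- σ<1)
          s , 0<s , εs≡1 = reciprocal 0<ε
          N , C≤N        = archimedean (C * (r * s))
          large : C ≤ ε * (1ℚ + fromℕ N * (1ℚ - σ))
          large = begin
            C                                     ≡⟨ solve 1 (λ C → C := con 1ℚ :* (con 1ℚ :* C)) refl C ⟩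
            1ℚ * (1ℚ * C)                         ≡⟨ cong₂ (λ a b → a * (b * C)) εs≡1 hr≡1 ⟨
            (ε * s) * (((1ℚ - σ) * r) * C)
              ≡⟨ solve 5 (λ e s h r C → (e :* s) :* ((h :* r) :* C) := e :* ((C :* (r :* s)) :* h)) refl
                   ε s (1ℚ - σ) r C ⟩
            ε * (C * (r * s) * (1ℚ - σ))
              ≤⟨ *-monoˡ-≤-nonNeg ε {{nonNegative (<⇒≤ 0<ε)}}
                   (*-monoʳ-≤-nonNeg (1ℚ - σ) {{nonNegative (<⇒≤ (<⇒0<- σ<1))}} C≤N) ⟩
            ε * (fromℕ N * (1ℚ - σ))
              ≤⟨ *-monoˡ-≤-nonNeg ε {{nonNegative (<⇒≤ 0<ε)}}
                   (subst (_≤ 1ℚ + fromℕ N * (1ℚ - σ)) (+-identityˡ _)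
                     (+-monoˡ-≤ (fromℕ N * (1ℚ - σ)) (nonNegative⁻¹ 1ℚ))) ⟩
            ε * (1ℚ + fromℕ N * (1ℚ - σ))         ∎
      in N , λ n N≤n → begin
        C * σ ^ℚ n
          ≤⟨ *-monoˡ-≤-nonNeg C {{nonNegative 0≤C}} (^-antimono 0≤σ (<⇒≤ σ<1) N≤n) ⟩
        C * σ ^ℚ N
          ≤⟨ *-monoʳ-≤-nonNeg (σ ^ℚ N) {{nonNegative (^-nonNeg 0≤σ N)}} large ⟩
        ε * (1ℚ + fromℕ N * (1ℚ - σ)) * σ ^ℚ N
          ≡⟨ solve 3 (λ e a b → e :* a :* b := e :* (b :* a)) refl ε (1ℚ + fromℕ N * (1ℚ - σ)) (σ ^ℚ N) ⟩
        ε * (σ ^ℚ N * (1ℚ + fromℕ N * (1ℚ - σ)))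
          ≤⟨ *-monoˡ-≤-nonNeg ε {{nonNegative (<⇒≤ 0<ε)}} (bernoulli 0≤σ (<⇒≤ σ<1) N) ⟩
        ε * 1ℚ
          ≡⟨ *-identityʳ ε ⟩
        ε
          ∎

  abstract
    geometric-products-bounded : ∀ {σ W} → 0ℚ ≤ σ → σ < 1ℚ → 0ℚ ≤ W → (u : ℕ → ℚ) →
      0ℚ ≤ u 0 → (∀ n → u (suc n) ≡ u n * (1ℚ + W * σ ^ℚ n)) → ∃[ K ] (∀ n → u n ≤ K)
    geometric-products-bounded {σ} {W} 0≤σ σ<1 0≤W u 0≤u₀ u-suc =
      let r , 0<r , hr≡1 = reciprocal (<⇒0<- σ<1)
          0≤M = 0≤* 0≤W (<⇒≤ 0<r)
          J , small = ^-small {C = W * r} 0≤σ σ<1 0≤M (positive⁻¹ ½)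
      in u J * fromℕ 2 , bound (W * r) J 0≤M
        (trans (*-assoc W r (1ℚ - σ)) (trans (cong (W *_) (trans (*-comm r (1ℚ - σ)) hr≡1)) (*-identityʳ W)))
        (small J ℕ.≤-refl)
      where
      0≤factor : ∀ n → 0ℚ ≤ 1ℚ + W * σ ^ℚ n
      0≤factor n = 0≤+ (nonNegative⁻¹ 1ℚ) (0≤* 0≤W (^-nonNeg 0≤σ n))
      0≤u : ∀ n → 0ℚ ≤ u n
      0≤u zero    = 0≤u₀
      0≤u (suc n) = subst (0ℚ ≤_) (sym (u-suc n)) (0≤* (0≤u n) (0≤factor n))
      0≤2u : ∀ n → 0ℚ ≤ u n * fromℕ 2
      0≤2u n = 0≤* (0≤u n) (nonNegative⁻¹ (fromℕ 2))
      u≤u-suc : ∀ n → u n ≤ u (suc n)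
      u≤u-suc n = begin
        u n                      ≡⟨ *-identityʳ (u n) ⟨
        u n * 1ℚ                 ≤⟨ *-monoˡ-≤-nonNeg (u n) {{nonNegative (0≤u n)}}
                                      (p≤p+q 1ℚ (0≤* 0≤W (^-nonNeg 0≤σ n))) ⟩
        u n * (1ℚ + W * σ ^ℚ n)   ≡⟨ u-suc n ⟨
        u (suc n)                ∎
      monotone : ∀ n k → u n ≤ u (n ℕ.+ k)
      monotone n zero    = ≤-reflexive (cong u (sym (ℕ.+-identityʳ n)))
      monotone n (suc k) = ≤-trans (monotone n k)
        (≤-trans (u≤u-suc (n ℕ.+ k)) (≤-reflexive (cong u (sym (ℕ.+-suc n k)))))

      bound : ∀ M J → 0ℚ ≤ M → M * (1ℚ - σ) ≡ W → M * σ ^ℚ J ≤ ½ → ∀ n → u n ≤ u J * fromℕ 2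
      bound M J 0≤M Mh≡W small n = begin
        u n                                  ≤⟨ monotone n J ⟩
        u (n ℕ.+ J)                          ≤⟨ sharp n ⟩
        2u * (1ℚ - M * σ ^ℚ (n ℕ.+ J))
          ≤⟨ *-monoˡ-≤-nonNeg 2u {{nonNegative (0≤2u J)}} (+-monoʳ-≤ 1ℚ (neg-antimono-≤
               (0≤* 0≤M (^-nonNeg 0≤σ (n ℕ.+ J))))) ⟩
        2u * 1ℚ                              ≡⟨ *-identityʳ 2u ⟩
        2u                                   ∎
        where
        2u : ℚ
        2u = u J * fromℕ 2
        sharp : ∀ k → u (k ℕ.+ J) ≤ 2u * (1ℚ - M * σ ^ℚ (k ℕ.+ J))
        sharp zero = begin
          u J                      ≡⟨ solve 1 (λ u → u := (u :* con (fromℕ 2)) :* (con 1ℚ :- con ½)) refl (u J) ⟩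
          2u * (1ℚ - ½)            ≤⟨ *-monoˡ-≤-nonNeg 2u {{nonNegative (0≤2u J)}}
                                        (+-monoʳ-≤ 1ℚ (neg-antimono-≤ small)) ⟩
          2u * (1ℚ - M * σ ^ℚ J)    ∎
        sharp (suc k) = begin
          u (suc (k ℕ.+ J))                    ≡⟨ u-suc (k ℕ.+ J) ⟩
          u (k ℕ.+ J) * (1ℚ + W * x)           ≤⟨ *-monoʳ-≤-nonNeg (1ℚ + W * x) {{nonNegative (0≤factor (k ℕ.+ J))}} (sharp k) ⟩
          2u * (1ℚ - M * x) * (1ℚ + W * x)
            ≡⟨ solve 5 (λ u M x W s →
                 u :* (con 1ℚ :- M :* x) :* (con 1ℚ :+ W :* x) :=
                 u :* (con 1ℚ :- M :* (s :* x)) :+ u :* x :* (W :- M :* (con 1ℚ :- s)) :-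
                 u :* (M :* x :* (W :* x))) refl 2u M x W σ ⟩
          2u * (1ℚ - M * (σ * x)) + 2u * x * (W - M * (1ℚ - σ)) - 2u * (M * x * (W * x))
            ≡⟨ cong (λ t → 2u * (1ℚ - M * (σ * x)) + 2u * x * (W - t) - 2u * (M * x * (W * x))) Mh≡W ⟩
          2u * (1ℚ - M * (σ * x)) + 2u * x * (W - W) - 2u * (M * x * (W * x))
            ≤⟨ +-monoʳ-≤ (2u * (1ℚ - M * (σ * x)) + 2u * x * (W - W)) (neg-antimono-≤
                 (0≤* (0≤2u J) (0≤* (0≤* 0≤M (^-nonNeg 0≤σ (k ℕ.+ J)))
                                    (0≤* 0≤W (^-nonNeg 0≤σ (k ℕ.+ J)))))) ⟩
          2u * (1ℚ - M * (σ * x)) + 2u * x * (W - W) - 0ℚ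
            ≡⟨ solve 4 (λ u y x W → u :* y :+ u :* x :* (W :- W) :- con 0ℚ := u :* y) refl 2u (1ℚ - M * (σ * x)) x W ⟩
          2u * (1ℚ - M * (σ * x))
            ∎
          where
          x : ℚ
          x = σ ^ℚ (k ℕ.+ J)

open RationalBounds

-- A polynomial solver over any commutative ring, with integer coefficients

module IntegerCoefficients {c ℓ : Level} (R : CommutativeRing c ℓ) where
  open import Data.Integer.Base using (+_)
  open CommutativeRing R
  open import Algebra.Properties.Semiring.Mult.TCOptimised semiring
    using (×-homo-+; ×1-homo-*; 1+×) renaming (_×_ to _·_)
  open import Algebra.Properties.Ring ring
    using (-‿distribˡ-*; -‿distribʳ-*; -‿involutive; -0#≈0#)
  open import Algebra.Properties.AbelianGroup +-abelianGroup using (⁻¹-∙-comm)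
  open import Relation.Binary.Reasoning.Setoid setoid

  fromℤ : ℤ → Carrier
  fromℤ (+ n)    = n · 1#
  fromℤ -[1+ n ] = - (suc n · 1#)

  fromℤ-neg : ∀ i → fromℤ (ℤ.- i) ≈ - fromℤ i
  fromℤ-neg (+ zero)  = sym -0#≈0#
  fromℤ-neg (+ suc n) = refl
  fromℤ-neg -[1+ n ]  = sym (-‿involutive _)

  fromℤ-⊖ : ∀ m n → fromℤ (m ⊖ n) ≈ m · 1# - n · 1#
  fromℤ-⊖ zero    zero    = sym (-‿inverseʳ _)
  fromℤ-⊖ zero    (suc n) = sym (+-identityˡ _)
  fromℤ-⊖ (suc m) zero    = sym (trans (+-congˡ -0#≈0#) (+-identityʳ _))
  fromℤ-⊖ (suc m) (suc n) = begin
    fromℤ (suc m ⊖ suc n)                    ≡⟨ ≡.cong fromℤ (ℤ.[1+m]⊖[1+n]≡m⊖n m n) ⟩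
    fromℤ (m ⊖ n)                            ≈⟨ fromℤ-⊖ m n ⟩
    m · 1# - n · 1#                          ≈⟨ +-congʳ (+-identityʳ _) ⟨
    (m · 1# + 0#) - n · 1#                   ≈⟨ +-congʳ (+-congˡ (-‿inverseʳ 1#)) ⟨
    (m · 1# + (1# - 1#)) - n · 1#            ≈⟨ +-congʳ (+-assoc _ _ _) ⟨
    ((m · 1# + 1#) - 1#) - n · 1#            ≈⟨ +-assoc _ _ _ ⟩
    (m · 1# + 1#) + (- 1# - n · 1#)          ≈⟨ +-cong (+-comm _ _) (⁻¹-∙-comm _ _) ⟩
    (1# + m · 1#) - (1# + n · 1#)            ≈⟨ +-cong (1+× m 1#) (-‿cong (1+× n 1#)) ⟨
    suc m · 1# - suc n · 1#                  ∎

  fromℤ-+ : ∀ i j → fromℤ (i ℤ.+ j) ≈ fromℤ i + fromℤ j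
  fromℤ-+ (+ m)    (+ n)    = ×-homo-+ 1# m n
  fromℤ-+ (+ m)    -[1+ n ] = fromℤ-⊖ m (suc n)
  fromℤ-+ -[1+ m ] (+ n)    = trans (fromℤ-⊖ n (suc m)) (+-comm _ _)
  fromℤ-+ -[1+ m ] -[1+ n ] = begin
    fromℤ (-[1+ m ] ℤ.+ -[1+ n ])        ≡⟨ ≡.cong fromℤ (ℤ.neg-distrib-+ (+ suc m) (+ suc n)) ⟨
    - ((suc m ℕ.+ suc n) · 1#)           ≈⟨ -‿cong (×-homo-+ 1# (suc m) (suc n)) ⟩
    - (suc m · 1# + suc n · 1#)          ≈⟨ ⁻¹-∙-comm _ _ ⟨
    - (suc m · 1#) + - (suc n · 1#)      ∎

  private
    pos-* : ∀ m n → fromℤ (+ m ℤ.* + n) ≈ (m · 1#) * (n · 1#)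
    pos-* m n = trans (reflexive (≡.cong fromℤ (≡.sym (ℤ.pos-* m n)))) (×1-homo-* m n)

  fromℤ-* : ∀ i j → fromℤ (i ℤ.* j) ≈ fromℤ i * fromℤ j
  fromℤ-* (+ m) (+ n) = pos-* m n
  fromℤ-* (+ m) -[1+ n ] = begin
    fromℤ (+ m ℤ.* -[1+ n ])         ≡⟨ ≡.cong fromℤ (ℤ.neg-distribʳ-* (+ m) (+ suc n)) ⟨
    fromℤ (ℤ.- (+ m ℤ.* + suc n))    ≈⟨ fromℤ-neg (+ m ℤ.* + suc n) ⟩
    - fromℤ (+ m ℤ.* + suc n)        ≈⟨ -‿cong (pos-* m (suc n)) ⟩
    - ((m · 1#) * (suc n · 1#))      ≈⟨ -‿distribʳ-* _ _ ⟩
    (m · 1#) * - (suc n · 1#)        ∎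
  fromℤ-* -[1+ m ] (+ n) = begin
    fromℤ (-[1+ m ] ℤ.* + n)         ≡⟨ ≡.cong fromℤ (ℤ.neg-distribˡ-* (+ suc m) (+ n)) ⟨
    fromℤ (ℤ.- (+ suc m ℤ.* + n))    ≈⟨ fromℤ-neg (+ suc m ℤ.* + n) ⟩
    - fromℤ (+ suc m ℤ.* + n)        ≈⟨ -‿cong (pos-* (suc m) n) ⟩
    - ((suc m · 1#) * (n · 1#))      ≈⟨ -‿distribˡ-* _ _ ⟩
    - (suc m · 1#) * (n · 1#)        ∎
  fromℤ-* -[1+ m ] -[1+ n ] = begin
    (suc m ℕ.* suc n) · 1#               ≈⟨ ×1-homo-* (suc m) (suc n) ⟩
    (suc m · 1#) * (suc n · 1#)          ≈⟨ -‿involutive _ ⟨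
    - - ((suc m · 1#) * (suc n · 1#))    ≈⟨ -‿cong (-‿distribʳ-* _ _) ⟩
    - ((suc m · 1#) * - (suc n · 1#))    ≈⟨ -‿distribˡ-* _ _ ⟩
    - (suc m · 1#) * - (suc n · 1#)      ∎

  private
    homomorphism : CommutativeRing.rawRing ℤ.+-*-commutativeRing
      -Raw-AlmostCommutative⟶ fromCommutativeRing R
    homomorphism = record
      { ⟦_⟧    = fromℤ
      ; +-homo = fromℤ-+
      ; *-homo = fromℤ-*
      ; -‿homo = fromℤ-neg
      ; 0-homo = refl
      ; 1-homo = refl
      }

    -- Like terms cancel by comparing integer coefficients, since equality in the carrier may be
    -- undecidable. The answer `nothing` asserts no inequality: `fromℤ` may fail to be injective.
    fromℤ-≟ : ∀ i j → Maybe (fromℤ i ≈ fromℤ j)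
    fromℤ-≟ i j with i ℤ.≟ j
    ... | yes i≡j = just (reflexive (≡.cong fromℤ i≡j))
    ... | no  _   = nothing

  open import Algebra.Solver.Ring _ _ homomorphism fromℤ-≟ public
    using (solve; con; _:+_; _:*_; _:-_; :-_; _:=_)

-- Finite q-identities

module FiniteIdentities {c ℓ : Level} (R : CommutativeRing c ℓ) where
  open import Data.Integer.Base using (+_)
  open IntegerCoefficients R
  open CommutativeRing R
  open import Algebra.Properties.Semiring.Exp semiring
    using (_^_; ^-homo-*; ^-assocʳ; ^-congˡ)
  open import Algebra.Definitions.RawSemiring (Semiring.rawSemiring semiring) using (sum; product)
  open import Relation.Binary.Reasoning.Setoid setoid

  -- Convolution is kept abstract, so that its summand can be inferred.
  abstract
    conv : (ℕ → ℕ → Carrier) → ℕ → Carrier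
    conv f zero    = f 0 0
    conv f (suc n) = f 0 (suc n) + conv (λ i j → f (suc i) j) n

    conv-zero : ∀ f → conv f 0 ≈ f 0 0
    conv-zero f = refl

    conv-suc : ∀ f n → conv f (suc n) ≈ f 0 (suc n) + conv (λ i j → f (suc i) j) n
    conv-suc f n = refl

    conv-cong : ∀ {f g} n → (∀ i j → i ℕ.+ j ≡ n → f i j ≈ g i j) → conv f n ≈ conv g n
    conv-cong zero    f≈g = f≈g 0 0 ≡.refl
    conv-cong (suc n) f≈g =
      +-cong (f≈g 0 (suc n) ≡.refl) (conv-cong n (λ i j e → f≈g (suc i) j (≡.cong suc e)))

    conv-+ : ∀ f g n → conv (λ i j → f i j + g i j) n ≈ conv f n + conv g n
    conv-+ f g zero    = refl
    conv-+ f g (suc n) = trans (+-congˡ (conv-+ _ _ n))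
      (solve 4 (λ a b c d → (a :+ b) :+ (c :+ d) := (a :+ c) :+ (b :+ d)) refl _ _ _ _)

    conv-*ˡ : ∀ x f n → conv (λ i j → x * f i j) n ≈ x * conv f n
    conv-*ˡ x f zero    = refl
    conv-*ˡ x f (suc n) = trans (+-congˡ (conv-*ˡ x _ n)) (sym (distribˡ x _ _))

    conv-last : ∀ f n → conv f (suc n) ≈ conv (λ i j → f i (suc j)) n + f (suc n) 0
    conv-last f zero    = refl
    conv-last f (suc n) = trans (+-congˡ (conv-last (λ i j → f (suc i) j) n)) (sym (+-assoc _ _ _))

    -- Both sides run over the triples with i + j + k = n. This is the interchange of summations
    -- behind the Bailey lemma.
    conv-assoc : ∀ (f : ℕ → ℕ → ℕ → Carrier) n →
      conv (λ m k → conv (λ i j → f i j k) m) n ≈ conv (λ i m → conv (λ j k → f i j k) m) n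
    conv-assoc f zero    = refl
    conv-assoc f (suc n) = begin
      f 0 0 (suc n) + conv (λ m k → f 0 (suc m) k + conv (λ i j → f (suc i) j k) m) n
        ≈⟨ +-congˡ (conv-+ _ _ n) ⟩
      f 0 0 (suc n) + (conv (λ m k → f 0 (suc m) k) n + conv (λ m k → conv (λ i j → f (suc i) j k) m) n)
        ≈⟨ +-assoc _ _ _ ⟨
      conv (f 0) (suc n) + conv (λ m k → conv (λ i j → f (suc i) j k) m) n
        ≈⟨ +-congˡ (conv-assoc (λ i → f (suc i)) n) ⟩
      conv (f 0) (suc n) + conv (λ i m → conv (λ j k → f (suc i) j k) m) n
        ∎

  -- Finite products and sums, and invertible elements

  ∏ : (ℕ → Carrier) → ℕ → Carrier
  ∏ f zero    = 1#
  ∏ f (suc n) = ∏ f n * f n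

  ∏-cong : ∀ {f g} → (∀ j → f j ≈ g j) → ∀ n → ∏ f n ≈ ∏ g n
  ∏-cong f≈g zero    = refl
  ∏-cong f≈g (suc n) = *-cong (∏-cong f≈g n) (f≈g n)

  ∏-* : ∀ f g n → ∏ (λ j → f j * g j) n ≈ ∏ f n * ∏ g n
  ∏-* f g zero    = sym (*-identityˡ 1#)
  ∏-* f g (suc n) = trans (*-congʳ (∏-* f g n))
    (solve 4 (λ a b c d → (a :* b) :* (c :* d) := (a :* c) :* (b :* d)) refl _ _ _ _)

  ∏-1 : ∀ {f} → (∀ j → f j ≈ 1#) → ∀ n → ∏ f n ≈ 1#
  ∏-1 f≈1 zero    = refl
  ∏-1 f≈1 (suc n) = trans (*-cong (∏-1 f≈1 n) (f≈1 n)) (*-identityˡ 1#)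

  ∏-front : ∀ f n → ∏ f (suc n) ≈ f 0 * ∏ (λ j → f (suc j)) n
  ∏-front f zero    = trans (*-identityˡ _) (sym (*-identityʳ _))
  ∏-front f (suc n) = trans (*-congʳ (∏-front f n)) (*-assoc _ _ _)

  product≈∏ : ∀ f n → product {n} (λ i → f (toℕ i)) ≈ ∏ f n
  product≈∏ f zero    = refl
  product≈∏ f (suc n) = trans (*-congˡ (product≈∏ (λ j → f (suc j)) n)) (sym (∏-front f n))

  ∑ : (ℕ → Carrier) → ℕ → Carrier
  ∑ f zero    = 0#
  ∑ f (suc n) = ∑ f n + f n

  ∑-cong : ∀ {f g} → (∀ j → f j ≈ g j) → ∀ n → ∑ f n ≈ ∑ g n
  ∑-cong f≈g zero    = refl
  ∑-cong f≈g (suc n) = +-cong (∑-cong f≈g n) (f≈g n)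

  ∑-front : ∀ f n → ∑ f (suc n) ≈ f 0 + ∑ (λ j → f (suc j)) n
  ∑-front f zero    = trans (+-identityˡ _) (sym (+-identityʳ _))
  ∑-front f (suc n) = trans (+-congʳ (∑-front f n)) (+-assoc _ _ _)

  sum≈∑ : ∀ f n → sum {n} (λ i → f (toℕ i)) ≈ ∑ f n
  sum≈∑ f zero    = refl
  sum≈∑ f (suc n) = trans (+-congˡ (sum≈∑ (λ j → f (suc j)) n)) (sym (∑-front f n))

  conv-∑ : ∀ f n → conv (λ i _ → f i) n ≈ ∑ f (suc n)
  conv-∑ f zero    = trans (conv-zero _) (sym (+-identityˡ _))
  conv-∑ f (suc n) = trans (conv-last _ n) (+-congʳ (conv-∑ f n))

  -- Invertibility takes the place of being nonzero: it permits cancellation in every commutative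
  -- ring, without integrality or decidable equality.
  Unit : Carrier → Set _
  Unit x = ∃[ y ] x * y ≈ 1#

  unit-cancel : ∀ {x a b} → Unit x → x * a ≈ x * b → a ≈ b
  unit-cancel {x} {a} {b} (y , xy≈1) xa≈xb = begin
    a              ≈⟨ *-identityˡ a ⟨
    1# * a         ≈⟨ *-congʳ xy≈1 ⟨
    x * y * a      ≈⟨ solve 3 (λ x y a → x :* y :* a := y :* (x :* a)) refl x y a ⟩
    y * (x * a)    ≈⟨ *-congˡ xa≈xb ⟩
    y * (x * b)    ≈⟨ solve 3 (λ x y a → x :* y :* a := y :* (x :* a)) refl x y b ⟨
    x * y * b      ≈⟨ *-congʳ xy≈1 ⟩
    1# * b         ≈⟨ *-identityˡ b ⟩
    b              ∎

  unit-resp : ∀ {x y} → x ≈ y → Unit x → Unit y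
  unit-resp x≈y (u , xu≈1) = u , trans (*-congʳ (sym x≈y)) xu≈1

  unit-* : ∀ {x y} → Unit x → Unit y → Unit (x * y)
  unit-* {x} {y} (u , xu≈1) (v , yv≈1) = u * v , (begin
    x * y * (u * v)      ≈⟨ solve 4 (λ x y u v → x :* y :* (u :* v) := (x :* u) :* (y :* v)) refl x y u v ⟩
    (x * u) * (y * v)    ≈⟨ *-cong xu≈1 yv≈1 ⟩
    1# * 1#              ≈⟨ *-identityˡ 1# ⟩
    1#                   ∎)

  unit-∏ : ∀ {f} → (∀ j → Unit (f j)) → ∀ n → Unit (∏ f n)
  unit-∏ u zero    = 1# , *-identityˡ 1#
  unit-∏ u (suc n) = unit-* (unit-∏ u n) (u n)

  *-quotient : ∀ {d i} x → d * i ≈ 1# → d * (x * i) ≈ x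
  *-quotient {d} {i} x di≈1 = begin
    d * (x * i)    ≈⟨ solve 3 (λ d x i → d :* (x :* i) := x :* (d :* i)) refl d x i ⟩
    x * (d * i)    ≈⟨ *-congˡ di≈1 ⟩
    x * 1#         ≈⟨ *-identityʳ x ⟩
    x              ∎

  -- coeff r = (-1)^r (z^{-r} + ... + z^r) for z a primitive sixth root of
  -- unity, so that 1 - x + x² = (1 - z x)(1 - x / z).
  coeff : ℕ → Carrier
  coeff 0 = 1#
  coeff 1 = - (1# + 1#)
  coeff 2 = 1#
  coeff (suc (suc (suc r))) = coeff r

  -- This is c_(r-1), extended by the symmetry c_(-1-r) = c_r of the defining formula; hence the
  -- value 1, not 0, at r = 0.
  coeff′ : ℕ → Carrier
  coeff′ zero    = 1#
  coeff′ (suc r) = coeff r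

  -- Multiplying z^(-r) + ... + z^r by z + 1/z gives the sums for r + 1 and r - 1; here z + 1/z = 1,
  -- and the alternating sign produces the minus.
  coeff-recurrence : ∀ r → coeff (suc r) + coeff′ r ≈ - coeff r
  coeff-recurrence 0 = solve 0 (:- (con (+ 1) :+ con (+ 1)) :+ con (+ 1) := :- con (+ 1)) refl
  coeff-recurrence 1 = solve 0 (con (+ 1) :+ con (+ 1) := :- (:- (con (+ 1) :+ con (+ 1)))) refl
  coeff-recurrence 2 = solve 0 (con (+ 1) :+ :- (con (+ 1) :+ con (+ 1)) := :- con (+ 1)) refl
  coeff-recurrence 3 = solve 0 (:- (con (+ 1) :+ con (+ 1)) :+ con (+ 1) := :- con (+ 1)) refl
  coeff-recurrence (suc (suc (suc (suc r)))) = coeff-recurrence (suc r)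

  Φ₆∏ : Carrier → ℕ → Carrier
  Φ₆∏ p = ∏ (λ j → 1# - p ^ suc j + p ^ suc j * p ^ suc j)

  -- `I n` plays 1 / (p;p)_n and is known only through its recurrence; `unit` allows the factors 1 -
  -- p^(n+1) to be cancelled again.
  module Base
    (p : Carrier) (I : ℕ → Carrier) (I-zero : I 0 ≈ 1#)
    (I-step : ∀ n → (1# - p ^ suc n) * I (suc n) ≈ I n)
    (unit : ∀ n → Unit (1# - p ^ suc n))
    where

    private
      -- The convention 1 / (p;p)_(-1) = 0 agrees with the recurrence, whose factor 1 - p^0
      -- vanishes; thanks to it `I⁻-step` has no exceptional index.
      I⁻ I⁻⁻ : ℕ → Carrier
      I⁻ zero     = 0#
      I⁻ (suc n)  = I n
      I⁻⁻ zero    = 0#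
      I⁻⁻ (suc n) = I⁻ n

      I⁻-step : ∀ n → (1# - p ^ n) * I n ≈ I⁻ n
      I⁻-step zero    = trans (*-congʳ (-‿inverseʳ 1#)) (zeroˡ _)
      I⁻-step (suc n) = I-step n

      ^-split : ∀ m n {k} → m ℕ.+ n ≡ k → p ^ m * p ^ n ≈ p ^ k
      ^-split m n ≡.refl = sym (^-homo-* p m n)

    -- The q-Pascal rule in reciprocal form: with x = p^i and y = p^j, 1 - x y = (1 - x) + x (1 -
    -- y), and each part lowers the index of one reciprocal.
    conv-pascal : ∀ (h : ℕ → Carrier) n →
      (1# - p ^ suc n) * conv (λ i j → h i * (I i * I j)) (suc n) ≈
      conv (λ i j → (h (suc i) + h i * p ^ i) * (I i * I j)) n
    conv-pascal h n = begin
      (1# - p ^ suc n) * conv (λ i j → h i * (I i * I j)) (suc n)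
        ≈⟨ conv-*ˡ _ _ (suc n) ⟨
      conv (λ i j → (1# - p ^ suc n) * (h i * (I i * I j))) (suc n)
        ≈⟨ conv-cong (suc n) (λ i j e → trans
             (*-congʳ (+-congˡ (-‿cong (sym (^-split i j e)))))
             (trans (solve 5 (λ x y h a b →
               (con (+ 1) :- x :* y) :* (h :* (a :* b)) :=
               h :* (((con (+ 1) :- x) :* a) :* b) :+ h :* x :* (a :* ((con (+ 1) :- y) :* b)))
               refl (p ^ i) (p ^ j) (h i) (I i) (I j))
             (+-cong (*-congˡ (*-congʳ (I⁻-step i))) (*-congˡ (*-congˡ (I⁻-step j)))))) ⟩
      conv (λ i j → h i * (I⁻ i * I j) + h i * p ^ i * (I i * I⁻ j)) (suc n)
        ≈⟨ conv-+ _ _ (suc n) ⟩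
      conv (λ i j → h i * (I⁻ i * I j)) (suc n) + conv (λ i j → h i * p ^ i * (I i * I⁻ j)) (suc n)
        ≈⟨ +-cong (conv-suc _ n) (conv-last _ n) ⟩
      (h 0 * (0# * I (suc n)) + conv (λ i j → h (suc i) * (I i * I j)) n) +
      (conv (λ i j → h i * p ^ i * (I i * I j)) n + h (suc n) * p ^ suc n * (I (suc n) * 0#))
        ≈⟨ solve 6 (λ a b c d x y →
             (a :* (con (+ 0) :* b) :+ x) :+ (y :+ c :* (d :* con (+ 0))) := x :+ y) refl
             (h 0) (I (suc n)) (h (suc n) * p ^ suc n) (I (suc n)) _ _ ⟩
      conv (λ i j → h (suc i) * (I i * I j)) n + conv (λ i j → h i * p ^ i * (I i * I j)) n
        ≈⟨ conv-+ _ _ n ⟨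
      conv (λ i j → h (suc i) * (I i * I j) + h i * p ^ i * (I i * I j)) n
        ≈⟨ conv-cong n (λ i j _ → sym (distribʳ _ _ _)) ⟩
      conv (λ i j → (h (suc i) + h i * p ^ i) * (I i * I j)) n
        ∎

    -- A form of the q-Vandermonde sum; the Pascal rule turns (n + 1, k)
    -- into (n, k + 1).
    conv-vandermonde : ∀ n k →
      conv (λ i j → p ^ (i ℕ.* (i ℕ.+ k)) * I (i ℕ.+ k) * (I i * I j)) n ≈ I n * I (n ℕ.+ k)
    conv-vandermonde zero k = begin
      conv (λ i j → p ^ (i ℕ.* (i ℕ.+ k)) * I (i ℕ.+ k) * (I i * I j)) 0
        ≈⟨ conv-zero _ ⟩
      1# * I k * (I 0 * I 0)    ≈⟨ *-congˡ (*-congˡ I-zero) ⟩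
      1# * I k * (I 0 * 1#)
        ≈⟨ solve 2 (λ a b → con (+ 1) :* a :* (b :* con (+ 1)) := b :* a) refl _ _ ⟩
      I 0 * I k                 ∎
    conv-vandermonde (suc n) k = unit-cancel (unit n) (begin
      (1# - p ^ suc n) * conv (λ i j → p ^ (i ℕ.* (i ℕ.+ k)) * I (i ℕ.+ k) * (I i * I j)) (suc n)
        ≈⟨ conv-pascal (λ i → p ^ (i ℕ.* (i ℕ.+ k)) * I (i ℕ.+ k)) n ⟩
      conv (λ i j → (p ^ (suc i ℕ.* (suc i ℕ.+ k)) * I (suc (i ℕ.+ k)) +
                     p ^ (i ℕ.* (i ℕ.+ k)) * I (i ℕ.+ k) * p ^ i) * (I i * I j)) n
        -- Raising `I (i + k)` to `I (suc (i + k))` brings in the factor 1 - p^(i+k+1), whose second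
        -- part cancels the shifted summand.
        ≈⟨ conv-cong n (λ i j _ → *-congʳ (collect i)) ⟩
      conv (λ i j → p ^ (i ℕ.* (i ℕ.+ suc k)) * I (i ℕ.+ suc k) * (I i * I j)) n
        ≈⟨ conv-vandermonde n (suc k) ⟩
      I n * I (n ℕ.+ suc k)
        ≈⟨ *-cong (sym (I-step n)) (reflexive (≡.cong I (ℕ.+-suc n k))) ⟩
      ((1# - p ^ suc n) * I (suc n)) * I (suc n ℕ.+ k)
        ≈⟨ *-assoc _ _ _ ⟩
      (1# - p ^ suc n) * (I (suc n) * I (suc n ℕ.+ k))
        ∎)
      where
      collect : ∀ i →
        p ^ (suc i ℕ.* (suc i ℕ.+ k)) * I (suc (i ℕ.+ k)) + p ^ (i ℕ.* (i ℕ.+ k)) * I (i ℕ.+ k) * p ^ i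
        ≈ p ^ (i ℕ.* (i ℕ.+ suc k)) * I (i ℕ.+ suc k)
      collect i = begin
        p ^ (suc i ℕ.* (suc i ℕ.+ k)) * I (suc (i ℕ.+ k)) + p ^ (i ℕ.* (i ℕ.+ k)) * I (i ℕ.+ k) * p ^ i
          ≈⟨ +-cong (*-congʳ (sym (^-split (i ℕ.* (i ℕ.+ suc k)) (suc (i ℕ.+ k)) (vandermonde-exponent₁ i k)))) (trans
               (*-congʳ (*-congˡ (sym (I-step (i ℕ.+ k)))))
               (solve 4 (λ x y z a → x :* ((con (+ 1) :- z) :* a) :* y := (x :* y) :* ((con (+ 1) :- z) :* a))
                 refl (p ^ (i ℕ.* (i ℕ.+ k))) (p ^ i) (p ^ suc (i ℕ.+ k)) (I (suc (i ℕ.+ k))))) ⟩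
        (p ^ (i ℕ.* (i ℕ.+ suc k)) * p ^ suc (i ℕ.+ k)) * I (suc (i ℕ.+ k)) +
        (p ^ (i ℕ.* (i ℕ.+ k)) * p ^ i) * ((1# - p ^ suc (i ℕ.+ k)) * I (suc (i ℕ.+ k)))
          ≈⟨ +-congˡ (*-congʳ (^-split (i ℕ.* (i ℕ.+ k)) i (vandermonde-exponent₂ i k))) ⟩
        (p ^ (i ℕ.* (i ℕ.+ suc k)) * p ^ suc (i ℕ.+ k)) * I (suc (i ℕ.+ k)) +
        p ^ (i ℕ.* (i ℕ.+ suc k)) * ((1# - p ^ suc (i ℕ.+ k)) * I (suc (i ℕ.+ k)))
          ≈⟨ solve 3 (λ x y a → (x :* y) :* a :+ x :* ((con (+ 1) :- y) :* a) := x :* a) refl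
               (p ^ (i ℕ.* (i ℕ.+ suc k))) (p ^ suc (i ℕ.+ k)) (I (suc (i ℕ.+ k))) ⟩
        p ^ (i ℕ.* (i ℕ.+ suc k)) * I (suc (i ℕ.+ k))
          ≈⟨ *-congˡ (reflexive (≡.cong I (≡.sym (ℕ.+-suc i k)))) ⟩
        p ^ (i ℕ.* (i ℕ.+ suc k)) * I (i ℕ.+ suc k)
          ∎

    -- On the diagonal r + l = n the reciprocals have indices n - r and n + r + 1, as in a Bailey
    -- pair relative to p; the form in r and l avoids truncated subtraction.
    term : ℕ → ℕ → Carrier
    term r l = p ^ tri r * (I l * I (suc (r ℕ.+ (r ℕ.+ l))))

    β : ℕ → Carrier
    β = conv (λ r l → coeff r * term r l)

    -- With x = p^l, y = p^{b+2} and A, B the reciprocals I_l, I_{b+2}, this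
    -- is the identity (1 - xy/p)(1 - xy) = (1 + xy/p)(1 - x)(1 - y)
    -- + x(1 - y/p)(1 - y) + y(1 - x/p)(1 - x).
    private
      reciprocal-recurrence : ∀ l b →
        (1# - p ^ (l ℕ.+ suc b)) * (1# - p ^ suc (l ℕ.+ suc b)) * (I l * I (suc (suc b))) ≈
        (1# + p ^ (l ℕ.+ suc b)) * (I⁻ l * I (suc b)) + p ^ l * (I l * I b) +
        p ^ suc (suc b) * (I⁻⁻ l * I (suc (suc b)))
      reciprocal-recurrence l b = begin
        (1# - p ^ (l ℕ.+ suc b)) * (1# - p ^ suc (l ℕ.+ suc b)) * (I l * I (suc (suc b)))
          ≈⟨ *-congʳ (*-cong (+-congˡ (-‿cong split)) (+-congˡ (-‿cong (*-congˡ split)))) ⟩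
        (1# - x * y′) * (1# - p * (x * y′)) * (I l * B)
          ≈⟨ solve 5 (λ p x y′ A B →
               (con (+ 1) :- x :* y′) :* (con (+ 1) :- p :* (x :* y′)) :* (A :* B) :=
               (con (+ 1) :+ x :* y′) :* (((con (+ 1) :- x) :* A) :* ((con (+ 1) :- p :* y′) :* B))
               :+ x :* (A :* ((con (+ 1) :- y′) :* ((con (+ 1) :- p :* y′) :* B)))
               :+ ((p :* y′ :- x :* y′) :* ((con (+ 1) :- x) :* A)) :* B)
               refl p x y′ (I l) B ⟩
        (1# + x * y′) * (((1# - x) * I l) * ((1# - p * y′) * B))
        + x * (I l * ((1# - y′) * ((1# - p * y′) * B)))
        + ((p * y′ - x * y′) * ((1# - x) * I l)) * B
          ≈⟨ +-cong (+-cong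
               (*-cong (+-congˡ (sym split)) (*-cong (I⁻-step l) (I-step (suc b))))
               (*-congˡ (*-congˡ (trans (*-congˡ (I-step (suc b))) (I-step b)))))
               (trans (*-congʳ (trans (*-congˡ (I⁻-step l)) (lower l))) (*-assoc _ _ _)) ⟩
        (1# + p ^ (l ℕ.+ suc b)) * (I⁻ l * I (suc b)) + p ^ l * (I l * I b) +
        p ^ suc (suc b) * (I⁻⁻ l * I (suc (suc b)))
          ∎
        where
        x y′ B : Carrier
        x  = p ^ l
        y′ = p ^ suc b
        B  = I (suc (suc b))
        split : p ^ (l ℕ.+ suc b) ≈ x * y′
        split = ^-homo-* p l (suc b)
        -- The factor 1 - x/p with its denominator cleared, since p may be zero: p y′ - x y′ is p y′
        -- (1 - p^(l-1)), which lowers `I⁻ l` once more.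
        lower : ∀ l → (p * y′ - p ^ l * y′) * I⁻ l ≈ p * y′ * I⁻⁻ l
        lower zero    = trans (zeroʳ _) (sym (zeroʳ _))
        lower (suc l) = begin
          (p * y′ - p * p ^ l * y′) * I l
            ≈⟨ solve 4 (λ p x y A → (p :* y :- p :* x :* y) :* A := p :* y :* ((con (+ 1) :- x) :* A))
                 refl p (p ^ l) y′ (I l) ⟩
          p * y′ * ((1# - p ^ l) * I l)
            ≈⟨ *-congˡ (I⁻-step l) ⟩
          p * y′ * I⁻ l
            ∎

    private
      upper : ℕ → ℕ → ℕ → Carrier
      upper n r l = coeff r * (p ^ tri r * p ^ suc (suc (r ℕ.+ n))) * (I⁻⁻ l * I (suc (suc (r ℕ.+ n))))

      -- Only l ≥ 2 survives in `I⁻⁻ l`, and (r, l + 2) becomes (r + 1, l) on the next lower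
      -- diagonal, as t_r + (r + n + 2) = t_(r+1) + (n + 1). The image misses r = 0, which the
      -- `coeff′` sum contains with coefficient 1; hence the subtracted `term 0 n`.
      conv-upper : ∀ n → conv (upper n) (suc n) ≈
        p ^ suc n * (conv (λ r l → coeff′ r * term r l) n - term 0 n)
      conv-upper zero = begin
        conv (upper 0) 1
          ≈⟨ trans (conv-suc _ 0) (+-congˡ (conv-zero _)) ⟩
        upper 0 0 1 + upper 0 1 0
          ≈⟨ solve 6 (λ a b c d P t →
               a :* (con (+ 0) :* b) :+ c :* (con (+ 0) :* d) := P :* (con (+ 1) :* t :- t)) refl
               _ _ _ _ (p ^ 1) (term 0 0) ⟩
        p ^ 1 * (1# * term 0 0 - term 0 0)
          ≈⟨ *-congˡ (+-congʳ (conv-zero _)) ⟨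
        p ^ 1 * (conv (λ r l → coeff′ r * term r l) 0 - term 0 0)
          ∎
      conv-upper (suc n) = begin
        conv (upper (suc n)) (suc (suc n))
          ≈⟨ trans (conv-last _ (suc n)) (+-congʳ (conv-last _ n)) ⟩
        conv (λ r l → upper (suc n) r (suc (suc l))) n + upper (suc n) (suc n) 1 + upper (suc n) (suc (suc n)) 0
          ≈⟨ solve 5 (λ x a b c d → x :+ a :* (con (+ 0) :* b) :+ c :* (con (+ 0) :* d) := x) refl
               _ _ _ _ _ ⟩
        conv (λ r l → upper (suc n) r (suc (suc l))) n
          ≈⟨ conv-cong n (λ { r l ≡.refl → trans
               (*-congʳ (*-congˡ (reflexive (≡.cong (λ k → p ^ tri r * p ^ k) (upper-exponent r (r ℕ.+ l))))))
               (trans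
                 (*-cong (*-congˡ (*-congˡ (^-homo-* p (suc r) (suc (suc (r ℕ.+ l))))))
                   (*-congˡ (reflexive (≡.cong (λ k → I (suc (suc k))) (ℕ.+-suc r (r ℕ.+ l))))))
                 (trans
                   (solve 5 (λ c t x P A → c :* (t :* (x :* P)) :* A := P :* (c :* (x :* t :* A))) refl
                     (coeff r) (p ^ tri r) (p ^ suc r) (p ^ suc (suc (r ℕ.+ l))) _)
                   (*-congˡ (*-congˡ (*-cong (sym (^-homo-* p (suc r) (tri r)))
                     (*-congˡ (reflexive (≡.cong (λ k → I (suc (suc k))) (≡.sym (ℕ.+-suc r (r ℕ.+ l)))))))))))}) ⟩
        conv (λ r l → P * (coeff r * term (suc r) l)) n
          ≈⟨ conv-*ˡ _ _ n ⟩
        P * conv (λ r l → coeff r * term (suc r) l) n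
          ≈⟨ solve 3 (λ P t x → P :* x := P :* ((con (+ 1) :* t :+ x) :- t)) refl P (term 0 (suc n)) _ ⟩
        P * ((1# * term 0 (suc n) + conv (λ r l → coeff r * term (suc r) l) n) - term 0 (suc n))
          ≈⟨ *-congˡ (+-congʳ (conv-suc _ n)) ⟨
        P * (conv (λ r l → coeff′ r * term r l) (suc n) - term 0 (suc n))
          ∎
        where
        P : Carrier
        P = p ^ suc (suc n)

    -- The three parts of `reciprocal-recurrence` keep r, lower it by one, or raise it by one. After
    -- reindexing, the last two carry c_(r+1) and c_(r-1), which add up to -c_r and so supply the
    -- middle term -p^(n+1) of Φ₆.
    β-recurrence : ∀ n →
      (1# - p ^ suc (n ℕ.+ suc n)) * (1# - p ^ suc (suc (n ℕ.+ suc n))) * β (suc n) ≈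
      (1# - p ^ suc n + p ^ suc n * p ^ suc n) * β n
    β-recurrence n = begin
      (1# - p ^ suc m) * (1# - p ^ suc (suc m)) * β (suc n)
        ≈⟨ conv-*ˡ _ _ (suc n) ⟨
      conv (λ r l → (1# - p ^ suc m) * (1# - p ^ suc (suc m)) * (coeff r * term r l)) (suc n)
        ≈⟨ conv-cong (suc n) pointwise ⟩
      conv (λ r l → (t₁ r l + t₂ r l) + t₃ r l) (suc n)
        ≈⟨ trans (conv-+ _ _ (suc n)) (+-congʳ (conv-+ _ _ (suc n))) ⟩
      (conv t₁ (suc n) + conv t₂ (suc n)) + conv t₃ (suc n)
        ≈⟨ +-cong (+-cong sum₁ sum₂) sum₃ ⟩
      ((1# + p ^ suc m) * β n + P * (term 0 n + conv (λ r l → coeff (suc r) * term r l) n))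
      + P * (conv (λ r l → coeff′ r * term r l) n - term 0 n)
        -- The boundary terms at r = 0 cancel; this is the reflection c_(-1) = c_0 at work.
        ≈⟨ solve 6 (λ c b P t x y →
             (c :* b :+ P :* (t :+ x)) :+ P :* (y :- t) := c :* b :+ P :* (x :+ y)) refl
             (1# + p ^ suc m) (β n) P (term 0 n) _ _ ⟩
      (1# + p ^ suc m) * β n +
      P * (conv (λ r l → coeff (suc r) * term r l) n + conv (λ r l → coeff′ r * term r l) n)
        ≈⟨ +-congˡ (*-congˡ recombine) ⟩
      (1# + p ^ suc m) * β n + P * (- 1# * β n)
        ≈⟨ +-congʳ (*-congʳ (+-congˡ (^-homo-* p (suc n) (suc n)))) ⟩
      (1# + P * P) * β n + P * (- 1# * β n)
        ≈⟨ solve 2 (λ P b → (con (+ 1) :+ P :* P) :* b :+ P :* (:- con (+ 1) :* b)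
             := (con (+ 1) :- P :+ P :* P) :* b) refl P (β n) ⟩
      (1# - P + P * P) * β n
        ∎
      where
      m : ℕ
      m = n ℕ.+ suc n
      P : Carrier
      P = p ^ suc n
      t₁ t₂ t₃ : ℕ → ℕ → Carrier
      t₁ r l = (1# + p ^ suc m) * (coeff r * p ^ tri r * (I⁻ l * I (suc (r ℕ.+ n))))
      t₂ r l = coeff r * (p ^ tri r * p ^ l) * (I l * I (r ℕ.+ n))
      t₃ r l = coeff r * (p ^ tri r * p ^ suc (suc (r ℕ.+ n))) * (I⁻⁻ l * I (suc (suc (r ℕ.+ n))))

      pointwise : ∀ r l → r ℕ.+ l ≡ suc n →
        (1# - p ^ suc m) * (1# - p ^ suc (suc m)) * (coeff r * term r l) ≈ (t₁ r l + t₂ r l) + t₃ r l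
      pointwise r l e = begin
        (1# - p ^ suc m) * (1# - p ^ suc (suc m)) * (coeff r * term r l)
          ≈⟨ *-cong (reflexive (≡.cong (λ k → (1# - p ^ k) * (1# - p ^ suc k)) exponent))
               (*-congˡ (*-congˡ (*-congˡ (reflexive (≡.cong I index))))) ⟩
        (1# - p ^ (l ℕ.+ suc b)) * (1# - p ^ suc (l ℕ.+ suc b)) *
        (coeff r * (p ^ tri r * (I l * I (suc (suc b)))))
          ≈⟨ solve 4 (λ a c t A → a :* (c :* (t :* A)) := c :* t :* (a :* A)) refl _ _ _ _ ⟩
        coeff r * p ^ tri r * ((1# - p ^ (l ℕ.+ suc b)) * (1# - p ^ suc (l ℕ.+ suc b)) *
        (I l * I (suc (suc b))))
          ≈⟨ *-congˡ (reciprocal-recurrence l b) ⟩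
        coeff r * p ^ tri r * ((1# + p ^ (l ℕ.+ suc b)) * (I⁻ l * I (suc b)) + p ^ l * (I l * I b) +
        p ^ suc (suc b) * (I⁻⁻ l * I (suc (suc b))))
          ≈⟨ solve 8 (λ c t u v w x y z →
               c :* t :* (u :* x :+ v :* y :+ w :* z) :=
               u :* (c :* t :* x) :+ c :* (t :* v) :* y :+ c :* (t :* w) :* z) refl
               (coeff r) (p ^ tri r) (1# + p ^ (l ℕ.+ suc b)) (p ^ l) (p ^ suc (suc b)) _ _ _ ⟩
        (1# + p ^ (l ℕ.+ suc b)) * (coeff r * p ^ tri r * (I⁻ l * I (suc b))) + t₂ r l + t₃ r l
          ≈⟨ +-congʳ (+-congʳ (*-congʳ (+-congˡ (reflexive (≡.cong (p ^_) exponent))))) ⟨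
        (t₁ r l + t₂ r l) + t₃ r l
          ∎
        where
        b : ℕ
        b = r ℕ.+ n
        index : suc (r ℕ.+ (r ℕ.+ l)) ≡ suc (suc b)
        index = ≡.cong suc (≡.trans (≡.cong (r ℕ.+_) e) (ℕ.+-suc r n))
        exponent : suc m ≡ l ℕ.+ suc b
        exponent = ≡.trans (≡.cong (ℕ._+ suc n) (≡.sym e))
          (split-exponent r l n)

      sum₁ : conv t₁ (suc n) ≈ (1# + p ^ suc m) * β n
      sum₁ = begin
        conv t₁ (suc n)
          ≈⟨ trans (conv-*ˡ _ _ (suc n)) (*-congˡ (conv-last _ n)) ⟩
        (1# + p ^ suc m) * (conv (λ r l → coeff r * p ^ tri r * (I l * I (suc (r ℕ.+ n)))) n +
                            coeff (suc n) * p ^ tri (suc n) * (0# * I (suc (suc n ℕ.+ n))))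
          ≈⟨ *-congˡ (trans (+-congˡ (trans (*-congˡ (zeroˡ _)) (zeroʳ _))) (+-identityʳ _)) ⟩
        (1# + p ^ suc m) * conv (λ r l → coeff r * p ^ tri r * (I l * I (suc (r ℕ.+ n)))) n
          ≈⟨ *-congˡ (conv-cong n (λ { r l ≡.refl → *-assoc _ _ _ })) ⟩
        (1# + p ^ suc m) * β n
          ∎

      sum₂ : conv t₂ (suc n) ≈ P * (term 0 n + conv (λ r l → coeff (suc r) * term r l) n)
      sum₂ = begin
        conv t₂ (suc n)
          ≈⟨ conv-suc _ n ⟩
        1# * (1# * P) * (I (suc n) * I n) +
        conv (λ r l → coeff (suc r) * (p ^ tri (suc r) * p ^ l) * (I l * I (suc (r ℕ.+ n)))) n
          ≈⟨ +-cong
               (solve 3 (λ P a b → con (+ 1) :* (con (+ 1) :* P) :* (a :* b) := P :* (con (+ 1) :* (b :* a)))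
                 refl P (I (suc n)) (I n))
               (conv-cong n (λ { r l ≡.refl → trans
                 (*-congʳ (*-congˡ (trans (*-congʳ (^-homo-* p (suc r) (tri r))) (trans
                   (solve 3 (λ x y z → x :* y :* z := (x :* z) :* y) refl (p ^ suc r) (p ^ tri r) (p ^ l))
                   (*-congʳ (sym (^-homo-* p (suc r) l)))))))
                 (solve 4 (λ c P t A → c :* (P :* t) :* A := P :* (c :* (t :* A))) refl _ _ _ _) })) ⟩
        P * term 0 n + conv (λ r l → P * (coeff (suc r) * term r l)) n
          ≈⟨ +-congˡ (conv-*ˡ _ _ n) ⟩
        P * term 0 n + P * conv (λ r l → coeff (suc r) * term r l) n
          ≈⟨ distribˡ _ _ _ ⟨
        P * (term 0 n + conv (λ r l → coeff (suc r) * term r l) n)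
          ∎

      sum₃ : conv t₃ (suc n) ≈ P * (conv (λ r l → coeff′ r * term r l) n - term 0 n)
      sum₃ = conv-upper n

      recombine : conv (λ r l → coeff (suc r) * term r l) n + conv (λ r l → coeff′ r * term r l) n
        ≈ - 1# * β n
      recombine = begin
        conv (λ r l → coeff (suc r) * term r l) n + conv (λ r l → coeff′ r * term r l) n
          ≈⟨ conv-+ _ _ n ⟨
        conv (λ r l → coeff (suc r) * term r l + coeff′ r * term r l) n
          ≈⟨ conv-cong n (λ r l _ → trans (sym (distribʳ _ _ _)) (trans (*-congʳ (coeff-recurrence r))
               (solve 2 (λ c t → :- c :* t := :- con (+ 1) :* (c :* t)) refl _ _))) ⟩
        conv (λ r l → - 1# * (coeff r * term r l)) n
          ≈⟨ conv-*ˡ _ _ n ⟩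
        - 1# * β n
          ∎

    -- The finite Jacobi triple product at a primitive sixth root of unity.
    β-product : ∀ n → β n ≈ Φ₆∏ p n * I (suc (n ℕ.+ n))
    β-product zero = begin
      β 0                           ≈⟨ conv-zero _ ⟩
      1# * (1# * (I 0 * I 1))       ≈⟨ *-congˡ (*-congˡ (trans (*-congʳ I-zero) (*-identityˡ _))) ⟩
      1# * (1# * I 1)               ≈⟨ *-congˡ (*-identityˡ _) ⟩
      1# * I 1                      ∎
    β-product (suc n) = unit-cancel (unit (n ℕ.+ suc n)) (unit-cancel (unit (suc (n ℕ.+ suc n))) (begin
      (1# - p ^ suc (suc (n ℕ.+ suc n))) * ((1# - p ^ suc (n ℕ.+ suc n)) * β (suc n))
        ≈⟨ solve 3 (λ x y b → y :* (x :* b) := x :* y :* b) refl _ _ _ ⟩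
      (1# - p ^ suc (n ℕ.+ suc n)) * (1# - p ^ suc (suc (n ℕ.+ suc n))) * β (suc n)
        ≈⟨ β-recurrence n ⟩
      (1# - p ^ suc n + p ^ suc n * p ^ suc n) * β n
        ≈⟨ *-congˡ (β-product n) ⟩
      (1# - p ^ suc n + p ^ suc n * p ^ suc n) * (Φ₆∏ p n * I (suc (n ℕ.+ n)))
        ≈⟨ *-congˡ (*-congˡ lower) ⟩
      (1# - p ^ suc n + p ^ suc n * p ^ suc n) *
      (Φ₆∏ p n * ((1# - p ^ suc (n ℕ.+ suc n)) * ((1# - p ^ suc (suc (n ℕ.+ suc n))) * I (suc (suc (n ℕ.+ suc n))))))
        ≈⟨ solve 5 (λ a f x y A → a :* (f :* (x :* (y :* A))) := y :* (x :* (f :* a :* A))) refl _ _ _ _ _ ⟩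
      (1# - p ^ suc (suc (n ℕ.+ suc n))) * ((1# - p ^ suc (n ℕ.+ suc n)) * (Φ₆∏ p (suc n) * I (suc (suc n ℕ.+ suc n))))
        ∎))
      where
      lower : I (suc (n ℕ.+ n)) ≈
        (1# - p ^ suc (n ℕ.+ suc n)) * ((1# - p ^ suc (suc (n ℕ.+ suc n))) * I (suc (suc (n ℕ.+ suc n))))
      lower = begin
        I (suc (n ℕ.+ n))     ≡⟨ ≡.cong I (ℕ.+-suc n n) ⟨
        I (n ℕ.+ suc n)       ≈⟨ I-step (n ℕ.+ suc n) ⟨
        (1# - p ^ suc (n ℕ.+ suc n)) * I (suc (n ℕ.+ suc n))
          ≈⟨ *-congˡ (I-step (suc (n ℕ.+ suc n))) ⟨
        (1# - p ^ suc (n ℕ.+ suc n)) * ((1# - p ^ suc (suc (n ℕ.+ suc n))) * I (suc (suc (n ℕ.+ suc n))))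
          ∎

    -- The finite Bailey lemma with both free parameters sent to infinity. Expand β and exchange the
    -- sums; for m = r + k the weight splits as p^(r(r+1)) p^(k(k+2r+1)), and the sum over k is
    -- `conv-vandermonde` with shift 2r + 1.
    bailey : ∀ n →
      conv (λ m l → p ^ (m ℕ.* (m ℕ.+ 1)) * (Φ₆∏ p m * I (suc (m ℕ.+ m))) * I l) n ≈
      conv (λ r l → coeff r * (p ^ 3) ^ tri r * (I l * I (suc (r ℕ.+ (r ℕ.+ l))))) n
    bailey n = begin
      conv (λ m l → p ^ (m ℕ.* (m ℕ.+ 1)) * (Φ₆∏ p m * I (suc (m ℕ.+ m))) * I l) n
        ≈⟨ conv-cong n (λ m l _ → expand m l) ⟩
      conv (λ m l → conv (λ r k → summand r k l) m) n
        ≈⟨ conv-assoc summand n ⟩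
      conv (λ r m → conv (λ k l → summand r k l) m) n
        ≈⟨ conv-cong n (λ r m _ → collect r m) ⟩
      conv (λ r l → coeff r * (p ^ 3) ^ tri r * (I l * I (suc (r ℕ.+ (r ℕ.+ l))))) n
        ∎
      where
      summand : ℕ → ℕ → ℕ → Carrier
      summand r k l = coeff r * (p ^ 3) ^ tri r *
        (p ^ (k ℕ.* (k ℕ.+ suc (r ℕ.+ r))) * I (k ℕ.+ suc (r ℕ.+ r)) * (I k * I l))

      powers : ∀ r k → p ^ ((r ℕ.+ k) ℕ.* ((r ℕ.+ k) ℕ.+ 1)) * p ^ tri r ≈
        (p ^ 3) ^ tri r * p ^ (k ℕ.* (k ℕ.+ suc (r ℕ.+ r)))
      powers r k = begin
        p ^ ((r ℕ.+ k) ℕ.* ((r ℕ.+ k) ℕ.+ 1)) * p ^ tri r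
          ≡⟨ ≡.cong (λ e → p ^ e * p ^ tri r) (bailey-exponent r k) ⟩
        p ^ (r ℕ.* (r ℕ.+ 1) ℕ.+ k ℕ.* (k ℕ.+ suc (r ℕ.+ r))) * p ^ tri r
          ≈⟨ *-congʳ (^-homo-* p (r ℕ.* (r ℕ.+ 1)) _) ⟩
        p ^ (r ℕ.* (r ℕ.+ 1)) * p ^ (k ℕ.* (k ℕ.+ suc (r ℕ.+ r))) * p ^ tri r
          ≈⟨ solve 3 (λ x y z → x :* y :* z := (z :* x) :* y) refl _ _ _ ⟩
        p ^ tri r * p ^ (r ℕ.* (r ℕ.+ 1)) * p ^ (k ℕ.* (k ℕ.+ suc (r ℕ.+ r)))
          ≈⟨ *-congʳ (^-split (tri r) (r ℕ.* (r ℕ.+ 1)) (tri-triple r)) ⟩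
        p ^ (3 ℕ.* tri r) * p ^ (k ℕ.* (k ℕ.+ suc (r ℕ.+ r)))
          ≈⟨ *-congʳ (^-assocʳ p 3 (tri r)) ⟨
        (p ^ 3) ^ tri r * p ^ (k ℕ.* (k ℕ.+ suc (r ℕ.+ r)))
          ∎

      expand : ∀ m l → p ^ (m ℕ.* (m ℕ.+ 1)) * (Φ₆∏ p m * I (suc (m ℕ.+ m))) * I l ≈
        conv (λ r k → summand r k l) m
      expand m l = begin
        p ^ (m ℕ.* (m ℕ.+ 1)) * (Φ₆∏ p m * I (suc (m ℕ.+ m))) * I l
          ≈⟨ *-congʳ (*-congˡ (β-product m)) ⟨
        p ^ (m ℕ.* (m ℕ.+ 1)) * β m * I l
          ≈⟨ solve 3 (λ x y z → x :* y :* z := (x :* z) :* y) refl _ _ _ ⟩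
        p ^ (m ℕ.* (m ℕ.+ 1)) * I l * β m
          ≈⟨ conv-*ˡ _ _ m ⟨
        conv (λ r k → p ^ (m ℕ.* (m ℕ.+ 1)) * I l * (coeff r * term r k)) m
          ≈⟨ conv-cong m (λ { r k ≡.refl → trans
               (solve 6 (λ a l c t x y → a :* l :* (c :* (t :* (x :* y))) := c :* (a :* t) :* (y :* (x :* l)))
                 refl (p ^ (m ℕ.* (m ℕ.+ 1))) (I l) (coeff r) (p ^ tri r) (I k) (I (suc (r ℕ.+ (r ℕ.+ k)))))
               (trans
                 (*-cong (*-congˡ (powers r k))
                   (*-congʳ (reflexive (≡.cong I (bailey-index r k)))))
                 (solve 5 (λ c t x y z → c :* (t :* x) :* (y :* z) := c :* t :* (x :* y :* z)) refl
                   _ _ _ _ _)) }) ⟩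
        conv (λ r k → summand r k l) m
          ∎

      collect : ∀ r m → conv (λ k l → summand r k l) m ≈
        coeff r * (p ^ 3) ^ tri r * (I m * I (suc (r ℕ.+ (r ℕ.+ m))))
      collect r m = trans (conv-*ˡ _ _ m) (*-congˡ (trans (conv-vandermonde m (suc (r ℕ.+ r)))
        (*-congˡ (reflexive (≡.cong I (≡.sym (bailey-index r m)))))))

  -- Product identities for q-Pochhammer symbols

  poch : Carrier → Carrier → ℕ → Carrier
  poch x q = ∏ (λ j → 1# - x * q ^ j)

  poch-cong : ∀ {x y p q} → x ≈ y → p ≈ q → ∀ n → poch x p n ≈ poch y q n
  poch-cong x≈y p≈q = ∏-cong (λ j → +-congˡ (-‿cong (*-cong x≈y (^-congˡ j p≈q))))

  ^-swap : ∀ x a m b n → a ℕ.* m ≡ b ℕ.+ n → (x ^ a) ^ m ≈ x ^ b * x ^ n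
  ^-swap x a m b n e = trans (^-assocʳ x a m)
    (trans (reflexive (≡.cong (x ^_) e)) (^-homo-* x b n))

  ^-comm : ∀ x a m → (x ^ a) ^ m ≈ (x ^ m) ^ a
  ^-comm x a m = trans (^-assocʳ x a m)
    (trans (reflexive (≡.cong (x ^_) (ℕ.*-comm a m))) (sym (^-assocʳ x m a)))

  -- Factorwise this is the cyclotomic identity Φ₆(x) (1 - x²)(1 - x³) = (1 - x⁶)(1 - x).
  Φ₆∏-poch : ∀ q n →
    Φ₆∏ q n * (poch (q ^ 2) (q ^ 2) n * poch (q ^ 3) (q ^ 3) n) ≈ poch (q ^ 6) (q ^ 6) n * poch q q n
  Φ₆∏-poch q n = begin
    Φ₆∏ q n * (poch (q ^ 2) (q ^ 2) n * poch (q ^ 3) (q ^ 3) n)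
      ≈⟨ trans (∏-* _ _ n) (*-congˡ (∏-* _ _ n)) ⟨
    ∏ (λ j → (1# - q ^ suc j + q ^ suc j * q ^ suc j) *
             ((1# - (q ^ 2) ^ suc j) * (1# - (q ^ 3) ^ suc j))) n
      ≈⟨ ∏-cong factor n ⟩
    ∏ (λ j → (1# - (q ^ 6) ^ suc j) * (1# - q ^ suc j)) n
      ≈⟨ ∏-* _ _ n ⟩
    poch (q ^ 6) (q ^ 6) n * poch q q n
      ∎
    where
    factor : ∀ j → (1# - q ^ suc j + q ^ suc j * q ^ suc j) *
        ((1# - (q ^ 2) ^ suc j) * (1# - (q ^ 3) ^ suc j)) ≈ (1# - (q ^ 6) ^ suc j) * (1# - q ^ suc j)
    factor j = begin
      (1# - x + x * x) * ((1# - (q ^ 2) ^ suc j) * (1# - (q ^ 3) ^ suc j))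
        ≈⟨ *-congˡ (*-cong (+-congˡ (-‿cong (^-comm q 2 (suc j)))) (+-congˡ (-‿cong (^-comm q 3 (suc j))))) ⟩
      (1# - x + x * x) * ((1# - x ^ 2) * (1# - x ^ 3))
        ≈⟨ solve 1 (λ x → (con (+ 1) :- x :+ x :* x) :*
             ((con (+ 1) :- x :* (x :* con (+ 1))) :* (con (+ 1) :- x :* (x :* (x :* con (+ 1))))) :=
             (con (+ 1) :- x :* (x :* (x :* (x :* (x :* (x :* con (+ 1))))))) :* (con (+ 1) :- x)) refl x ⟩
      (1# - x ^ 6) * (1# - x)
        ≈⟨ *-congʳ (+-congˡ (-‿cong (^-comm q 6 (suc j)))) ⟨
      (1# - (q ^ 6) ^ suc j) * (1# - x)
        ∎
      where
      x : Carrier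
      x = q ^ suc j

  -- Sorting the factors 1 - q^j with j ≤ 6n by the residue of j modulo 6.
  poch-residues : ∀ q n →
    poch q q (n ℕ.* 6) * poch (q ^ 6) (q ^ 6) n ≈
    poch q (q ^ 6) n * poch (q ^ 5) (q ^ 6) n *
    (poch (q ^ 2) (q ^ 2) (n ℕ.* 3) * poch (q ^ 3) (q ^ 3) (n ℕ.* 2))
  poch-residues q zero    = solve 0 (con (+ 1) :* con (+ 1) :=
    con (+ 1) :* con (+ 1) :* (con (+ 1) :* con (+ 1))) refl
  poch-residues q (suc n) = begin
    poch q q (n ℕ.* 6) * f₁ 0 * f₁ 1 * f₁ 2 * f₁ 3 * f₁ 4 * f₁ 5 *
    (poch (q ^ 6) (q ^ 6) n * (1# - (q ^ 6) ^ suc n))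
      ≈⟨ *-cong (*-cong (*-cong (*-cong (*-cong (*-cong (*-congˡ
           (e₁ 0)) (e₁ 1)) (e₁ 2)) (e₁ 3)) (e₁ 4)) (e₁ 5)) (*-congˡ (f≈e 6 (suc n) 6 (residue₆ n))) ⟩
    poch q q (n ℕ.* 6) * e 1 * e 2 * e 3 * e 4 * e 5 * e 6 * (poch (q ^ 6) (q ^ 6) n * e 6)
      -- Multiples of 6 are counted once among the multiples of 2 and once among those of 3; the
      -- copy of `e 6` from (q⁶;q⁶)_n balances this.
      ≈⟨ solve 8 (λ a b e₁ e₂ e₃ e₄ e₅ e₆ →
           a :* e₁ :* e₂ :* e₃ :* e₄ :* e₅ :* e₆ :* (b :* e₆) :=
           (a :* b) :* ((e₁ :* e₅) :* ((e₂ :* e₄ :* e₆) :* (e₃ :* e₆)))) refl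
           _ _ (e 1) (e 2) (e 3) (e 4) (e 5) (e 6) ⟩
    (poch q q (n ℕ.* 6) * poch (q ^ 6) (q ^ 6) n) * ((e 1 * e 5) * ((e 2 * e 4 * e 6) * (e 3 * e 6)))
      ≈⟨ *-congʳ (poch-residues q n) ⟩
    (poch q (q ^ 6) n * poch (q ^ 5) (q ^ 6) n *
    (poch (q ^ 2) (q ^ 2) (n ℕ.* 3) * poch (q ^ 3) (q ^ 3) (n ℕ.* 2))) *
    ((e 1 * e 5) * ((e 2 * e 4 * e 6) * (e 3 * e 6)))
      ≈⟨ solve 10 (λ b c p₂ p₃ e₁ e₂ e₃ e₄ e₅ e₆ →
           (b :* c :* (p₂ :* p₃)) :* ((e₁ :* e₅) :* ((e₂ :* e₄ :* e₆) :* (e₃ :* e₆))) :=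
           (b :* e₁) :* (c :* e₅) :* ((p₂ :* e₂ :* e₄ :* e₆) :* (p₃ :* e₃ :* e₆))) refl
           _ _ _ _ (e 1) (e 2) (e 3) (e 4) (e 5) (e 6) ⟩
    (poch q (q ^ 6) n * e 1) * (poch (q ^ 5) (q ^ 6) n * e 5) *
    ((poch (q ^ 2) (q ^ 2) (n ℕ.* 3) * e 2 * e 4 * e 6) * (poch (q ^ 3) (q ^ 3) (n ℕ.* 2) * e 3 * e 6))
      ≈⟨ *-cong (*-cong (*-congˡ e₁′) (*-congˡ e₅′)) (*-cong
           (*-cong (*-cong (*-congˡ (f≈e 2 (suc (n ℕ.* 3)) 2 (residue₂ 0 n))) (f≈e 2 (suc (suc (n ℕ.* 3))) 4 (residue₂ 1 n))) (f≈e 2 (suc (suc (suc (n ℕ.* 3)))) 6 (residue₂ 2 n)))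
           (*-cong (*-congˡ (f≈e 3 (suc (n ℕ.* 2)) 3 (residue₃ 0 n))) (f≈e 3 (suc (suc (n ℕ.* 2))) 6 (residue₃ 1 n)))) ⟨
    poch q (q ^ 6) (suc n) * poch (q ^ 5) (q ^ 6) (suc n) *
    (poch (q ^ 2) (q ^ 2) (suc n ℕ.* 3) * poch (q ^ 3) (q ^ 3) (suc n ℕ.* 2))
      ∎
    where
    e f₁ : ℕ → Carrier
    e i  = 1# - q ^ i * q ^ (6 ℕ.* n)
    f₁ i = 1# - q ^ suc (i ℕ.+ n ℕ.* 6)
    e₁ : ∀ i → f₁ i ≈ e (suc i)
    e₁ i = +-congˡ (-‿cong (trans (reflexive (≡.cong (q ^_) (residue₁ i n))) (^-homo-* q (suc i) (6 ℕ.* n))))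
    f≈e : ∀ a m i → a ℕ.* m ≡ i ℕ.+ 6 ℕ.* n → 1# - (q ^ a) ^ m ≈ e i
    f≈e a m i eq = +-congˡ (-‿cong (^-swap q a m i (6 ℕ.* n) eq))
    e₁′ : 1# - q * (q ^ 6) ^ n ≈ e 1
    e₁′ = +-congˡ (-‿cong (*-cong (sym (*-identityʳ q)) (^-assocʳ q 6 n)))
    e₅′ : 1# - q ^ 5 * (q ^ 6) ^ n ≈ e 5
    e₅′ = +-congˡ (-‿cong (*-congˡ (^-assocʳ q 6 n)))

-- Limits at a geometric rate

-- x ≼ r stands for |x| ≤ r.
record CompleteNormedRing : Set₁ where
  field
    commutativeRing : CommutativeRing 0ℓ 0ℓ
  open CommutativeRing commutativeRing
  infix 4 _≼_
  field
    _≼_      : Carrier → ℚ → Set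
    ≼-resp   : ∀ {x y r} → x ≈ y → x ≼ r → y ≼ r
    ≼-mono   : ∀ {x r s} → r ℚ.≤ s → x ≼ r → x ≼ s
    ≼-closed : ∀ {x r} → (∀ ε → 0ℚ ℚ.< ε → x ≼ r ℚ.+ ε) → x ≼ r
    ≼-0      : 0# ≼ 0ℚ
    ≼-1      : 1# ≼ 1ℚ
    ≼-+      : ∀ {x y r s} → x ≼ r → y ≼ s → x + y ≼ r ℚ.+ s
    ≼-*      : ∀ {x y r s} → x ≼ r → y ≼ s → x * y ≼ r ℚ.* s
    ≼-neg    : ∀ {x r} → x ≼ r → - x ≼ r
    ≼⇒0≤     : ∀ {x r} → x ≼ r → 0ℚ ℚ.≤ r
    ≼-bound  : ∀ x → ∃[ r ] x ≼ r
    ≼0⇒≈0    : ∀ {x} → x ≼ 0ℚ → x ≈ 0#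
    complete : ∀ (s : ℕ → Carrier) →
      (∀ ε → 0ℚ ℚ.< ε → ∃[ N ] (∀ m n → N ℕ.≤ m → N ℕ.≤ n → s m - s n ≼ ε)) →
      ∃[ l ] (∀ ε → 0ℚ ℚ.< ε → ∃[ N ] (∀ n → N ℕ.≤ n → s n - l ≼ ε))

module GeometricLimits
  (R : CompleteNormedRing) (σ : ℚ) (0≤σ : 0ℚ ℚ.≤ σ) (σ<1 : σ ℚ.< 1ℚ) where

  open import Data.Integer.Base using (+_)
  open CompleteNormedRing R
  open CommutativeRing commutativeRing
  open IntegerCoefficients commutativeRing
  open FiniteIdentities commutativeRing
  open import Algebra.Properties.Semiring.Exp semiring using (_^_)
  open import Relation.Binary.Reasoning.Setoid setoid

  σ^ : ℕ → ℚ
  σ^ n = σ ^ℚ n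

  0≤σ^ : ∀ n → 0ℚ ℚ.≤ σ^ n
  0≤σ^ = ^-nonNeg 0≤σ

  σ^-antimono : ∀ m n → m ℕ.≤ n → σ^ n ℚ.≤ σ^ m
  σ^-antimono m n = ^-antimono 0≤σ (ℚ.<⇒≤ σ<1) {m} {n}

  private
    1-σ-inverse : ∃[ r ] (0ℚ ℚ.< r × (1ℚ ℚ.- σ) ℚ.* r ≡ 1ℚ)
    1-σ-inverse = reciprocal (<⇒0<- σ<1)

  L : ℚ
  L = proj₁ 1-σ-inverse

  private
    0≤L : 0ℚ ℚ.≤ L
    0≤L = ℚ.<⇒≤ (proj₁ (proj₂ 1-σ-inverse))

    module Q = +-*-Solver

    -- Head plus tail of a geometric series of ratio σ; it closes the inductions of
    -- `geometric-limit` and `conv-≼`.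
    geometric-step : ∀ D → D ℚ.+ D ℚ.* σ ℚ.* L ≡ D ℚ.* L
    geometric-step D = ≡.trans
      (≡.cong (ℚ._+ D ℚ.* σ ℚ.* L) (≡.sym (ℚ.*-identityʳ D))) (≡.trans
      (≡.cong (λ u → D ℚ.* u ℚ.+ D ℚ.* σ ℚ.* L) (≡.sym (proj₂ (proj₂ 1-σ-inverse))))
      (Q.solve 3 (λ D s L → D Q.:* ((Q.con 1ℚ Q.:- s) Q.:* L) Q.:+ D Q.:* s Q.:* L Q.:= D Q.:* L)
        ≡.refl D σ L))

  ≼-cong : ∀ {x r s} → r ≡ s → x ≼ r → x ≼ s
  ≼-cong r≡s = ≼-mono (ℚ.≤-reflexive r≡s)

  -- Building the rate σ^n into the definition replaces every choice of N by arithmetic on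
  -- constants. Subsequences keep the rate as long as their indices satisfy n ≤ f n.
  Bounded Null : (ℕ → Carrier) → Set
  Bounded s = ∃[ B ] (∀ n → s n ≼ B)
  Null s    = ∃[ C ] (∀ n → s n ≼ C ℚ.* σ^ n)

  infix 4 _⇝_
  _⇝_ : (ℕ → Carrier) → Carrier → Set
  s ⇝ l = Null (λ n → s n - l)

  null-resp : ∀ {s t} → (∀ n → s n ≈ t n) → Null s → Null t
  null-resp s≈t (C , h) = C , λ n → ≼-resp (s≈t n) (h n)

  null-+ : ∀ {s t} → Null s → Null t → Null (λ n → s n + t n)
  null-+ (C , f) (D , g) = C ℚ.+ D , λ n →
    ≼-cong (≡.sym (ℚ.*-distribʳ-+ (σ^ n) C D)) (≼-+ (f n) (g n))

  null-neg : ∀ {s} → Null s → Null (λ n → - s n)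
  null-neg (C , f) = C , λ n → ≼-neg (f n)

  null-*ˡ : ∀ {s t} → Bounded s → Null t → Null (λ n → s n * t n)
  null-*ˡ (B , f) (D , g) = B ℚ.* D , λ n →
    ≼-cong (≡.sym (ℚ.*-assoc B D (σ^ n))) (≼-* (f n) (g n))

  null-sub : ∀ {s} (f : ℕ → ℕ) → (∀ n → n ℕ.≤ f n) → Null s → Null (λ n → s (f n))
  null-sub f n≤f (C , h) = C , λ n → ≼-mono
    (ℚ.*-monoˡ-≤-nonNeg C {{ℚ.nonNegative 0≤C}} (σ^-antimono n (f n) (n≤f n))) (h (f n))
    where
    0≤C : 0ℚ ℚ.≤ C
    0≤C = ≡.subst (0ℚ ℚ.≤_) (ℚ.*-identityʳ C) (≼⇒0≤ (h 0))

  null-eventually : ∀ {s} → Null s → ∀ ε → 0ℚ ℚ.< ε → ∃[ N ] (∀ n → N ℕ.≤ n → s n ≼ ε)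
  null-eventually (C , h) ε 0<ε =
    let N , small = ^-small {C = C} 0≤σ σ<1 (≡.subst (0ℚ ℚ.≤_) (ℚ.*-identityʳ C) (≼⇒0≤ (h 0))) 0<ε
    in N , λ n N≤n → ≼-mono (small n N≤n) (h n)

  null-const : ∀ {x} → Null (λ _ → x) → x ≈ 0#
  null-const null = ≼0⇒≈0 (≼-closed λ ε 0<ε →
    let N , h = null-eventually null ε 0<ε
    in ≼-cong (≡.sym (ℚ.+-identityˡ ε)) (h N ℕ.≤-refl))

  -≈0⇒≈ : ∀ {x y} → x - y ≈ 0# → x ≈ y
  -≈0⇒≈ {x} {y} x-y≈0 = begin
    x              ≈⟨ solve 2 (λ x y → x := (x :- y) :+ y) refl x y ⟩
    (x - y) + y    ≈⟨ +-congʳ x-y≈0 ⟩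
    0# + y         ≈⟨ +-identityˡ y ⟩
    y              ∎

  ⇝-bounded : ∀ {s l} → s ⇝ l → Bounded s
  ⇝-bounded {s} {l} (C , h) =
    let B , l≼B = ≼-bound l
        0≤C = ≡.subst (0ℚ ℚ.≤_) (ℚ.*-identityʳ C) (≼⇒0≤ (h 0))
    in C ℚ.+ B , λ n → ≼-resp (solve 2 (λ s l → (s :- l) :+ l := s) refl (s n) l)
      (≼-+ (≼-mono (ℚ.≤-trans (ℚ.*-monoˡ-≤-nonNeg C {{ℚ.nonNegative 0≤C}} (σ^-antimono 0 n ℕ.z≤n))
        (ℚ.≤-reflexive (ℚ.*-identityʳ C))) (h n)) l≼B)

  ⇝-cong : ∀ {s t l} → (∀ n → s n ≈ t n) → s ⇝ l → t ⇝ l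
  ⇝-cong s≈t = null-resp (λ n → +-congʳ (s≈t n))

  ⇝-congʳ : ∀ {s l m} → l ≈ m → s ⇝ l → s ⇝ m
  ⇝-congʳ l≈m = null-resp (λ n → +-congˡ (-‿cong l≈m))

  ⇝-const : ∀ x → (λ _ → x) ⇝ x
  ⇝-const x = 0ℚ , λ n →
    ≼-cong (≡.sym (ℚ.*-zeroˡ (σ^ n))) (≼-resp (sym (-‿inverseʳ x)) ≼-0)

  ⇝-sub : ∀ {s l} (f : ℕ → ℕ) → (∀ n → n ℕ.≤ f n) → s ⇝ l → (λ n → s (f n)) ⇝ l
  ⇝-sub f n≤f = null-sub f n≤f

  ⇝-* : ∀ {s t l m} → s ⇝ l → t ⇝ m → (λ n → s n * t n) ⇝ l * m
  ⇝-* {s} {t} {l} {m} s⇝l t⇝m = null-resp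
    (λ n → solve 4 (λ s t l m → s :* (t :- m) :+ m :* (s :- l) := s :* t :- l :* m) refl (s n) (t n) l m)
    (null-+ (null-*ˡ (⇝-bounded s⇝l) t⇝m)
      (null-*ˡ (proj₁ (≼-bound m) , λ _ → proj₂ (≼-bound m)) s⇝l))

  ⇝-unique : ∀ {s l m} → s ⇝ l → s ⇝ m → l ≈ m
  ⇝-unique {s} {l} {m} s⇝l s⇝m = -≈0⇒≈ (null-const (null-resp
    (λ n → solve 3 (λ s l m → :- (s :- l) :+ (s :- m) := l :- m) refl (s n) l m)
    (null-+ (null-neg s⇝l) s⇝m)))

  ⇝-null : ∀ {s t l} → Null (λ n → s n - t n) → s ⇝ l → t ⇝ l
  ⇝-null {s} {t} {l} null s⇝l = null-resp
    (λ n → solve 3 (λ s t l → :- (s :- t) :+ (s :- l) := t :- l) refl (s n) (t n) l)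
    (null-+ (null-neg null) s⇝l)

  -- Abstract, so that limits remain neutral terms.
  abstract
    geometric-limit : ∀ (s : ℕ → Carrier) {C} → (∀ n → s (suc n) - s n ≼ C ℚ.* σ^ n) →
      ∃[ l ] (∀ n → s n - l ≼ C ℚ.* L ℚ.* σ^ n)
    geometric-limit s {C} step = bound (complete s cauchy)
      where
      0≤C : 0ℚ ℚ.≤ C
      0≤C = ≡.subst (0ℚ ℚ.≤_) (ℚ.*-identityʳ C) (≼⇒0≤ (step 0))
      0≤CL : 0ℚ ℚ.≤ C ℚ.* L
      0≤CL = 0≤* 0≤C 0≤L
      ahead : ∀ (k n : ℕ) → s (k ℕ.+ n) - s n ≼ C ℚ.* L ℚ.* σ^ n
      ahead zero    n = ≼-mono (0≤* 0≤CL (0≤σ^ n)) (≼-resp (sym (-‿inverseʳ _)) ≼-0)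
      ahead (suc k) n = ≼-cong
        (≡.trans
          (Q.solve 4 (λ C s L x → C Q.:* x Q.:+ C Q.:* L Q.:* (s Q.:* x) Q.:= (C Q.:+ C Q.:* s Q.:* L) Q.:* x)
            ≡.refl C σ L (σ^ n))
          (≡.cong (ℚ._* σ^ n) (geometric-step C)))
        (≼-resp
          (trans (+-congˡ (+-congʳ (reflexive (≡.cong s (ℕ.+-suc k n)))))
            (solve 3 (λ a b c → (b :- c) :+ (a :- b) := a :- c) refl (s (suc k ℕ.+ n)) (s (suc n)) (s n)))
          (≼-+ (step n) (ahead k (suc n))))
      close : ∀ {m n} → n ℕ.≤ m → s m - s n ≼ C ℚ.* L ℚ.* σ^ n
      close {m} {n} n≤m = ≼-resp
        (+-congʳ (reflexive (≡.cong s (ℕ.m∸n+n≡m n≤m)))) (ahead (m ℕ.∸ n) n)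
      cauchy : ∀ ε → 0ℚ ℚ.< ε → ∃[ N ] (∀ m n → N ℕ.≤ m → N ℕ.≤ n → s m - s n ≼ ε)
      cauchy ε 0<ε =
        let N , small = ^-small 0≤σ σ<1 0≤CL (0<* 0<ε (ℚ.positive⁻¹ ½))
        in N , λ m n N≤m N≤n → ≼-cong
          (≡.trans (≡.sym (ℚ.*-distribˡ-+ ε ½ ½)) (ℚ.*-identityʳ ε))
          (≼-resp (solve 3 (λ a b c → (a :- c) :+ :- (b :- c) := a :- b) refl (s m) (s n) (s N))
            (≼-+ (≼-mono (small N ℕ.≤-refl) (close N≤m)) (≼-neg (≼-mono (small N ℕ.≤-refl) (close N≤n)))))
      bound : ∃[ l ] (∀ ε → 0ℚ ℚ.< ε → ∃[ N ] (∀ n → N ℕ.≤ n → s n - l ≼ ε)) →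
        ∃[ l ] (∀ n → s n - l ≼ C ℚ.* L ℚ.* σ^ n)
      -- Completeness alone yields no rate. It is recovered by comparing with a distant `s m`, then
      -- letting ε tend to 0 through `≼-closed`.
      bound (l , h) = l , λ n → ≼-closed λ ε 0<ε →
        let N , near = h ε 0<ε
            m = N ℕ.+ n
        in ≼-resp (solve 3 (λ a b c → :- (b :- a) :+ (b :- c) := a :- c) refl (s n) (s m) l)
          (≼-+ (≼-neg (close (ℕ.m≤n+m n N))) (near m (ℕ.m≤m+n N n)))

    -- Successive partial products differ by w_n times the n-th one, and the rational majorant ∏ (1
    -- + W σ^j) is bounded, so the differences decay like σ^n.
    ∏-converges : ∀ {w : ℕ → Carrier} {W} → (∀ j → w j ≼ W ℚ.* σ^ j) → ∃[ l ] ∏ (λ j → 1# + w j) ⇝ l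
    ∏-converges {w} {W} w≼ =
      let K , u≤K = geometric-products-bounded 0≤σ σ<1 0≤W u (ℚ.nonNegative⁻¹ 1ℚ) (λ _ → ≡.refl)
          l , h = geometric-limit (∏ (λ j → 1# + w j)) {K ℚ.* W} (λ n → ≼-cong
            (≡.sym (ℚ.*-assoc K W (σ^ n)))
            (≼-resp (solve 2 (λ P w → P :* w := P :* (con (+ 1) :+ w) :- P) refl _ (w n))
              (≼-* (≼-mono (u≤K n) (≼u n)) (w≼ n))))
      in l , K ℚ.* W ℚ.* L , h
      where
      0≤W : 0ℚ ℚ.≤ W
      0≤W = ≡.subst (0ℚ ℚ.≤_) (ℚ.*-identityʳ W) (≼⇒0≤ (w≼ 0))
      u : ℕ → ℚ
      u zero    = 1ℚ
      u (suc n) = u n ℚ.* (1ℚ ℚ.+ W ℚ.* σ^ n)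
      ≼u : ∀ n → ∏ (λ j → 1# + w j) n ≼ u n
      ≼u zero    = ≼-1
      ≼u (suc n) = ≼-* (≼u n) (≼-+ ≼-1 (w≼ n))

    -- The sum of the powers of x. Its bound depends on C alone, hence is uniform over x = p^(j+1);
    -- the convergence of the reciprocal product relies on this.
    geometric-inverse : ∀ {x C} → (∀ n → x ^ n ≼ C ℚ.* σ^ n) →
      ∃[ y ] ((1# - x) * y ≈ 1# × y ≼ C ℚ.* L)
    geometric-inverse {x} {C} x^n≼ = let y , h = limit in y , inverse y h , y≼ y h
      where
      g : ℕ → Carrier
      g zero    = 0#
      g (suc n) = g n + x ^ n
      limit : ∃[ l ] (∀ n → g n - l ≼ C ℚ.* L ℚ.* σ^ n)
      limit = geometric-limit g {C} (λ n →
        ≼-resp (solve 2 (λ g x → x := (g :+ x) :- g) refl (g n) (x ^ n)) (x^n≼ n))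
      y≼ : ∀ y → (∀ n → g n - y ≼ C ℚ.* L ℚ.* σ^ n) → y ≼ C ℚ.* L
      y≼ y h = ≼-cong (ℚ.*-identityʳ _)
        (≼-resp (solve 1 (λ y → :- (con (+ 0) :- y) := y) refl y) (≼-neg (h 0)))
      telescope : ∀ n → (1# - x) * g n ≈ 1# - x ^ n
      telescope zero    = trans (zeroʳ _) (sym (-‿inverseʳ 1#))
      telescope (suc n) = begin
        (1# - x) * (g n + x ^ n)               ≈⟨ distribˡ _ _ _ ⟩
        (1# - x) * g n + (1# - x) * x ^ n      ≈⟨ +-congʳ (telescope n) ⟩
        (1# - x ^ n) + (1# - x) * x ^ n
          ≈⟨ solve 2 (λ x z → (con (+ 1) :- z) :+ (con (+ 1) :- x) :* z := con (+ 1) :- x :* z) refl x (x ^ n) ⟩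
        1# - x * x ^ n                         ∎
      inverse : ∀ y → (∀ n → g n - y ≼ C ℚ.* L ℚ.* σ^ n) → (1# - x) * y ≈ 1#
      inverse y h = ⇝-unique
        (⇝-* (⇝-const (1# - x)) (C ℚ.* L , h))
        (null-resp
          (λ n → sym (trans (+-congʳ (telescope n))
            (solve 1 (λ z → (con (+ 1) :- z) :- con (+ 1) := :- z) refl (x ^ n))))
          (null-neg (C , x^n≼)))

  -- For i + j = n the weight is σ^n σ^i, a geometric series in i. In the induction, removing i = 0
  -- multiplies the constant D by σ².
  conv-≼ : ∀ {f D} n → (∀ i j → f i j ≼ D ℚ.* (σ^ i ℚ.* σ^ i) ℚ.* σ^ j) → conv f n ≼ D ℚ.* L ℚ.* σ^ n
  conv-≼ {f} {D} zero f≼ = ≼-mono D≤DL (≼-resp (sym (conv-zero f)) (f≼ 0 0))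
    where
    0≤D : 0ℚ ℚ.≤ D
    0≤D = ≡.subst (0ℚ ℚ.≤_)
      (Q.solve 1 (λ D → D Q.:* (Q.con 1ℚ Q.:* Q.con 1ℚ) Q.:* Q.con 1ℚ Q.:= D) ≡.refl D) (≼⇒0≤ (f≼ 0 0))
    D≤DL : D ℚ.* (1ℚ ℚ.* 1ℚ) ℚ.* 1ℚ ℚ.≤ D ℚ.* L ℚ.* 1ℚ
    D≤DL = ℚ.≤-trans
      (ℚ.≤-reflexive (Q.solve 1 (λ D → D Q.:* (Q.con 1ℚ Q.:* Q.con 1ℚ) Q.:* Q.con 1ℚ Q.:= D) ≡.refl D))
      (ℚ.≤-trans (p≤p+q D (0≤* (0≤* 0≤D 0≤σ) 0≤L))
        (ℚ.≤-reflexive (≡.trans (geometric-step D) (≡.sym (ℚ.*-identityʳ _)))))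
  conv-≼ {f} {D} (suc n) f≼ = ≼-mono step
    (≼-resp (sym (conv-suc f n)) (≼-+ (f≼ 0 (suc n)) (conv-≼ {D = D ℚ.* (σ ℚ.* σ)} n (λ i j → ≼-cong
      (Q.solve 4 (λ D s x y → D Q.:* ((s Q.:* x) Q.:* (s Q.:* x)) Q.:* y Q.:=
        D Q.:* (s Q.:* s) Q.:* (x Q.:* x) Q.:* y) ≡.refl D σ (σ^ i) (σ^ j)) (f≼ (suc i) j)))))
    where
    step : D ℚ.* (1ℚ ℚ.* 1ℚ) ℚ.* σ^ (suc n) ℚ.+ D ℚ.* (σ ℚ.* σ) ℚ.* L ℚ.* σ^ n ℚ.≤ D ℚ.* L ℚ.* σ^ (suc n)
    step = ℚ.≤-reflexive (≡.trans
      (Q.solve 4 (λ D s L x → D Q.:* (Q.con 1ℚ Q.:* Q.con 1ℚ) Q.:* (s Q.:* x) Q.:+ D Q.:* (s Q.:* s) Q.:* L Q.:* x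
        Q.:= (D Q.:+ D Q.:* s Q.:* L) Q.:* (s Q.:* x)) ≡.refl D σ L (σ^ n))
      (≡.cong (ℚ._* (σ ℚ.* σ^ n)) (geometric-step D)))

  -- Tannery's theorem with a rate: replacing every b_(r,l) by its limit leaves a convolution of
  -- errors of the kind that `conv-≼` sums.
  dominated-convergence : ∀ {a : ℕ → Carrier} {b : ℕ → ℕ → Carrier} {b∞ A B} →
    (∀ r → a r ≼ A ℚ.* (σ^ r ℚ.* σ^ r)) → (∀ r l → b r l - b∞ ≼ B ℚ.* σ^ l) →
    Null (λ n → conv (λ r l → a r * b r l) n - conv (λ r _ → a r) n * b∞)
  dominated-convergence {a} {b} {b∞} {A} {B} a≼ b≼ = A ℚ.* B ℚ.* L , λ n → ≼-resp (split n)
    (conv-≼ {D = A ℚ.* B} n (λ r l → ≼-cong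
      (Q.solve 4 (λ A B x y → A Q.:* x Q.:* (B Q.:* y) Q.:= A Q.:* B Q.:* x Q.:* y) ≡.refl
        A B (σ^ r ℚ.* σ^ r) (σ^ l))
      (≼-* (a≼ r) (b≼ r l))))
    where
    split : ∀ n → conv (λ r l → a r * (b r l - b∞)) n ≈
      conv (λ r l → a r * b r l) n - conv (λ r _ → a r) n * b∞
    split n = begin
      conv (λ r l → a r * (b r l - b∞)) n
        ≈⟨ conv-cong n (λ r l _ → solve 3 (λ a b c → a :* (b :- c) := a :* b :+ :- c :* a) refl _ _ _) ⟩
      conv (λ r l → a r * b r l + - b∞ * a r) n
        ≈⟨ conv-+ _ _ n ⟩
      conv (λ r l → a r * b r l) n + conv (λ r l → - b∞ * a r) n
        ≈⟨ +-congˡ (conv-*ˡ _ _ n) ⟩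
      conv (λ r l → a r * b r l) n + - b∞ * conv (λ r _ → a r) n
        ≈⟨ solve 3 (λ x y c → x :+ :- c :* y := x :- y :* c) refl _ _ _ ⟩
      conv (λ r l → a r * b r l) n - conv (λ r _ → a r) n * b∞
        ∎

-- q-series

module QSeries
  (R : CompleteNormedRing) (σ : ℚ) (0≤σ : 0ℚ ℚ.≤ σ) (σ<1 : σ ℚ.< 1ℚ) where

  open import Data.Integer.Base using (+_)
  open GeometricLimits R σ 0≤σ σ<1

  open CompleteNormedRing R
  open CommutativeRing commutativeRing
  open IntegerCoefficients commutativeRing
  open FiniteIdentities commutativeRing
  open import Algebra.Properties.Semiring.Exp semiring using (_^_; ^-assocʳ)
  open import Relation.Binary.Reasoning.Setoid setoid

  private
    module Q = +-*-Solver

    0≤2 : 0ℚ ℚ.≤ fromℕ 2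
    0≤2 = ℚ.nonNegative⁻¹ (fromℕ 2)

    *-monoˡ : ∀ {C r s} → 0ℚ ℚ.≤ C → r ℚ.≤ s → C ℚ.* r ℚ.≤ C ℚ.* s
    *-monoˡ {C} 0≤C = ℚ.*-monoˡ-≤-nonNeg C {{ℚ.nonNegative 0≤C}}

    σ^²≤σ^ : ∀ n → σ^ n ℚ.* σ^ n ℚ.≤ σ^ n
    σ^²≤σ^ n = ℚ.≤-trans (*-monoˡ (0≤σ^ n) (^-≤1 0≤σ (ℚ.<⇒≤ σ<1) n))
      (ℚ.≤-reflexive (ℚ.*-identityʳ (σ^ n)))

  -- On ℂ with its ℓ¹ norm the factor 2 absorbs the comparison with |p|, and
  -- the square leaves a spare σ^n for summing convolutions.
  Decay : Carrier → Set
  Decay p = ∀ n → p ^ n ≼ fromℕ 2 ℚ.* (σ^ n ℚ.* σ^ n)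

  decay-≤ : ∀ {p} → Decay p → ∀ n k → n ℕ.≤ k → p ^ k ≼ fromℕ 2 ℚ.* (σ^ n ℚ.* σ^ n)
  decay-≤ decay n k n≤k = ≼-mono
    (*-monoˡ 0≤2 (*-mono₂-≤ (0≤σ^ k) (0≤σ^ n) (σ^-antimono n k n≤k) (σ^-antimono n k n≤k)))
    (decay k)

  decay-^ : ∀ {p} → Decay p → ∀ k → Decay (p ^ suc k)
  decay-^ {p} decay k n = ≼-resp (sym (^-assocʳ p (suc k) n))
    (decay-≤ decay n (suc k ℕ.* n) (ℕ.m≤m+n n (k ℕ.* n)))

  decay-σ^ : ∀ {p} → Decay p → ∀ n k → n ℕ.≤ k → p ^ k ≼ fromℕ 2 ℚ.* σ^ n
  decay-σ^ decay n k n≤k = ≼-mono (*-monoˡ 0≤2 (σ^²≤σ^ n)) (decay-≤ decay n k n≤k)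

  poch-converges : ∀ x {p} → Decay p → ∃[ l ] poch x p ⇝ l
  poch-converges x {p} decay =
    let X , x≼X = ≼-bound x
    in ∏-converges {w = λ j → - (x * p ^ j)} {X ℚ.* fromℕ 2} (λ j → ≼-cong
      (≡.sym (ℚ.*-assoc X (fromℕ 2) (σ^ j)))
      (≼-neg (≼-* x≼X (decay-σ^ decay j j ℕ.≤-refl))))

  Φ₆∏-converges : ∀ {p} → Decay p → ∃[ l ] Φ₆∏ p ⇝ l
  Φ₆∏-converges {p} decay =
    let l , h = ∏-converges {w = w} {fromℕ 2 ℚ.+ fromℕ 2 ℚ.* fromℕ 2} w≼
    in l , ⇝-cong (∏-cong (λ j → sym (+-assoc _ _ _))) h
    where
    w : ℕ → Carrier
    w j = - p ^ suc j + p ^ suc j * p ^ suc j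
    w≼ : ∀ j → w j ≼ (fromℕ 2 ℚ.+ fromℕ 2 ℚ.* fromℕ 2) ℚ.* σ^ j
    w≼ j = ≼-mono
      (ℚ.≤-trans
        (ℚ.+-monoʳ-≤ (fromℕ 2 ℚ.* σ^ j) (ℚ.≤-trans
          (ℚ.≤-reflexive (Q.solve 2 (λ t x → t Q.:* x Q.:* (t Q.:* x) Q.:= t Q.:* t Q.:* (x Q.:* x))
            ≡.refl (fromℕ 2) (σ^ j)))
          (*-monoˡ (0≤* 0≤2 0≤2) (σ^²≤σ^ j))))
        (ℚ.≤-reflexive (≡.sym (ℚ.*-distribʳ-+ (σ^ j) (fromℕ 2) (fromℕ 2 ℚ.* fromℕ 2)))))
      (≼-+ (≼-neg p^≼) (≼-* p^≼ p^≼))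
      where
      p^≼ : p ^ suc j ≼ fromℕ 2 ℚ.* σ^ j
      p^≼ = decay-σ^ decay j (suc j) (ℕ.n≤1+n j)

  module Reciprocals {p : Carrier} (decay : Decay p) where

    private
      inverse : ∀ j → ∃[ y ] ((1# - p ^ suc j) * y ≈ 1# × y ≼ fromℕ 2 ℚ.* L)
      inverse j = geometric-inverse {C = fromℕ 2} (λ n →
        decay-σ^ (decay-^ decay j) n n ℕ.≤-refl)

      v : ℕ → Carrier
      v j = proj₁ (inverse j)

    unit : ∀ j → Unit (1# - p ^ suc j)
    unit j = v j , proj₁ (proj₂ (inverse j))

    I : ℕ → Carrier
    I = ∏ v

    I-step : ∀ n → (1# - p ^ suc n) * I (suc n) ≈ I n
    I-step n = begin
      (1# - p ^ suc n) * (I n * v n)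
        ≈⟨ solve 3 (λ x a v → x :* (a :* v) := a :* (x :* v)) refl _ _ _ ⟩
      I n * ((1# - p ^ suc n) * v n)
        ≈⟨ *-congˡ (proj₂ (unit n)) ⟩
      I n * 1#
        ≈⟨ *-identityʳ _ ⟩
      I n
        ∎

    poch-I : ∀ n → poch p p n * I n ≈ 1#
    poch-I n = trans (sym (∏-* _ _ n)) (∏-1 (λ j → proj₂ (unit j)) n)

    open FiniteIdentities.Base commutativeRing p I refl I-step unit public

    private
      abstract
        D-limit : ∃[ D ] poch p p ⇝ D
        D-limit = poch-converges p decay

        -- As 1/(1 - x) = 1 + x/(1 - x), the reciprocals themselves form a convergent product. Its
        -- limit becomes the inverse of D in `D*E≈1`.
        E-limit : ∃[ E ] I ⇝ E
        E-limit =
          let l , h = ∏-converges {w = λ j → p ^ suc j * v j} {fromℕ 2 ℚ.* (fromℕ 2 ℚ.* L)} (λ j → ≼-cong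
                (Q.solve 3 (λ t x y → t Q.:* x Q.:* y Q.:= t Q.:* y Q.:* x) ≡.refl (fromℕ 2) (σ^ j) (fromℕ 2 ℚ.* L))
                (≼-* (decay-σ^ decay j (suc j) (ℕ.n≤1+n j)) (proj₂ (proj₂ (inverse j)))))
          in l , ⇝-cong (∏-cong (λ j → begin
               1# + p ^ suc j * v j                    ≈⟨ +-congʳ (proj₂ (unit j)) ⟨
               (1# - p ^ suc j) * v j + p ^ suc j * v j
                 ≈⟨ solve 2 (λ x v → (con (+ 1) :- x) :* v :+ x :* v := v) refl (p ^ suc j) (v j) ⟩
               v j                                     ∎)) h

        Φ-limit : ∃[ Φ ] Φ₆∏ p ⇝ Φ
        Φ-limit = Φ₆∏-converges decay

    D E Φ : Carrier
    D = proj₁ D-limit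
    E = proj₁ E-limit
    Φ = proj₁ Φ-limit

    poch⇝D : poch p p ⇝ D
    poch⇝D = proj₂ D-limit

    I⇝E : I ⇝ E
    I⇝E = proj₂ E-limit

    Φ₆∏⇝Φ : Φ₆∏ p ⇝ Φ
    Φ₆∏⇝Φ = proj₂ Φ-limit

    D*E≈1 : D * E ≈ 1#
    D*E≈1 = ⇝-unique (⇝-* poch⇝D I⇝E) (⇝-cong (λ n → sym (poch-I n)) (⇝-const 1#))

    private
      kernel-converges : ∃[ B ] (∀ r l → I l * I (suc (r ℕ.+ (r ℕ.+ l))) - E * E ≼ B ℚ.* σ^ l)
      kernel-converges =
        let C , h = I⇝E
            K , I≼K = ⇝-bounded I⇝E
            e , E≼e = ≼-bound E
            0≤C = ≡.subst (0ℚ ℚ.≤_) (ℚ.*-identityʳ C) (≼⇒0≤ (h 0))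
        in C ℚ.* K ℚ.+ e ℚ.* C , λ r l →
          let m = suc (r ℕ.+ (r ℕ.+ l))
              l≤m : l ℕ.≤ m
              l≤m = ℕ.m≤n⇒m≤1+n (ℕ.≤-trans (ℕ.m≤n+m l r) (ℕ.m≤n+m (r ℕ.+ l) r))
          in ≼-resp
            (solve 3 (λ a b e → (a :- e) :* b :+ e :* (b :- e) := a :* b :- e :* e) refl (I l) (I m) E)
            (≼-cong
              (Q.solve 4 (λ C K e x → C Q.:* x Q.:* K Q.:+ e Q.:* (C Q.:* x) Q.:=
                (C Q.:* K Q.:+ e Q.:* C) Q.:* x) ≡.refl C K e (σ^ l))
              (≼-+ (≼-* (h l) (I≼K m))
                (≼-* E≼e (≼-mono (*-monoˡ 0≤C (σ^-antimono l m l≤m)) (h m)))))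

      coeff-≼ : ∀ r → coeff r ≼ fromℕ 2
      coeff-≼ 0 = ≼-mono (p≤p+q 1ℚ {1ℚ} (ℚ.nonNegative⁻¹ 1ℚ)) ≼-1
      coeff-≼ 1 = ≼-neg (≼-+ ≼-1 ≼-1)
      coeff-≼ 2 = ≼-mono (p≤p+q 1ℚ {1ℚ} (ℚ.nonNegative⁻¹ 1ℚ)) ≼-1
      coeff-≼ (suc (suc (suc r))) = coeff-≼ r

      n≤tri : ∀ n → n ℕ.≤ tri n
      n≤tri zero    = ℕ.z≤n
      n≤tri (suc n) = ℕ.m≤m+n (suc n) (tri n)

    -- I_l I_{2r+l+1} → E² at the rate σ^l, uniformly in r.
    theta-kernel : ∀ {x} → Decay x → Null (λ n →
      conv (λ r l → coeff r * x ^ tri r * (I l * I (suc (r ℕ.+ (r ℕ.+ l))))) n -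
      conv (λ r _ → coeff r * x ^ tri r) n * (E * E))
    theta-kernel {x} x-decay = dominated-convergence {A = fromℕ 2 ℚ.* fromℕ 2} {B = proj₁ kernel-converges}
      (λ r → ≼-cong (≡.sym (ℚ.*-assoc (fromℕ 2) (fromℕ 2) (σ^ r ℚ.* σ^ r)))
        (≼-* (coeff-≼ r) (decay-≤ x-decay r (tri r) (n≤tri r))))
      (proj₂ kernel-converges)

    cancel-EE : ∀ {s l} → (λ n → s n * (E * E)) ⇝ l → s ⇝ l * (D * D)
    cancel-EE {s} h = ⇝-cong
      (λ n → begin
        s n * (E * E) * (D * D)
          ≈⟨ solve 3 (λ s e d → s :* (e :* e) :* (d :* d) := s :* ((d :* e) :* (d :* e))) refl (s n) E D ⟩
        s n * ((D * E) * (D * E))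
          ≈⟨ *-congˡ (*-cong D*E≈1 D*E≈1) ⟩
        s n * (1# * 1#)
          ≈⟨ solve 1 (λ s → s :* (con (+ 1) :* con (+ 1)) := s) refl (s n) ⟩
        s n
          ∎)
      (⇝-* h (⇝-const (D * D)))

    -- The limit of β_n is Φ E by `β-product`, while `theta-kernel` compares β_n with the partial
    -- theta series times E²; multiplying by D² isolates the series. Its convergence is obtained
    -- along with its value.
    theta⇝ : conv (λ r _ → coeff r * p ^ tri r) ⇝ D * Φ
    theta⇝ = ⇝-congʳ
      (begin
        Φ * E * (D * D)      ≈⟨ solve 3 (λ f e d → f :* e :* (d :* d) := d :* f :* (d :* e)) refl Φ E D ⟩
        D * Φ * (D * E)      ≈⟨ *-congˡ D*E≈1 ⟩
        D * Φ * 1#           ≈⟨ *-identityʳ _ ⟩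
        D * Φ                ∎)
      (cancel-EE (⇝-null (theta-kernel decay) (⇝-cong
        (λ n → trans (sym (β-product n)) (conv-cong n (λ r l _ → sym (*-assoc _ _ _))))
        (⇝-* Φ₆∏⇝Φ (⇝-sub (λ n → suc (n ℕ.+ n)) (λ n → ℕ.m≤n⇒m≤1+n (ℕ.m≤m+n n n)) I⇝E)))))

    summand : ℕ → Carrier
    summand m = p ^ (m ℕ.* (m ℕ.+ 1)) * (Φ₆∏ p m * I (suc (m ℕ.+ m)))

    -- Pass to the limit in `bailey`: the left side tends to the series times E, the right side to u
    -- E², and one factor E cancels against D. The kernel keeps base p while the theta series has
    -- base p³, so `theta-kernel` is applied at p³.
    series⇝ : ∀ {u} → conv (λ r _ → coeff r * (p ^ 3) ^ tri r) ⇝ u → ∑ summand ⇝ E * u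
    series⇝ {u} θ⇝u = ⇝-congʳ
      (begin
        u * (E * E) * D      ≈⟨ solve 3 (λ u e d → u :* (e :* e) :* d := e :* u :* (d :* e)) refl u E D ⟩
        E * u * (D * E)      ≈⟨ *-congˡ D*E≈1 ⟩
        E * u * 1#           ≈⟨ *-identityʳ _ ⟩
        E * u                ∎)
      (⇝-null summand-null
        (⇝-cong (λ n → conv-∑ summand n) (⇝-cong cancel (⇝-* convolved (⇝-const D)))))
      where
      bounded : Bounded (λ m → Φ₆∏ p m * I (suc (m ℕ.+ m)))
      bounded = ⇝-bounded
        (⇝-* Φ₆∏⇝Φ (⇝-sub (λ n → suc (n ℕ.+ n)) (λ n → ℕ.m≤n⇒m≤1+n (ℕ.m≤m+n n n)) I⇝E))
      m≤m[m+1] : ∀ m → m ℕ.≤ m ℕ.* (m ℕ.+ 1)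
      m≤m[m+1] m = ≡.subst (ℕ._≤ m ℕ.* (m ℕ.+ 1)) (ℕ.*-identityʳ m) (ℕ.*-monoʳ-≤ m (ℕ.m≤n+m 1 m))
      B : ℚ
      B = proj₁ bounded
      summand-≼ : ∀ m → summand m ≼ fromℕ 2 ℚ.* B ℚ.* (σ^ m ℚ.* σ^ m)
      summand-≼ m = ≼-cong
        (Q.solve 3 (λ t x b → t Q.:* x Q.:* b Q.:= t Q.:* b Q.:* x) ≡.refl (fromℕ 2) (σ^ m ℚ.* σ^ m) B)
        (≼-* (decay-≤ decay m (m ℕ.* (m ℕ.+ 1)) (m≤m[m+1] m)) (proj₂ bounded m))
      -- A convolution at n has n + 1 summands, `∑` at n only n; the difference tends to zero.
      summand-null : Null (λ n → ∑ summand (suc n) - ∑ summand n)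
      summand-null = fromℕ 2 ℚ.* B , λ n → ≼-resp
        (solve 2 (λ s a → a := (s :+ a) :- s) refl (∑ summand n) (summand n))
        (≼-mono (*-monoˡ (0≤* 0≤2 (≼⇒0≤ (proj₂ bounded 0))) (σ^²≤σ^ n)) (summand-≼ n))
      convolved : (λ n → conv (λ m _ → summand m) n * E) ⇝ u * (E * E)
      convolved = ⇝-null
        (dominated-convergence {b = λ _ l → I l} {A = fromℕ 2 ℚ.* B} {B = proj₁ I⇝E} summand-≼ (λ _ l → proj₂ I⇝E l))
        (⇝-cong (λ n → sym (bailey n))
          (⇝-null (null-resp (λ n → solve 2 (λ x y → :- (x :- y) := y :- x) refl _ _)
                    (null-neg (theta-kernel (decay-^ decay 2))))
            (⇝-* θ⇝u (⇝-const (E * E)))))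
      cancel : ∀ n → conv (λ m _ → summand m) n * E * D ≈ conv (λ m _ → summand m) n
      cancel n = trans
        (solve 3 (λ s e d → s :* e :* d := s :* (d :* e)) refl _ _ _)
        (trans (*-congˡ D*E≈1) (*-identityʳ _))

  1-x-*1+x : ∀ x → (1# - x) * (1# + x) ≈ 1# - x ^ 2
  1-x-*1+x = solve 1 (λ x →
    (con (+ 1) :- x) :* (con (+ 1) :+ x) := con (+ 1) :- x :* (x :* con (+ 1))) refl

  poch-unit : ∀ {q} → Decay q → ∀ n → Unit (poch q q n)
  poch-unit decay = unit-∏ (Reciprocals.unit decay)

  -- The inverse of 1 + x is (1 - x) / (1 - x²), which reduces the claim to base q².
  poch-neg-unit : ∀ {q} → Decay q → ∀ n → Unit (poch (- q) q n)
  poch-neg-unit {q} decay = unit-∏ λ j →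
    let y , eq = Reciprocals.unit (decay-^ decay 1) j
        x = q ^ suc j
    in (1# - x) * y , (begin
      (1# - - q * q ^ j) * ((1# - x) * y)
        ≈⟨ solve 3 (λ q z y → (con (+ 1) :- :- q :* z) :* ((con (+ 1) :- q :* z) :* y) :=
             (con (+ 1) :- q :* z) :* (con (+ 1) :+ q :* z) :* y) refl q (q ^ j) y ⟩
      (1# - x) * (1# + x) * y
        ≈⟨ *-congʳ (1-x-*1+x x) ⟩
      (1# - x ^ 2) * y
        ≈⟨ *-congʳ (+-congˡ (-‿cong (^-comm q 2 (suc j)))) ⟨
      (1# - (q ^ 2) ^ suc j) * y
        ≈⟨ eq ⟩
      1#
        ∎)

  -- Factorwise, (1 - x + x²)(1 + x) = 1 + x³.
  Φ₆∏-poch-neg : ∀ q n → Φ₆∏ q n * poch (- q) q n ≈ poch (- (q ^ 3)) (q ^ 3) n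
  Φ₆∏-poch-neg q n = trans (sym (∏-* _ _ n)) (∏-cong (λ j → let x = q ^ suc j in begin
    (1# - x + x * x) * (1# - - q * q ^ j)
      ≈⟨ solve 2 (λ q z → (con (+ 1) :- q :* z :+ q :* z :* (q :* z)) :* (con (+ 1) :- :- q :* z) :=
           con (+ 1) :+ (q :* z) :* ((q :* z) :* ((q :* z) :* con (+ 1)))) refl q (q ^ j) ⟩
    1# + x ^ 3
      ≈⟨ +-congˡ (^-comm q 3 (suc j)) ⟨
    1# + q ^ 3 * (q ^ 3) ^ j
      ≈⟨ solve 2 (λ q z → con (+ 1) :+ q :* z := con (+ 1) :- :- q :* z) refl (q ^ 3) ((q ^ 3) ^ j) ⟩
    1# - - (q ^ 3) * (q ^ 3) ^ j
      ∎) n)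

  -- `Φ₆∏-poch` and `poch-residues` evaluate (q;q)_∞ (q⁶;q⁶)_∞ in two ways, the latter along indices
  -- 6n, 3n and 2n. Both contain the invertible (q²;q²)_∞ (q³;q³)_∞, which is cancelled.
  Φ-product : ∀ {q B C} (decay : Decay q) → poch q (q ^ 6) ⇝ B → poch (q ^ 5) (q ^ 6) ⇝ C →
    Reciprocals.Φ decay ≈ B * C
  Φ-product {q} {B} {C} decay ⇝B ⇝C = unit-cancel
    (unit-* (R₂.E , R₂.D*E≈1) (R₃.E , R₃.D*E≈1)) (begin
      R₂.D * R₃.D * R₁.Φ          ≈⟨ *-comm _ _ ⟩
      R₁.Φ * (R₂.D * R₃.D)        ≈⟨ ⇝-unique (⇝-* R₁.Φ₆∏⇝Φ (⇝-* R₂.poch⇝D R₃.poch⇝D))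
                                       (⇝-cong (λ n → sym (Φ₆∏-poch q n)) (⇝-* R₆.poch⇝D R₁.poch⇝D)) ⟩
      R₆.D * R₁.D                 ≈⟨ *-comm _ _ ⟩
      R₁.D * R₆.D                 ≈⟨ ⇝-unique
                                       (⇝-* (⇝-sub (ℕ._* 6) (λ n → ℕ.m≤m*n n 6) R₁.poch⇝D) R₆.poch⇝D)
                                       (⇝-cong (λ n → sym (poch-residues q n)) (⇝-* (⇝-* ⇝B ⇝C) (⇝-*
                                         (⇝-sub (ℕ._* 3) (λ n → ℕ.m≤m*n n 3) R₂.poch⇝D)
                                         (⇝-sub (ℕ._* 2) (λ n → ℕ.m≤m*n n 2) R₃.poch⇝D)))) ⟩
      B * C * (R₂.D * R₃.D)       ≈⟨ *-comm _ _ ⟩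
      R₂.D * R₃.D * (B * C)       ∎)
    where
    module R₁ = Reciprocals decay
    module R₂ = Reciprocals (decay-^ decay 1)
    module R₃ = Reciprocals (decay-^ decay 2)
    module R₆ = Reciprocals (decay-^ decay 5)

  -- The summand `t` is specified by its cross-multiplied equation, so that the result does not
  -- depend on how quotients are formed.
  series-evaluation : ∀ {q t A B C} (decay : Decay q) →
    (∀ n → poch (- q) q n * poch q q (2 ℕ.* n ℕ.+ 1) * t n ≈ q ^ (n ℕ.* (n ℕ.+ 1)) * poch (- (q ^ 3)) (q ^ 3) n) →
    poch (q ^ 3) (q ^ 3) ⇝ A → poch (q ^ 3) ((q ^ 3) ^ 6) ⇝ B → poch ((q ^ 3) ^ 5) ((q ^ 3) ^ 6) ⇝ C →
    ∑ t ⇝ A * B * C * Reciprocals.E decay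
  series-evaluation {q} {t} {A} {B} {C} decay t-eq ⇝A ⇝B ⇝C = ⇝-congʳ
    (begin
      R.E * (R₃.D * R₃.Φ)      ≈⟨ *-congˡ (*-cong (⇝-unique R₃.poch⇝D ⇝A) (Φ-product (decay-^ decay 2) ⇝B ⇝C)) ⟩
      R.E * (A * (B * C))
        ≈⟨ solve 4 (λ e a b c → e :* (a :* (b :* c)) := a :* b :* c :* e) refl R.E A B C ⟩
      A * B * C * R.E          ∎)
    (⇝-cong (∑-cong summand≈t) (R.series⇝ R₃.theta⇝))
    where
    module R = Reciprocals decay
    module R₃ = Reciprocals (decay-^ decay 2)
    summand≈t : ∀ n → R.summand n ≈ t n
    summand≈t n = unit-cancel
      (unit-* (poch-neg-unit decay n) (poch-unit decay (2 ℕ.* n ℕ.+ 1))) (begin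
        poch (- q) q n * poch q q (2 ℕ.* n ℕ.+ 1) * (x * (Φ₆∏ q n * R.I (suc (n ℕ.+ n))))
          ≈⟨ *-congʳ (*-congˡ (reflexive (≡.cong (poch q q) (odd-index n)))) ⟩
        poch (- q) q n * poch q q (suc (n ℕ.+ n)) * (x * (Φ₆∏ q n * R.I (suc (n ℕ.+ n))))
          ≈⟨ solve 5 (λ a b x f i → a :* b :* (x :* (f :* i)) := x :* (f :* a) :* (b :* i)) refl
               (poch (- q) q n) (poch q q (suc (n ℕ.+ n))) x (Φ₆∏ q n) (R.I (suc (n ℕ.+ n))) ⟩
        x * (Φ₆∏ q n * poch (- q) q n) * (poch q q (suc (n ℕ.+ n)) * R.I (suc (n ℕ.+ n)))
          ≈⟨ *-cong (*-congˡ (Φ₆∏-poch-neg q n)) (R.poch-I (suc (n ℕ.+ n))) ⟩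
        x * poch (- (q ^ 3)) (q ^ 3) n * 1#
          ≈⟨ *-identityʳ _ ⟩
        x * poch (- (q ^ 3)) (q ^ 3) n
          ≈⟨ t-eq n ⟨
        poch (- q) q n * poch q q (2 ℕ.* n ℕ.+ 1) * t n
          ∎)
      where
      x : Carrier
      x = q ^ (n ℕ.* (n ℕ.+ 1))

  -- x₃, x₁₅, x₁₈ stand for q³, q¹⁵, q¹⁸; being variables, they do not unfold
  -- into real and imaginary parts.
  record Evaluation (q x₃ x₁₅ x₁₈ : Carrier) : Set where
    field
      den-unit : ∀ n → Unit (poch (- q) q n * poch q q (2 ℕ.* n ℕ.+ 1))
      {A B C D E} : Carrier
      A-limit  : poch x₃ x₃ ⇝ A
      B-limit  : poch x₃ x₁₈ ⇝ B
      C-limit  : poch x₁₅ x₁₈ ⇝ C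
      D-limit  : poch q q ⇝ D
      D*E≈1    : D * E ≈ 1#
      series-limit : ∀ {t} →
        (∀ n → poch (- q) q n * poch q q (2 ℕ.* n ℕ.+ 1) * t n ≈ q ^ (n ℕ.* (n ℕ.+ 1)) * poch (- x₃) x₃ n) →
        ∑ t ⇝ A * B * C * E

  evaluation : ∀ {q x₃ x₁₅ x₁₈} → Decay q → x₃ ≈ q ^ 3 → x₁₅ ≈ q ^ 15 → x₁₈ ≈ q ^ 18 →
    Evaluation q x₃ x₁₅ x₁₈
  evaluation {q} {x₃} {x₁₅} {x₁₈} decay x₃≈ x₁₅≈ x₁₈≈ = record
    { den-unit = λ n → unit-* (poch-neg-unit decay n) (poch-unit decay (2 ℕ.* n ℕ.+ 1))
    ; A-limit  = ⇝-cong (poch-cong (sym x₃≈) (sym x₃≈)) R₃.poch⇝D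
    ; B-limit  = ⇝-cong (poch-cong (sym x₃≈) Q⁶≈x₁₈) (proj₂ B)
    ; C-limit  = ⇝-cong (poch-cong Q⁵≈x₁₅ Q⁶≈x₁₈) (proj₂ C)
    ; D-limit  = R.poch⇝D
    ; D*E≈1    = R.D*E≈1
    ; series-limit = λ t-eq → series-evaluation decay
        (λ n → trans (t-eq n) (*-congˡ (poch-cong (-‿cong x₃≈) x₃≈ n)))
        R₃.poch⇝D (proj₂ B) (proj₂ C)
    }
    where
    module R  = Reciprocals decay
    module R₃ = Reciprocals (decay-^ decay 2)
    Q⁶≈x₁₈ : (q ^ 3) ^ 6 ≈ x₁₈
    Q⁶≈x₁₈ = trans (^-assocʳ q 3 6) (sym x₁₈≈)
    Q⁵≈x₁₅ : (q ^ 3) ^ 5 ≈ x₁₅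
    Q⁵≈x₁₅ = trans (^-assocʳ q 3 5) (sym x₁₅≈)
    decay₁₈ : Decay ((q ^ 3) ^ 6)
    decay₁₈ = decay-^ (decay-^ decay 2) 5
    B : ∃[ l ] poch (q ^ 3) ((q ^ 3) ^ 6) ⇝ l
    B = poch-converges (q ^ 3) decay₁₈
    C : ∃[ l ] poch ((q ^ 3) ^ 5) ((q ^ 3) ^ 6) ⇝ l
    C = poch-converges ((q ^ 3) ^ 5) decay₁₈

-- Complex numbers

open import Defs

open ≡ using (refl)
open +-*-Solver

-- The ℓ¹ norm stays rational on rational entries, unlike the modulus, and is still
-- submultiplicative.
∥_∶_∥ : ℚ → ℚ → ℚ
∥ a ∶ b ∥ = ∣ a ∣ ℚ.+ ∣ b ∣

private
  half : ∀ ε → ε ℚ.* ½ ℚ.+ ε ℚ.* ½ ≡ ε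
  half ε = ≡.trans (≡.sym (ℚ.*-distribˡ-+ ε ½ ½)) (ℚ.*-identityʳ ε)

  0<half : ∀ {ε} → 0ℚ ℚ.< ε → 0ℚ ℚ.< ε ℚ.* ½
  0<half 0<ε = 0<* 0<ε (ℚ.positive⁻¹ ½)

  0≤∥∥ : ∀ a b → 0ℚ ℚ.≤ ∥ a ∶ b ∥
  0≤∥∥ a b = 0≤+ (ℚ.0≤∣p∣ a) (ℚ.0≤∣p∣ b)

  ∥∥-triangle : ∀ a b c d → ∥ a ℚ.+ c ∶ b ℚ.+ d ∥ ℚ.≤ ∥ a ∶ b ∥ ℚ.+ ∥ c ∶ d ∥
  ∥∥-triangle a b c d = ℚ.≤-trans (ℚ.+-mono-≤ (ℚ.∣p+q∣≤∣p∣+∣q∣ a c) (ℚ.∣p+q∣≤∣p∣+∣q∣ b d))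
    (ℚ.≤-reflexive (solve 4 (λ a b c d → a :+ c :+ (b :+ d) := a :+ b :+ (c :+ d)) refl (∣ a ∣) (∣ b ∣) (∣ c ∣) (∣ d ∣)))

  ∥∥-* : ∀ a b c d →
    ∥ a ℚ.* c ℚ.- b ℚ.* d ∶ a ℚ.* d ℚ.+ b ℚ.* c ∥ ℚ.≤ ∥ a ∶ b ∥ ℚ.* ∥ c ∶ d ∥
  ∥∥-* a b c d = begin
    ∥ a ℚ.* c ℚ.- b ℚ.* d ∶ a ℚ.* d ℚ.+ b ℚ.* c ∥
      ≤⟨ ℚ.+-mono-≤ (ℚ.∣p-q∣≤∣p∣+∣q∣ (a ℚ.* c) (b ℚ.* d)) (ℚ.∣p+q∣≤∣p∣+∣q∣ (a ℚ.* d) (b ℚ.* c)) ⟩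
    (∣ a ℚ.* c ∣ ℚ.+ ∣ b ℚ.* d ∣) ℚ.+ (∣ a ℚ.* d ∣ ℚ.+ ∣ b ℚ.* c ∣)
      ≡⟨ ≡.cong₂ ℚ._+_
           (≡.cong₂ ℚ._+_ (ℚ.∣p*q∣≡∣p∣*∣q∣ a c) (ℚ.∣p*q∣≡∣p∣*∣q∣ b d))
           (≡.cong₂ ℚ._+_ (ℚ.∣p*q∣≡∣p∣*∣q∣ a d) (ℚ.∣p*q∣≡∣p∣*∣q∣ b c)) ⟩
    (∣ a ∣ ℚ.* ∣ c ∣ ℚ.+ ∣ b ∣ ℚ.* ∣ d ∣) ℚ.+ (∣ a ∣ ℚ.* ∣ d ∣ ℚ.+ ∣ b ∣ ℚ.* ∣ c ∣)
      ≡⟨ solve 4 (λ a b c d → (a :* c :+ b :* d) :+ (a :* d :+ b :* c) := (a :+ b) :* (c :+ d)) refl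
           (∣ a ∣) (∣ b ∣) (∣ c ∣) (∣ d ∣) ⟩
    ∥ a ∶ b ∥ ℚ.* ∥ c ∶ d ∥
      ∎
    where open ℚ.≤-Reasoning

  ∣∣-square : ∀ a → ∣ a ∣ ℚ.* ∣ a ∣ ≡ a ℚ.* a
  ∣∣-square a with ℚ.∣p∣≡p∨∣p∣≡-p a
  ... | inj₁ eq = ≡.cong₂ ℚ._*_ eq eq
  ... | inj₂ eq = ≡.trans (≡.cong₂ ℚ._*_ eq eq) (solve 1 (λ a → :- a :* :- a := a :* a) refl a)

  0≤square : ∀ a → 0ℚ ℚ.≤ a ℚ.* a
  0≤square a = ≡.subst (0ℚ ℚ.≤_) (∣∣-square a) (0≤* (ℚ.0≤∣p∣ a) (ℚ.0≤∣p∣ a))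

  square≤∥∥² : ∀ a b → a ℚ.* a ℚ.+ b ℚ.* b ℚ.≤ ∥ a ∶ b ∥ ℚ.* ∥ a ∶ b ∥
  square≤∥∥² a b = begin
    a ℚ.* a ℚ.+ b ℚ.* b
      ≡⟨ ≡.cong₂ ℚ._+_ (∣∣-square a) (∣∣-square b) ⟨
    ∣ a ∣ ℚ.* ∣ a ∣ ℚ.+ ∣ b ∣ ℚ.* ∣ b ∣
      ≤⟨ p≤p+q _ (0≤+ (0≤* (ℚ.0≤∣p∣ a) (ℚ.0≤∣p∣ b)) (0≤* (ℚ.0≤∣p∣ a) (ℚ.0≤∣p∣ b))) ⟩
    ∣ a ∣ ℚ.* ∣ a ∣ ℚ.+ ∣ b ∣ ℚ.* ∣ b ∣ ℚ.+ (∣ a ∣ ℚ.* ∣ b ∣ ℚ.+ ∣ a ∣ ℚ.* ∣ b ∣)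
      ≡⟨ solve 2 (λ a b → a :* a :+ b :* b :+ (a :* b :+ a :* b) := (a :+ b) :* (a :+ b)) refl (∣ a ∣) (∣ b ∣) ⟩
    ∥ a ∶ b ∥ ℚ.* ∥ a ∶ b ∥
      ∎
    where open ℚ.≤-Reasoning

  -- The missing part is the square of |a| - |b|.
  ∥∥²≤2square : ∀ a b → ∥ a ∶ b ∥ ℚ.* ∥ a ∶ b ∥ ℚ.≤ fromℕ 2 ℚ.* (a ℚ.* a ℚ.+ b ℚ.* b)
  ∥∥²≤2square a b = begin
    ∥ a ∶ b ∥ ℚ.* ∥ a ∶ b ∥
      ≤⟨ p≤p+q _ (0≤square (∣ a ∣ ℚ.- ∣ b ∣)) ⟩
    ∥ a ∶ b ∥ ℚ.* ∥ a ∶ b ∥ ℚ.+ (∣ a ∣ ℚ.- ∣ b ∣) ℚ.* (∣ a ∣ ℚ.- ∣ b ∣)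
      ≡⟨ solve 2 (λ a b → (a :+ b) :* (a :+ b) :+ (a :- b) :* (a :- b) :=
           con (fromℕ 2) :* (a :* a :+ b :* b)) refl (∣ a ∣) (∣ b ∣) ⟩
    fromℕ 2 ℚ.* (∣ a ∣ ℚ.* ∣ a ∣ ℚ.+ ∣ b ∣ ℚ.* ∣ b ∣)
      ≡⟨ ≡.cong₂ (λ x y → fromℕ 2 ℚ.* (x ℚ.+ y)) (∣∣-square a) (∣∣-square b) ⟩
    fromℕ 2 ℚ.* (a ℚ.* a ℚ.+ b ℚ.* b)
      ∎
    where open ℚ.≤-Reasoning

  square-cancel-≤ : ∀ {p r} → 0ℚ ℚ.≤ r → p ℚ.* p ℚ.≤ r ℚ.* r → p ℚ.≤ r
  square-cancel-≤ {p} {r} 0≤r pp≤rr with p ℚ.≤? r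
  ... | yes p≤r = p≤r
  ... | no  p≰r = contradiction (ℚ.<-≤-trans rr<pp pp≤rr) (ℚ.<-irrefl refl)
    where
    r<p : r ℚ.< p
    r<p = ℚ.≰⇒> p≰r
    rr<pp : r ℚ.* r ℚ.< p ℚ.* p
    rr<pp = ℚ.≤-<-trans (ℚ.*-monoˡ-≤-nonNeg r {{ℚ.nonNegative 0≤r}} (ℚ.<⇒≤ r<p))
      (ℚ.*-monoˡ-<-pos p {{ℚ.positive (ℚ.≤-<-trans 0≤r r<p)}} r<p)

-- Eventual ℓ¹ bounds and equality of complex numbers

dist : ℂ → ℕ → ℂ → ℕ → ℚ
dist z m w n = ∥ seq (re z) m ℚ.- seq (re w) n ∶ seq (im z) m ℚ.- seq (im w) n ∥

∥_∥ : ℂ → ℕ → ℚ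
∥ z ∥ n = ∥ seq (re z) n ∶ seq (im z) n ∥

infix 9 _ʳ_ _ⁱ_
_ʳ_ _ⁱ_ : ℂ → ℕ → ℚ
z ʳ n = seq (re z) n
z ⁱ n = seq (im z) n

0≤norm : ∀ z n → 0ℚ ℚ.≤ ∥ z ∥ n
0≤norm z n = 0≤∥∥ (seq (re z) n) (seq (im z) n)

infix 4 _≼_ _≗_

-- The slack ε makes the bound a property of the limit rather than of the chosen sequence. As a
-- record type it lets z and r be inferred.
record _≼_ (z : ℂ) (r : ℚ) : Set where
  constructor within
  field
    eventually : ∀ ε → 0ℚ ℚ.< ε → ∃[ N ] (∀ n → N ℕ.≤ n → ∥ z ∥ n ℚ.≤ r ℚ.+ ε)

open _≼_

-- Operations act termwise, so the ring laws hold entry by entry in ℚ and pass to `≈` through `≗⇒≈`.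
_≗_ : ℂ → ℂ → Set
z ≗ w = ∀ n → (seq (re z) n ≡ seq (re w) n) × (seq (im z) n ≡ seq (im w) n)

private
  dist-triangle : ∀ z m u k w n → dist z m w n ℚ.≤ dist z m u k ℚ.+ dist u k w n
  dist-triangle z m u k w n = ≡.subst₂ (λ x y → ∥ x ∶ y ∥ ℚ.≤ dist z m u k ℚ.+ dist u k w n)
    (telescope (seq (re z) m) (seq (re u) k) (seq (re w) n))
    (telescope (seq (im z) m) (seq (im u) k) (seq (im w) n))
    (∥∥-triangle (seq (re z) m ℚ.- seq (re u) k) (seq (im z) m ℚ.- seq (im u) k)
                 (seq (re u) k ℚ.- seq (re w) n) (seq (im u) k ℚ.- seq (im w) n))
    where
    telescope : ∀ a b c → (a ℚ.- b) ℚ.+ (b ℚ.- c) ≡ a ℚ.- c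
    telescope = solve 3 (λ a b c → (a :- b) :+ (b :- c) := a :- c) refl

  re-dist : ∀ z m w n → ∣ seq (re z) m ℚ.- seq (re w) n ∣ ℚ.≤ dist z m w n
  re-dist z m w n = p≤p+q _ (ℚ.0≤∣p∣ _)

  im-dist : ∀ z m w n → ∣ seq (im z) m ℚ.- seq (im w) n ∣ ℚ.≤ dist z m w n
  im-dist z m w n = ≡.subst (y ℚ.≤_) (ℚ.+-comm y x) (p≤p+q y (ℚ.0≤∣p∣ (seq (re z) m ℚ.- seq (re w) n)))
    where
    x y : ℚ
    x = ∣ seq (re z) m ℚ.- seq (re w) n ∣
    y = ∣ seq (im z) m ℚ.- seq (im w) n ∣

  half<  : ∀ {ε} → 0ℚ ℚ.< ε → ε ℚ.* ½ ℚ.< ε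
  half< {ε} 0<ε = ≡.subst₂ ℚ._<_ (ℚ.+-identityʳ (ε ℚ.* ½)) (half ε) (ℚ.+-monoʳ-< (ε ℚ.* ½) (0<half 0<ε))

½<1ℚ : ½ ℚ.< 1ℚ
½<1ℚ = ≡.subst₂ ℚ._<_ (ℚ.+-identityʳ ½) (solve 0 (con ½ :+ con ½ := con 1ℚ) refl)
  (ℚ.+-monoʳ-< ½ (ℚ.positive⁻¹ ½))

abstract
  dist-cauchy : ∀ z ε → 0ℚ ℚ.< ε → ∃[ N ] (∀ m n → N ℕ.≤ m → N ℕ.≤ n → dist z m z n ℚ.≤ ε)
  dist-cauchy z ε 0<ε =
    let M , f = cauchy (re z) (ε ℚ.* ½) (0<half 0<ε)
        N , g = cauchy (im z) (ε ℚ.* ½) (0<half 0<ε)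
    in M ℕ.⊔ N , λ m n p r → ≡.subst (dist z m z n ℚ.≤_) (half ε) (ℚ.+-mono-≤
      (ℚ.<⇒≤ (f m n (ℕ.m⊔n≤o⇒m≤o M N p) (ℕ.m⊔n≤o⇒m≤o M N r)))
      (ℚ.<⇒≤ (g m n (ℕ.m⊔n≤o⇒n≤o M N p) (ℕ.m⊔n≤o⇒n≤o M N r))))

≼-≗ : ∀ {z w r} → z ≗ w → z ≼ r → w ≼ r
≼-≗ {r = r} z≗w h = within λ ε 0<ε →
  let N , f = eventually h ε 0<ε
  in N , λ n N≤n → ≡.subst₂ (λ x y → ∥ x ∶ y ∥ ℚ.≤ r ℚ.+ ε) (proj₁ (z≗w n)) (proj₂ (z≗w n)) (f n N≤n)

≼-mono : ∀ {z r s} → r ℚ.≤ s → z ≼ r → z ≼ s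
≼-mono r≤s h = within λ ε 0<ε →
  let N , f = eventually h ε 0<ε
  in N , λ n N≤n → ℚ.≤-trans (f n N≤n) (ℚ.+-monoˡ-≤ ε r≤s)

≼-closed : ∀ {z r} → (∀ ε → 0ℚ ℚ.< ε → z ≼ r ℚ.+ ε) → z ≼ r
≼-closed {r = r} h = within λ ε 0<ε →
  let N , f = eventually (h (ε ℚ.* ½) (0<half 0<ε)) (ε ℚ.* ½) (0<half 0<ε)
  in N , λ n N≤n → ℚ.≤-trans (f n N≤n)
       (ℚ.≤-reflexive (≡.trans (ℚ.+-assoc r (ε ℚ.* ½) (ε ℚ.* ½)) (≡.cong (r ℚ.+_) (half ε))))

≼-0 : 0# ≼ 0ℚ
≼-0 = within λ ε 0<ε → 0 , λ _ _ → p≤p+q 0ℚ (ℚ.<⇒≤ 0<ε)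

≼-1 : 1# ≼ 1ℚ
≼-1 = within λ ε 0<ε → 0 , λ _ _ → p≤p+q 1ℚ (ℚ.<⇒≤ 0<ε)

≼-+ : ∀ {z w r s} → z ≼ r → w ≼ s → z + w ≼ r ℚ.+ s
≼-+ {z} {w} {r} {s} z≼r w≼s = within λ ε 0<ε →
  let M , f = eventually z≼r (ε ℚ.* ½) (0<half 0<ε)
      N , g = eventually w≼s (ε ℚ.* ½) (0<half 0<ε)
  in M ℕ.⊔ N , λ n h → begin
    ∥ z + w ∥ n                              ≤⟨ ∥∥-triangle (seq (re z) n) (seq (im z) n) (seq (re w) n) (seq (im w) n) ⟩
    ∥ z ∥ n ℚ.+ ∥ w ∥ n                      ≤⟨ ℚ.+-mono-≤ (f n (ℕ.m⊔n≤o⇒m≤o M N h)) (g n (ℕ.m⊔n≤o⇒n≤o M N h)) ⟩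
    (r ℚ.+ ε ℚ.* ½) ℚ.+ (s ℚ.+ ε ℚ.* ½)
      ≡⟨ solve 3 (λ r s x → (r :+ x) :+ (s :+ x) := (r :+ s) :+ (x :+ x)) refl r s (ε ℚ.* ½) ⟩
    (r ℚ.+ s) ℚ.+ (ε ℚ.* ½ ℚ.+ ε ℚ.* ½)      ≡⟨ ≡.cong ((r ℚ.+ s) ℚ.+_) (half ε) ⟩
    (r ℚ.+ s) ℚ.+ ε                          ∎
  where open ℚ.≤-Reasoning

≼⇒0≤ : ∀ {z r} → z ≼ r → 0ℚ ℚ.≤ r
≼⇒0≤ {z} h = ≤-fromε λ ε 0<ε →
  let N , f = eventually h ε 0<ε
  in ℚ.≤-trans (0≤norm z N) (f N ℕ.≤-refl)

≼-* : ∀ {z w r s} → z ≼ r → w ≼ s → z * w ≼ r ℚ.* s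
≼-* {z} {w} {r} {s} z≼r w≼s = within λ ε 0<ε →
  let k , 0<k , Kk≡1 = reciprocal 0<K
      0<εk  = 0<* 0<ε 0<k
      -- The excess of (r + η)(s + η) over r s is η (r + s + η). With η ≤ 1 and η ≤ ε / (r + s + 1)
      -- it is at most ε.
      η     = (ε ℚ.* k) ℚ.⊓ 1ℚ
      0<η   = 0<⊓ 0<εk (ℚ.positive⁻¹ 1ℚ)
      M , f = eventually z≼r η 0<η
      N , g = eventually w≼s η 0<η
  in M ℕ.⊔ N , λ n h → begin
    ∥ z * w ∥ n                   ≤⟨ ∥∥-* (seq (re z) n) (seq (im z) n) (seq (re w) n) (seq (im w) n) ⟩
    ∥ z ∥ n ℚ.* ∥ w ∥ n           ≤⟨ *-mono₂-≤ (0≤norm w n) (0≤+ 0≤r (ℚ.<⇒≤ 0<η))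
                                       (f n (ℕ.m⊔n≤o⇒m≤o M N h)) (g n (ℕ.m⊔n≤o⇒n≤o M N h)) ⟩
    (r ℚ.+ η) ℚ.* (s ℚ.+ η)
      ≡⟨ solve 3 (λ r s x → (r :+ x) :* (s :+ x) := r :* s :+ x :* (r :+ s :+ x)) refl r s η ⟩
    r ℚ.* s ℚ.+ η ℚ.* (r ℚ.+ s ℚ.+ η)
      ≤⟨ ℚ.+-monoʳ-≤ (r ℚ.* s) (*-mono₂-≤ (0≤+ (0≤+ 0≤r 0≤s) (ℚ.<⇒≤ 0<η)) (ℚ.<⇒≤ 0<εk)
           (ℚ.p⊓q≤p (ε ℚ.* k) 1ℚ) (ℚ.+-monoʳ-≤ (r ℚ.+ s) (ℚ.p⊓q≤q (ε ℚ.* k) 1ℚ))) ⟩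
    r ℚ.* s ℚ.+ ε ℚ.* k ℚ.* (r ℚ.+ s ℚ.+ 1ℚ)
      ≡⟨ ≡.cong (r ℚ.* s ℚ.+_) (≡.trans
           (solve 3 (λ e k K → e :* k :* K := e :* (K :* k)) refl ε k (r ℚ.+ s ℚ.+ 1ℚ))
           (≡.trans (≡.cong (ε ℚ.*_) Kk≡1) (ℚ.*-identityʳ ε))) ⟩
    r ℚ.* s ℚ.+ ε                 ∎
  where
  open ℚ.≤-Reasoning
  0≤r : 0ℚ ℚ.≤ r
  0≤r = ≼⇒0≤ z≼r
  0≤s : 0ℚ ℚ.≤ s
  0≤s = ≼⇒0≤ w≼s
  0<K : 0ℚ ℚ.< r ℚ.+ s ℚ.+ 1ℚ
  0<K = ℚ.+-mono-≤-< (0≤+ 0≤r 0≤s) (ℚ.positive⁻¹ 1ℚ)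
  0<⊓ : ∀ {p q} → 0ℚ ℚ.< p → 0ℚ ℚ.< q → 0ℚ ℚ.< p ℚ.⊓ q
  0<⊓ {p} {q} 0<p 0<q with ℚ.⊓-sel p q
  ... | inj₁ eq = ≡.subst (0ℚ ℚ.<_) (≡.sym eq) 0<p
  ... | inj₂ eq = ≡.subst (0ℚ ℚ.<_) (≡.sym eq) 0<q

≼-neg : ∀ {z r} → z ≼ r → - z ≼ r
≼-neg {z} {r} h = within λ ε 0<ε →
  let N , f = eventually h ε 0<ε
  in N , λ n N≤n → ≡.subst (ℚ._≤ r ℚ.+ ε)
    (≡.sym (≡.cong₂ ℚ._+_ (ℚ.∣-p∣≡∣p∣ (seq (re z) n)) (ℚ.∣-p∣≡∣p∣ (seq (im z) n)))) (f n N≤n)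

≼-bound : ∀ z → ∃[ r ] z ≼ r
≼-bound z =
  let N , f = dist-cauchy z 1ℚ (ℚ.positive⁻¹ 1ℚ)
  in 1ℚ ℚ.+ ∥ z ∥ N , within λ ε 0<ε → N , λ n N≤n → ℚ.≤-trans
       (≡.subst₂ (λ x y → ∥ x ∶ y ∥ ℚ.≤ dist z n z N ℚ.+ ∥ z ∥ N)
         (restore (seq (re z) n) (seq (re z) N)) (restore (seq (im z) n) (seq (im z) N))
         (∥∥-triangle (seq (re z) n ℚ.- seq (re z) N) (seq (im z) n ℚ.- seq (im z) N) (seq (re z) N) (seq (im z) N)))
       (ℚ.≤-trans (ℚ.+-monoˡ-≤ (∥ z ∥ N) (f n N N≤n ℕ.≤-refl)) (p≤p+q _ (ℚ.<⇒≤ 0<ε)))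
  where
  restore : ∀ a b → (a ℚ.- b) ℚ.+ b ≡ a
  restore = solve 2 (λ a b → (a :- b) :+ b := a) refl

-- Equality is vanishing distance; with the converse `≈⇒≼0`, symmetry, transitivity and all
-- congruences follow from the norm laws.
≼0⇒≈ : ∀ {z w} → z - w ≼ 0ℚ → z ≈ w
≼0⇒≈ {z} {w} h = component (λ n → re-dist z n w n) , component (λ n → im-dist z n w n)
  where
  component : ∀ {d : ℕ → ℚ} → (∀ n → d n ℚ.≤ dist z n w n) →
    ∀ ε → 0ℚ ℚ.< ε → ∃[ N ] (∀ n → N ℕ.≤ n → d n ℚ.< ε)
  component d≤ ε 0<ε =
    let N , f = eventually h (ε ℚ.* ½) (0<half 0<ε)
    in N , λ n N≤n → ℚ.≤-<-trans (ℚ.≤-trans (d≤ n) (f n N≤n))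
         (≡.subst (ℚ._< ε) (≡.sym (ℚ.+-identityˡ (ε ℚ.* ½))) (half< 0<ε))

≈⇒≼0 : ∀ {z w} → z ≈ w → z - w ≼ 0ℚ
≈⇒≼0 {z} {w} (f , g) = within λ ε 0<ε →
  let M , h = f (ε ℚ.* ½) (0<half 0<ε)
      N , k = g (ε ℚ.* ½) (0<half 0<ε)
  in M ℕ.⊔ N , λ n p → ≡.subst (∥ z - w ∥ n ℚ.≤_) (≡.trans (half ε) (≡.sym (ℚ.+-identityˡ ε)))
    (ℚ.+-mono-≤ (ℚ.<⇒≤ (h n (ℕ.m⊔n≤o⇒m≤o M N p))) (ℚ.<⇒≤ (k n (ℕ.m⊔n≤o⇒n≤o M N p))))

≗⇒≈ : ∀ {z w} → z ≗ w → z ≈ w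
≗⇒≈ {z} {w} z≗w = ≼0⇒≈ {z} {w} (≼-≗ {0#} {z - w}
  (λ n → (vanish (proj₁ (z≗w n)) , vanish (proj₂ (z≗w n)))) ≼-0)
  where
  vanish : ∀ {a b} → a ≡ b → 0ℚ ≡ a ℚ.- b
  vanish {a} refl = ≡.sym (ℚ.+-inverseʳ a)

≼-resp : ∀ {z w r} → z ≈ w → z ≼ r → w ≼ r
≼-resp {z} {w} {r} z≈w z≼r = ≼-≗ {z + - (z - w)} {w} (λ n → (undo (z ʳ n) (w ʳ n) , undo (z ⁱ n) (w ⁱ n)))
  (≼-mono {z + - (z - w)} (ℚ.≤-reflexive (ℚ.+-identityʳ r))
    (≼-+ {z} {w = - (z - w)} z≼r (≼-neg {z - w} (≈⇒≼0 {z} {w} z≈w))))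
  where
  undo : ∀ a b → a ℚ.+ ℚ.- (a ℚ.+ ℚ.- b) ≡ b
  undo = solve 2 (λ a b → a :+ :- (a :+ :- b) := b) refl

≈-sym : ∀ {z w} → z ≈ w → w ≈ z
≈-sym {z} {w} z≈w = ≼0⇒≈ {w} {z} (≼-≗ { - (z - w)} {w - z} (λ n → (flip (z ʳ n) (w ʳ n) , flip (z ⁱ n) (w ⁱ n)))
  (≼-neg {z - w} (≈⇒≼0 {z} {w} z≈w)))
  where
  flip : ∀ a b → ℚ.- (a ℚ.- b) ≡ b ℚ.- a
  flip = solve 2 (λ a b → :- (a :- b) := b :- a) refl

≈-trans : ∀ {z u w} → z ≈ u → u ≈ w → z ≈ w
≈-trans {z} {u} {w} z≈u u≈w = ≼0⇒≈ {z} {w} (≼-≗ {(z - u) + (u - w)} {z - w}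
  (λ n → (telescope (z ʳ n) (u ʳ n) (w ʳ n) , telescope (z ⁱ n) (u ⁱ n) (w ⁱ n)))
  (≼-+ {z - u} {u - w} (≈⇒≼0 {z} {u} z≈u) (≈⇒≼0 {u} {w} u≈w)))
  where
  telescope : ∀ a b c → (a ℚ.- b) ℚ.+ (b ℚ.- c) ≡ a ℚ.- c
  telescope = solve 3 (λ a b c → (a :- b) :+ (b :- c) := a :- c) refl

+-cong : ∀ {z z′ w w′} → z ≈ z′ → w ≈ w′ → z + w ≈ z′ + w′
+-cong {z} {z′} {w} {w′} z≈ w≈ = ≼0⇒≈ {z + w} {z′ + w′} (≼-≗ {(z - z′) + (w - w′)} {(z + w) - (z′ + w′)}
  (λ n → (regroup (z ʳ n) (z′ ʳ n) (w ʳ n) (w′ ʳ n) , regroup (z ⁱ n) (z′ ⁱ n) (w ⁱ n) (w′ ⁱ n)))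
  (≼-+ {z - z′} {w - w′} (≈⇒≼0 {z} {z′} z≈) (≈⇒≼0 {w} {w′} w≈)))
  where
  regroup : ∀ a b c d → (a ℚ.- b) ℚ.+ (c ℚ.- d) ≡ (a ℚ.+ c) ℚ.- (b ℚ.+ d)
  regroup = solve 4 (λ a b c d → (a :- b) :+ (c :- d) := (a :+ c) :- (b :+ d)) refl

-‿cong : ∀ {z w} → z ≈ w → - z ≈ - w
-‿cong {z} {w} z≈w = ≼0⇒≈ { - z} { - w} (≼-≗ { - (z - w)} {(- z) - (- w)} (λ n → (regroup (z ʳ n) (w ʳ n) , regroup (z ⁱ n) (w ⁱ n)))
  (≼-neg {z - w} (≈⇒≼0 {z} {w} z≈w)))
  where
  regroup : ∀ a b → ℚ.- (a ℚ.- b) ≡ ℚ.- a ℚ.- ℚ.- b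
  regroup = solve 2 (λ a b → :- (a :- b) := :- a :- :- b) refl

*-cong : ∀ {z z′ w w′} → z ≈ z′ → w ≈ w′ → z * w ≈ z′ * w′
*-cong {z} {z′} {w} {w′} z≈ w≈ =
  let r , z≼r = ≼-bound z
      s , w′≼s = ≼-bound w′
  in ≼0⇒≈ {z * w} {z′ * w′} (≼-≗ {z * (w - w′) + (z - z′) * w′} {z * w - z′ * w′}
    (λ n → (regroup-re (z ʳ n) (z ⁱ n) (z′ ʳ n) (z′ ⁱ n) (w ʳ n) (w ⁱ n) (w′ ʳ n) (w′ ⁱ n) , regroup-im (z ʳ n) (z ⁱ n) (z′ ʳ n) (z′ ⁱ n) (w ʳ n) (w ⁱ n) (w′ ʳ n) (w′ ⁱ n)))
    (≼-mono {z * (w - w′) + (z - z′) * w′}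
      (ℚ.≤-reflexive (≡.cong₂ ℚ._+_ (ℚ.*-zeroʳ r) (ℚ.*-zeroˡ s)))
      (≼-+ {z * (w - w′)} {(z - z′) * w′} (≼-* {z} {w - w′} z≼r (≈⇒≼0 {w} {w′} w≈))
        (≼-* {z - z′} {w′} (≈⇒≼0 {z} {z′} z≈) w′≼s))))
  where
  regroup-re : ∀ a b a′ b′ c d c′ d′ →
    (a ℚ.* (c ℚ.- c′) ℚ.- b ℚ.* (d ℚ.- d′)) ℚ.+ ((a ℚ.- a′) ℚ.* c′ ℚ.- (b ℚ.- b′) ℚ.* d′) ≡
    (a ℚ.* c ℚ.- b ℚ.* d) ℚ.- (a′ ℚ.* c′ ℚ.- b′ ℚ.* d′)
  regroup-re = solve 8 (λ a b a′ b′ c d c′ d′ →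
    (a :* (c :- c′) :- b :* (d :- d′)) :+ ((a :- a′) :* c′ :- (b :- b′) :* d′) :=
    (a :* c :- b :* d) :- (a′ :* c′ :- b′ :* d′)) refl
  regroup-im : ∀ a b a′ b′ c d c′ d′ →
    (a ℚ.* (d ℚ.- d′) ℚ.+ b ℚ.* (c ℚ.- c′)) ℚ.+ ((a ℚ.- a′) ℚ.* d′ ℚ.+ (b ℚ.- b′) ℚ.* c′) ≡
    (a ℚ.* d ℚ.+ b ℚ.* c) ℚ.- (a′ ℚ.* d′ ℚ.+ b′ ℚ.* c′)
  regroup-im = solve 8 (λ a b a′ b′ c d c′ d′ →
    (a :* (d :- d′) :+ b :* (c :- c′)) :+ ((a :- a′) :* d′ :+ (b :- b′) :* c′) :=
    (a :* d :+ b :* c) :- (a′ :* d′ :+ b′ :* c′)) refl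

-- The ring structure and completeness of ℂ

ℂ-commutativeRing : CommutativeRing 0ℓ 0ℓ
ℂ-commutativeRing = record
  { Carrier = ℂ ; _≈_ = _≈_ ; _+_ = _+_ ; _*_ = _*_ ; -_ = -_ ; 0# = 0# ; 1# = 1#
  ; isCommutativeRing = record
    { isRing = record
      { +-isAbelianGroup = record
        { isGroup = record
          { isMonoid = record
            { isSemigroup = record
              { isMagma = record
                { isEquivalence = record
                  { refl  = λ {x} → ≗⇒≈ {x} {x} (λ _ → refl , refl)
                  ; sym   = λ {x} {y} → ≈-sym {x} {y}
                  ; trans = λ {x} {y} {z} → ≈-trans {x} {y} {z}
                  }
                ; ∙-cong = λ {x} {x′} {y} {y′} → +-cong {x} {x′} {y} {y′}
                }
              ; assoc = λ x y z → ≗⇒≈ {x + y + z} {x + (y + z)} λ n →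
                  ℚ.+-assoc (x ʳ n) (y ʳ n) (z ʳ n) , ℚ.+-assoc (x ⁱ n) (y ⁱ n) (z ⁱ n)
              }
            ; identity =
                (λ x → ≗⇒≈ {0# + x} {x} λ n → ℚ.+-identityˡ (x ʳ n) , ℚ.+-identityˡ (x ⁱ n)) ,
                (λ x → ≗⇒≈ {x + 0#} {x} λ n → ℚ.+-identityʳ (x ʳ n) , ℚ.+-identityʳ (x ⁱ n))
            }
          ; inverse =
              (λ x → ≗⇒≈ { - x + x} {0#} λ n → ℚ.+-inverseˡ (x ʳ n) , ℚ.+-inverseˡ (x ⁱ n)) ,
              (λ x → ≗⇒≈ {x - x} {0#} λ n → ℚ.+-inverseʳ (x ʳ n) , ℚ.+-inverseʳ (x ⁱ n))
          ; ⁻¹-cong = λ {x} {y} → -‿cong {x} {y}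
          }
        ; comm = λ x y → ≗⇒≈ {x + y} {y + x} λ n →
            ℚ.+-comm (x ʳ n) (y ʳ n) , ℚ.+-comm (x ⁱ n) (y ⁱ n)
        }
      ; *-cong = λ {x} {x′} {y} {y′} → *-cong {x} {x′} {y} {y′}
      ; *-assoc = λ x y z → ≗⇒≈ {x * y * z} {x * (y * z)} λ n →
          solve 6 (λ a b c d e f →
            (a :* c :- b :* d) :* e :- (a :* d :+ b :* c) :* f :=
            a :* (c :* e :- d :* f) :- b :* (c :* f :+ d :* e)) refl
            (x ʳ n) (x ⁱ n) (y ʳ n) (y ⁱ n) (z ʳ n) (z ⁱ n) ,
          solve 6 (λ a b c d e f →
            (a :* c :- b :* d) :* f :+ (a :* d :+ b :* c) :* e :=
            a :* (c :* f :+ d :* e) :+ b :* (c :* e :- d :* f)) refl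
            (x ʳ n) (x ⁱ n) (y ʳ n) (y ⁱ n) (z ʳ n) (z ⁱ n)
      ; *-identity =
          (λ x → ≗⇒≈ {1# * x} {x} λ n →
            solve 2 (λ a b → con 1ℚ :* a :- con 0ℚ :* b := a) refl (x ʳ n) (x ⁱ n) ,
            solve 2 (λ a b → con 1ℚ :* b :+ con 0ℚ :* a := b) refl (x ʳ n) (x ⁱ n)) ,
          (λ x → ≗⇒≈ {x * 1#} {x} λ n →
            solve 2 (λ a b → a :* con 1ℚ :- b :* con 0ℚ := a) refl (x ʳ n) (x ⁱ n) ,
            solve 2 (λ a b → a :* con 0ℚ :+ b :* con 1ℚ := b) refl (x ʳ n) (x ⁱ n))
      ; distrib =
          (λ x y z → ≗⇒≈ {x * (y + z)} {x * y + x * z} λ n →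
            solve 6 (λ a b c d e f →
              a :* (c :+ e) :- b :* (d :+ f) := (a :* c :- b :* d) :+ (a :* e :- b :* f)) refl
              (x ʳ n) (x ⁱ n) (y ʳ n) (y ⁱ n) (z ʳ n) (z ⁱ n) ,
            solve 6 (λ a b c d e f →
              a :* (d :+ f) :+ b :* (c :+ e) := (a :* d :+ b :* c) :+ (a :* f :+ b :* e)) refl
              (x ʳ n) (x ⁱ n) (y ʳ n) (y ⁱ n) (z ʳ n) (z ⁱ n)) ,
          (λ x y z → ≗⇒≈ {(y + z) * x} {y * x + z * x} λ n →
            solve 6 (λ a b c d e f →
              (c :+ e) :* a :- (d :+ f) :* b := (c :* a :- d :* b) :+ (e :* a :- f :* b)) refl
              (x ʳ n) (x ⁱ n) (y ʳ n) (y ⁱ n) (z ʳ n) (z ⁱ n) ,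
            solve 6 (λ a b c d e f →
              (c :+ e) :* b :+ (d :+ f) :* a := (c :* b :+ d :* a) :+ (e :* b :+ f :* a)) refl
              (x ʳ n) (x ⁱ n) (y ʳ n) (y ⁱ n) (z ʳ n) (z ⁱ n))
      }
    ; *-comm = λ x y → ≗⇒≈ {x * y} {y * x} λ n →
        solve 4 (λ a b c d → a :* c :- b :* d := c :* a :- d :* b) refl (x ʳ n) (x ⁱ n) (y ʳ n) (y ⁱ n) ,
        solve 4 (λ a b c d → a :* d :+ b :* c := c :* b :+ d :* a) refl (x ʳ n) (x ⁱ n) (y ʳ n) (y ⁱ n)
    }
  }

-- The limit is a diagonal sequence: its k-th entry is an entry of s N with
-- both N and the entry chosen for the precision 2^{-k}.
module Completeness
  (s : ℕ → ℂ)
  (s-cauchy : ∀ ε → 0ℚ ℚ.< ε → ∃[ N ] (∀ m n → N ℕ.≤ m → N ℕ.≤ n → s m - s n ≼ ε))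
  where

  e : ℕ → ℚ
  e k = ½ ^ℚ k

  0<e : ∀ k → 0ℚ ℚ.< e k
  0<e zero    = ℚ.positive⁻¹ 1ℚ
  0<e (suc k) = 0<* (ℚ.positive⁻¹ ½) (0<e k)

  e-antimono : ∀ j k → j ℕ.≤ k → e k ℚ.≤ e j
  e-antimono j k = ^-antimono (ℚ.nonNegative⁻¹ ½) (ℚ.<⇒≤ ½<1ℚ) {j} {k}

  abstract
    outer : ∀ k → ∃[ N ] (∀ m n → N ℕ.≤ m → N ℕ.≤ n → s m - s n ≼ e k)
    outer k = s-cauchy (e k) (0<e k)

  z : ℕ → ℂ
  z k = s (proj₁ (outer k))

  abstract
    inner : ∀ k → ∃[ N ] (∀ m n → N ℕ.≤ m → N ℕ.≤ n → dist (z k) m (z k) n ℚ.≤ e k)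
    inner k = dist-cauchy (z k) (e k) (0<e k)

  M : ℕ → ℕ
  M k = proj₁ (inner k)

  s-near : ∀ m k → proj₁ (outer k) ℕ.≤ m → s m - z k ≼ e k
  s-near m k N≤m = proj₂ (outer k) m (proj₁ (outer k)) N≤m ℕ.≤-refl

  z-near : ∀ j k → z j - z k ≼ e j ℚ.+ e k
  z-near j k = ≼-≗ {(- (s m - z j)) + (s m - z k)} {z j - z k}
    (λ n → regroup (s m ʳ n) (z j ʳ n) (z k ʳ n) , regroup (s m ⁱ n) (z j ⁱ n) (z k ⁱ n))
    (≼-+ (≼-neg (s-near m j (ℕ.m≤m⊔n _ _))) (s-near m k (ℕ.m≤n⊔m _ _)))
    where
    m : ℕ
    m = proj₁ (outer j) ℕ.⊔ proj₁ (outer k)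
    regroup : ∀ a b c → ℚ.- (a ℚ.- b) ℚ.+ (a ℚ.- c) ≡ b ℚ.- c
    regroup = solve 3 (λ a b c → :- (a :- b) :+ (a :- c) := b :- c) refl

  diagonal-dist : ∀ j k → dist (z j) (M j) (z k) (M k) ℚ.≤ fromℕ 3 ℚ.* (e j ℚ.+ e k)
  diagonal-dist j k =
    let N , f = eventually (z-near j k) (e j) (0<e j)
        n = N ℕ.⊔ (M j ℕ.⊔ M k)
        Mj≤n = ℕ.≤-trans (ℕ.m≤m⊔n (M j) (M k)) (ℕ.m≤n⊔m N (M j ℕ.⊔ M k))
        Mk≤n = ℕ.≤-trans (ℕ.m≤n⊔m (M j) (M k)) (ℕ.m≤n⊔m N (M j ℕ.⊔ M k))
    in begin
      dist (z j) (M j) (z k) (M k)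
        ≤⟨ dist-triangle (z j) (M j) (z j) n (z k) (M k) ⟩
      dist (z j) (M j) (z j) n ℚ.+ dist (z j) n (z k) (M k)
        ≤⟨ ℚ.+-monoʳ-≤ (dist (z j) (M j) (z j) n) (dist-triangle (z j) n (z k) n (z k) (M k)) ⟩
      dist (z j) (M j) (z j) n ℚ.+ (dist (z j) n (z k) n ℚ.+ dist (z k) n (z k) (M k))
        ≤⟨ ℚ.+-mono-≤ (proj₂ (inner j) (M j) n ℕ.≤-refl Mj≤n)
             (ℚ.+-mono-≤ (f n (ℕ.m≤m⊔n N (M j ℕ.⊔ M k))) (proj₂ (inner k) n (M k) Mk≤n ℕ.≤-refl)) ⟩
      e j ℚ.+ ((e j ℚ.+ e k ℚ.+ e j) ℚ.+ e k)
        -- The triangle inequality gives 3 e_j + 2 e_k; one more e_k makes the bound symmetric.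
        ≤⟨ p≤p+q _ (ℚ.<⇒≤ (0<e k)) ⟩
      e j ℚ.+ ((e j ℚ.+ e k ℚ.+ e j) ℚ.+ e k) ℚ.+ e k
        ≡⟨ solve 2 (λ a b → a :+ ((a :+ b :+ a) :+ b) :+ b := con (fromℕ 3) :* (a :+ b)) refl (e j) (e k) ⟩
      fromℕ 3 ℚ.* (e j ℚ.+ e k)
        ∎
    where open ℚ.≤-Reasoning

  precision : ∀ C → 0ℚ ℚ.≤ C → ∀ ε → 0ℚ ℚ.< ε → ∃[ K ] (∀ k → K ℕ.≤ k → C ℚ.* e k ℚ.≤ ε)
  precision C 0≤C ε 0<ε = ^-small {C = C} (ℚ.nonNegative⁻¹ ½) ½<1ℚ 0≤C 0<ε

  diagonal-cauchy : ∀ ε → 0ℚ ℚ.< ε →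
    ∃[ N ] (∀ j k → N ℕ.≤ j → N ℕ.≤ k → dist (z j) (M j) (z k) (M k) ℚ.< ε)
  diagonal-cauchy ε 0<ε =
    let K , small = precision (fromℕ 6) (ℚ.nonNegative⁻¹ (fromℕ 6)) (ε ℚ.* ½) (0<half 0<ε)
    in K , λ j k K≤j K≤k → begin-strict
      dist (z j) (M j) (z k) (M k)      ≤⟨ diagonal-dist j k ⟩
      fromℕ 3 ℚ.* (e j ℚ.+ e k)
        ≤⟨ ℚ.*-monoˡ-≤-nonNeg (fromℕ 3) (ℚ.+-mono-≤ (e-antimono K j K≤j) (e-antimono K k K≤k)) ⟩
      fromℕ 3 ℚ.* (e K ℚ.+ e K)
        ≡⟨ solve 1 (λ a → con (fromℕ 3) :* (a :+ a) := con (fromℕ 6) :* a) refl (e K) ⟩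
      fromℕ 6 ℚ.* e K                   ≤⟨ small K ℕ.≤-refl ⟩
      ε ℚ.* ½                           <⟨ half< 0<ε ⟩
      ε                                 ∎
    where open ℚ.≤-Reasoning

  abstract
    re-cauchy : IsCauchy (λ k → z k ʳ M k)
    re-cauchy ε 0<ε =
      let N , f = diagonal-cauchy ε 0<ε
      in N , λ j k N≤j N≤k → ℚ.≤-<-trans (re-dist (z j) (M j) (z k) (M k)) (f j k N≤j N≤k)

    im-cauchy : IsCauchy (λ k → z k ⁱ M k)
    im-cauchy ε 0<ε =
      let N , f = diagonal-cauchy ε 0<ε
      in N , λ j k N≤j N≤k → ℚ.≤-<-trans (im-dist (z j) (M j) (z k) (M k)) (f j k N≤j N≤k)

  limit : ℂ
  limit = mkℝ (λ k → z k ʳ M k) re-cauchy +i mkℝ (λ k → z k ⁱ M k) im-cauchy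

  -- The constant is 7 = 1 + 3 · 2: one e_k for moving to entry `M k` of `z k`, and `diagonal-dist`
  -- with e_j ≤ e_k for the rest.
  z-limit : ∀ k → z k - limit ≼ fromℕ 7 ℚ.* e k
  z-limit k = within λ ε 0<ε → k ℕ.⊔ M k , λ j k⊔M≤j → begin
    dist (z k) j (z j) (M j)
      ≤⟨ dist-triangle (z k) j (z k) (M k) (z j) (M j) ⟩
    dist (z k) j (z k) (M k) ℚ.+ dist (z k) (M k) (z j) (M j)
      ≤⟨ ℚ.+-mono-≤ (proj₂ (inner k) j (M k) (ℕ.m⊔n≤o⇒n≤o k (M k) k⊔M≤j) ℕ.≤-refl)
           (ℚ.≤-trans (diagonal-dist k j) (ℚ.*-monoˡ-≤-nonNeg (fromℕ 3)
             (ℚ.+-monoʳ-≤ (e k) (e-antimono k j (ℕ.m⊔n≤o⇒m≤o k (M k) k⊔M≤j))))) ⟩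
    e k ℚ.+ fromℕ 3 ℚ.* (e k ℚ.+ e k)
      ≡⟨ solve 1 (λ a → a :+ con (fromℕ 3) :* (a :+ a) := con (fromℕ 7) :* a) refl (e k) ⟩
    fromℕ 7 ℚ.* e k
      ≤⟨ p≤p+q _ (ℚ.<⇒≤ 0<ε) ⟩
    fromℕ 7 ℚ.* e k ℚ.+ ε
      ∎
    where open ℚ.≤-Reasoning

  converges : ∀ ε → 0ℚ ℚ.< ε → ∃[ N ] (∀ n → N ℕ.≤ n → s n - limit ≼ ε)
  converges ε 0<ε =
    let k , small = precision (fromℕ 8) (ℚ.nonNegative⁻¹ (fromℕ 8)) ε 0<ε
    in proj₁ (outer k) , λ n N≤n → ≼-≗ {(s n - z k) + (z k - limit)} {s n - limit}
      (λ m → telescope (s n ʳ m) (z k ʳ m) (limit ʳ m) , telescope (s n ⁱ m) (z k ⁱ m) (limit ⁱ m))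
      (≼-mono (ℚ.≤-trans
        (ℚ.≤-reflexive (solve 1 (λ a → a :+ con (fromℕ 7) :* a := con (fromℕ 8) :* a) refl (e k)))
        (small k ℕ.≤-refl))
        (≼-+ (s-near n k N≤n) (z-limit k)))
    where
    telescope : ∀ a b c → (a ℚ.- b) ℚ.+ (b ℚ.- c) ≡ a ℚ.- c
    telescope = solve 3 (λ a b c → (a :- b) :+ (b :- c) := a :- c) refl

ℂ-completeNormedRing : CompleteNormedRing
ℂ-completeNormedRing = record
  { commutativeRing = ℂ-commutativeRing
  ; _≼_      = _≼_
  ; ≼-resp   = λ {x} {y} → ≼-resp {x} {y}
  ; ≼-mono   = ≼-mono
  ; ≼-closed = ≼-closed
  ; ≼-0      = ≼-0
  ; ≼-1      = ≼-1
  ; ≼-+      = ≼-+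
  ; ≼-*      = ≼-*
  ; ≼-neg    = ≼-neg
  ; ≼⇒0≤     = ≼⇒0≤
  ; ≼-bound  = ≼-bound
  ; ≼0⇒≈0    = λ {x} x≼0 → ≼0⇒≈ {x} {0#} (≼-≗ {x} {x - 0#}
      (λ n → ≡.sym (ℚ.+-identityʳ (x ʳ n)) , ≡.sym (ℚ.+-identityʳ (x ⁱ n))) x≼0)
  ; complete = λ s s-cauchy → Completeness.limit s s-cauchy , Completeness.converges s s-cauchy
  }

-- Squared moduli, reciprocals and geometric decay

∣_∣²_ : ℂ → ℕ → ℚ
∣ z ∣² n = seq (normSq z) n

norm²-* : ∀ z w n → ∣ z * w ∣² n ≡ (∣ z ∣² n) ℚ.* (∣ w ∣² n)
norm²-* z w n = solve 4 (λ a b c d →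
  (a :* c :- b :* d) :* (a :* c :- b :* d) :+ (a :* d :+ b :* c) :* (a :* d :+ b :* c) :=
  (a :* a :+ b :* b) :* (c :* c :+ d :* d)) refl (z ʳ n) (z ⁱ n) (w ʳ n) (w ⁱ n)

0≤norm² : ∀ z n → 0ℚ ℚ.≤ ∣ z ∣² n
0≤norm² z n = 0≤+ (0≤square (z ʳ n)) (0≤square (z ⁱ n))

-- Eventually the ℓ¹ norm of z w is at least ½ and that of w at most b = 1/c, so that of z is at
-- least c/2. The squared modulus is at least half the squared ℓ¹ norm, whence δ = c²/8.
unit⇒#0 : ∀ {z} → (∃[ w ] z * w ≈ 1#) → z #0
unit⇒#0 {z} (w , zw≈1) =
  let B , w≼B = ≼-bound w
      0≤B = ≼⇒0≤ w≼B
      b = B ℚ.+ 1ℚ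
      0<b : 0ℚ ℚ.< b
      0<b = ℚ.+-mono-≤-< 0≤B (ℚ.positive⁻¹ 1ℚ)
      c , 0<c , bc≡1 = reciprocal 0<b
      N₁ , f = eventually w≼B 1ℚ (ℚ.positive⁻¹ 1ℚ)
      N₂ , g = eventually (≈⇒≼0 {z * w} {1#} zw≈1) ½ (ℚ.positive⁻¹ ½)
      δ = (c ℚ.* c) ℚ.* (½ ℚ.* ½ ℚ.* ½)
  in δ , 0<* (0<* 0<c 0<c) (ℚ.positive⁻¹ (½ ℚ.* ½ ℚ.* ½)) , N₁ ℕ.⊔ N₂ , λ n h →
     lower-bound c b n 0<c 0<b bc≡1 (f n (ℕ.m⊔n≤o⇒m≤o N₁ N₂ h)) (g n (ℕ.m⊔n≤o⇒n≤o N₁ N₂ h))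
  where
  open ℚ.≤-Reasoning
  lower-bound : ∀ c b n → 0ℚ ℚ.< c → 0ℚ ℚ.< b → b ℚ.* c ≡ 1ℚ →
    ∥ w ∥ n ℚ.≤ b → ∥ z * w - 1# ∥ n ℚ.≤ 0ℚ ℚ.+ ½ →
    0ℚ ℚ.+ (c ℚ.* c) ℚ.* (½ ℚ.* ½ ℚ.* ½) ℚ.≤ ∣ z ∣² n
  lower-bound c b n 0<c 0<b bc≡1 w≤b zw≤½ = begin
    0ℚ ℚ.+ (c ℚ.* c) ℚ.* (½ ℚ.* ½ ℚ.* ½)
      ≡⟨ solve 1 (λ c → con 0ℚ :+ (c :* c) :* con (½ ℚ.* ½ ℚ.* ½) := con ½ :* ((con ½ :* c) :* (con ½ :* c))) refl c ⟩
    ½ ℚ.* ((½ ℚ.* c) ℚ.* (½ ℚ.* c))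
      ≤⟨ ℚ.*-monoˡ-≤-nonNeg ½ (*-mono₂-≤ (0≤* (ℚ.nonNegative⁻¹ ½) (ℚ.<⇒≤ 0<c)) (0≤norm z n) ½c≤z ½c≤z) ⟩
    ½ ℚ.* (∥ z ∥ n ℚ.* ∥ z ∥ n)
      ≤⟨ ℚ.*-monoˡ-≤-nonNeg ½ (∥∥²≤2square (z ʳ n) (z ⁱ n)) ⟩
    ½ ℚ.* (fromℕ 2 ℚ.* (∣ z ∣² n))
      ≡⟨ solve 1 (λ x → con ½ :* (con (fromℕ 2) :* x) := x) refl (∣ z ∣² n) ⟩
    ∣ z ∣² n
      ∎
    where
    ½≤zw : ½ ℚ.≤ ∥ z ∥ n ℚ.* ∥ w ∥ n
    ½≤zw = ℚ.≤-trans 1≤ (∥∥-* (z ʳ n) (z ⁱ n) (w ʳ n) (w ⁱ n))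
      where
      1≤ : ½ ℚ.≤ ∥ z * w ∥ n
      1≤ = begin
        ½                                            ≡⟨ solve 0 (con ½ := con 1ℚ :- con ½) refl ⟩
        1ℚ ℚ.- ½                                     ≤⟨ ℚ.+-monoˡ-≤ (ℚ.- ½) triangle ⟩
        (∥ z * w ∥ n ℚ.+ ½) ℚ.- ½
          ≡⟨ solve 1 (λ x → (x :+ con ½) :- con ½ := x) refl (∥ z * w ∥ n) ⟩
        ∥ z * w ∥ n                                  ∎
        where
        cancel : ∀ a b → a ℚ.+ ℚ.- (a ℚ.- b) ≡ b
        cancel = solve 2 (λ a b → a :+ :- (a :- b) := b) refl
        restore : ∀ a b c d → ∥ a ℚ.+ ℚ.- (a ℚ.- c) ∶ b ℚ.+ ℚ.- (b ℚ.- d) ∥ ≡ ∥ c ∶ d ∥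
        restore a b c d = ≡.cong₂ ∥_∶_∥ (cancel a c) (cancel b d)
        triangle : 1ℚ ℚ.≤ ∥ z * w ∥ n ℚ.+ ½
        triangle = begin
          ∥ 1ℚ ∶ 0ℚ ∥
            ≡⟨ restore ((z * w) ʳ n) ((z * w) ⁱ n) 1ℚ 0ℚ ⟨
          ∥ (z * w) ʳ n ℚ.+ ℚ.- ((z * w - 1#) ʳ n) ∶ (z * w) ⁱ n ℚ.+ ℚ.- ((z * w - 1#) ⁱ n) ∥
            ≤⟨ ∥∥-triangle ((z * w) ʳ n) ((z * w) ⁱ n) (ℚ.- ((z * w - 1#) ʳ n)) (ℚ.- ((z * w - 1#) ⁱ n)) ⟩
          ∥ z * w ∥ n ℚ.+ ∥ ℚ.- ((z * w - 1#) ʳ n) ∶ ℚ.- ((z * w - 1#) ⁱ n) ∥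
            ≡⟨ ≡.cong (∥ z * w ∥ n ℚ.+_)
                 (≡.cong₂ ℚ._+_ (ℚ.∣-p∣≡∣p∣ ((z * w - 1#) ʳ n)) (ℚ.∣-p∣≡∣p∣ ((z * w - 1#) ⁱ n))) ⟩
          ∥ z * w ∥ n ℚ.+ ∥ z * w - 1# ∥ n
            ≤⟨ ℚ.+-monoʳ-≤ (∥ z * w ∥ n) (ℚ.≤-trans zw≤½ (ℚ.≤-reflexive (ℚ.+-identityˡ ½))) ⟩
          ∥ z * w ∥ n ℚ.+ ½
            ∎
    ½c≤z : ½ ℚ.* c ℚ.≤ ∥ z ∥ n
    ½c≤z = begin
      ½ ℚ.* c                       ≤⟨ ℚ.*-monoʳ-≤-nonNeg c {{ℚ.nonNegative (ℚ.<⇒≤ 0<c)}} ½≤zw ⟩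
      ∥ z ∥ n ℚ.* ∥ w ∥ n ℚ.* c     ≤⟨ ℚ.*-monoʳ-≤-nonNeg c {{ℚ.nonNegative (ℚ.<⇒≤ 0<c)}}
                                         (ℚ.*-monoˡ-≤-nonNeg (∥ z ∥ n) {{ℚ.nonNegative (0≤norm z n)}} w≤b) ⟩
      ∥ z ∥ n ℚ.* b ℚ.* c           ≡⟨ ℚ.*-assoc (∥ z ∥ n) b c ⟩
      ∥ z ∥ n ℚ.* (b ℚ.* c)         ≡⟨ ≡.cong (∥ z ∥ n ℚ.*_) bc≡1 ⟩
      ∥ z ∥ n ℚ.* 1ℚ                ≡⟨ ℚ.*-identityʳ (∥ z ∥ n) ⟩
      ∥ z ∥ n                       ∎

*-inverse : ∀ z (z#0 : z #0) → z * inverse z z#0 ≈ 1#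
*-inverse z z#0@(δ , 0<δ , N , δ≤) = ≼0⇒≈ {z * inverse z z#0} {1#} (within λ ε 0<ε → N , λ n N≤n →
  ℚ.≤-trans (ℚ.≤-reflexive (≡.cong₂ ∥_∶_∥ (real n N≤n) (imaginary n)))
    (p≤p+q 0ℚ (ℚ.<⇒≤ 0<ε)))
  where
  r : ℕ → ℚ
  r n = recip (∣ z ∣² n)
  inverse-at : ∀ n → N ℕ.≤ n → (∣ z ∣² n) ℚ.* r n ≡ 1ℚ
  inverse-at n N≤n = recip-inverseʳ λ eq → ℚ.<-irrefl (≡.sym eq)
    (ℚ.<-≤-trans 0<δ (≡.subst (ℚ._≤ ∣ z ∣² n) (ℚ.+-identityˡ δ) (δ≤ n N≤n)))
  real : ∀ n → N ℕ.≤ n → (z * inverse z z#0 - 1#) ʳ n ≡ 0ℚ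
  real n N≤n = ≡.trans
    (solve 3 (λ a b r → (a :* (a :* r) :- b :* (:- b :* r)) :- con 1ℚ := (a :* a :+ b :* b) :* r :- con 1ℚ)
      refl (z ʳ n) (z ⁱ n) (r n))
    (≡.trans (≡.cong (ℚ._- 1ℚ) (inverse-at n N≤n)) (ℚ.+-inverseʳ 1ℚ))
  imaginary : ∀ n → (z * inverse z z#0 - 1#) ⁱ n ≡ 0ℚ
  imaginary n = solve 3 (λ a b r → (a :* (:- b :* r) :+ b :* (a :* r)) :- con 0ℚ := con 0ℚ)
    refl (z ʳ n) (z ⁱ n) (r n)

-- The bound ε/4 and a slack of ε/4 keep the ℓ¹ norm below ε/2, hence the squared modulus below
-- ε²/4; this leaves room for the gap ε²/2 witnessing strict inequality of reals.
≼⇒∣∣< : ∀ {z ε} → 0ℚ ℚ.< ε → z ≼ ε ℚ.* ½ ℚ.* ½ → ∣ z ∣< ε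
≼⇒∣∣< {z} {ε} 0<ε z≼ =
  let ε₄ = ε ℚ.* ½ ℚ.* ½
      N , f = eventually z≼ ε₄ (0<half (0<half 0<ε))
  in 0<ε , ε ℚ.* ε ℚ.* ½ , 0<half (0<* 0<ε 0<ε) , N , λ n N≤n → begin
    ∣ z ∣² n ℚ.+ ε ℚ.* ε ℚ.* ½
      ≤⟨ ℚ.+-monoˡ-≤ (ε ℚ.* ε ℚ.* ½) (square≤∥∥² (z ʳ n) (z ⁱ n)) ⟩
    ∥ z ∥ n ℚ.* ∥ z ∥ n ℚ.+ ε ℚ.* ε ℚ.* ½
      ≤⟨ ℚ.+-monoˡ-≤ (ε ℚ.* ε ℚ.* ½) (*-mono₂-≤ (0≤norm z n)
           (0≤+ (ℚ.<⇒≤ (0<half (0<half 0<ε))) (ℚ.<⇒≤ (0<half (0<half 0<ε)))) (f n N≤n) (f n N≤n)) ⟩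
    (ε₄ ℚ.+ ε₄) ℚ.* (ε₄ ℚ.+ ε₄) ℚ.+ ε ℚ.* ε ℚ.* ½
      ≤⟨ p≤p+q _ (ℚ.<⇒≤ (0<half (0<half (0<* 0<ε 0<ε)))) ⟩
    (ε₄ ℚ.+ ε₄) ℚ.* (ε₄ ℚ.+ ε₄) ℚ.+ ε ℚ.* ε ℚ.* ½ ℚ.+ ε ℚ.* ε ℚ.* ½ ℚ.* ½
      ≡⟨ solve 1 (λ e → (e :* con ½ :* con ½ :+ e :* con ½ :* con ½) :* (e :* con ½ :* con ½ :+ e :* con ½ :* con ½)
           :+ e :* e :* con ½ :+ e :* e :* con ½ :* con ½ := e :* e) refl ε ⟩
    ε ℚ.* ε
      ∎
  where open ℚ.≤-Reasoning

private
  -- Bernoulli's inequality for σ = 1 - δ/4. The fourth power turns a bound 1 - δ on |q|² into |q| ≤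
  -- σ², without taking roots.
  rate : ∀ {δ} → 0ℚ ℚ.< δ → δ ℚ.≤ 1ℚ → ∃[ σ ] (0ℚ ℚ.≤ σ × σ ℚ.< 1ℚ ×
    1ℚ ℚ.- δ ℚ.≤ (σ ℚ.* σ) ℚ.* (σ ℚ.* σ))
  rate {δ} 0<δ δ≤1 = 1ℚ ℚ.- h , ≤⇒0≤- h≤1 , 1-h<1 , bound
    where
    open ℚ.≤-Reasoning
    h : ℚ
    h = δ ℚ.* ½ ℚ.* ½
    0<h : 0ℚ ℚ.< h
    0<h = 0<half (0<half 0<δ)
    h≤1 : h ℚ.≤ 1ℚ
    h≤1 = ℚ.≤-trans (ℚ.≤-trans (ℚ.<⇒≤ (half< (0<half 0<δ))) (ℚ.<⇒≤ (half< 0<δ))) δ≤1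
    1-h<1 : 1ℚ ℚ.- h ℚ.< 1ℚ
    1-h<1 = ≡.subst (1ℚ ℚ.- h ℚ.<_) (ℚ.+-identityʳ 1ℚ) (ℚ.+-monoʳ-< 1ℚ (ℚ.neg-antimono-< 0<h))
    bound : 1ℚ ℚ.- δ ℚ.≤ ((1ℚ ℚ.- h) ℚ.* (1ℚ ℚ.- h)) ℚ.* ((1ℚ ℚ.- h) ℚ.* (1ℚ ℚ.- h))
    bound = begin
      1ℚ ℚ.- δ
        ≤⟨ p≤p+q _ (0≤+ (0≤* (ℚ.<⇒≤ 0<h) (0≤* (ℚ.<⇒≤ 0<h) (0≤+ (≤⇒0≤- h≤1) (≤⇒0≤- h≤1))))
             (0≤+ (0≤* (ℚ.<⇒≤ 0<h) (0≤* (ℚ.<⇒≤ 0<h) (0≤+ (≤⇒0≤- h≤1) (≤⇒0≤- h≤1))))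
                  (0≤+ (0≤square (h ℚ.* h)) (0≤+ (0≤square h) (0≤square h))))) ⟩
      1ℚ ℚ.- δ ℚ.+ (h ℚ.* (h ℚ.* ((1ℚ ℚ.- h) ℚ.+ (1ℚ ℚ.- h))) ℚ.+
        (h ℚ.* (h ℚ.* ((1ℚ ℚ.- h) ℚ.+ (1ℚ ℚ.- h))) ℚ.+ ((h ℚ.* h) ℚ.* (h ℚ.* h) ℚ.+ (h ℚ.* h ℚ.+ h ℚ.* h))))
        ≡⟨ solve 1 (λ d → let h = d :* con ½ :* con ½ ; u = con 1ℚ :- h in
             con 1ℚ :- d :+ (h :* (h :* (u :+ u)) :+ (h :* (h :* (u :+ u)) :+ ((h :* h) :* (h :* h) :+ (h :* h :+ h :* h))))
             := (u :* u) :* (u :* u)) refl δ ⟩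
      ((1ℚ ℚ.- h) ℚ.* (1ℚ ℚ.- h)) ℚ.* ((1ℚ ℚ.- h) ℚ.* (1ℚ ℚ.- h))
        ∎

-- From some entry N on, |q|² ≤ 1 - δ ≤ σ⁴, and squared moduli multiply exactly, so the same N
-- serves all powers. Passing to the ℓ¹ norm costs the square root of 2, rounded up to 2.
geometric-decay : ∀ {q} → ∣ q ∣< 1ℚ → ∃[ σ ] (0ℚ ℚ.≤ σ × σ ℚ.< 1ℚ ×
  (∀ n → q ^ n ≼ fromℕ 2 ℚ.* ((σ ^ℚ n) ℚ.* (σ ^ℚ n))))
geometric-decay {q} (_ , δ , 0<δ , N , h) =
  let σ , 0≤σ , σ<1 , 1-δ≤ = rate 0<δ δ≤1
  in σ , 0≤σ , σ<1 , λ n → within λ ε 0<ε → N , λ k N≤k →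
    ℚ.≤-trans (square-cancel-≤ (0≤bound 0≤σ n) (norm-bound 0≤σ n k (power 0≤σ 1-δ≤ k N≤k n)))
      (p≤p+q _ (ℚ.<⇒≤ 0<ε))
  where
  open ℚ.≤-Reasoning
  δ≤1 : δ ℚ.≤ 1ℚ
  δ≤1 = ℚ.≤-trans (≡.subst (ℚ._≤ ∣ q ∣² N ℚ.+ δ) (ℚ.+-identityˡ δ) (ℚ.+-monoˡ-≤ δ (0≤norm² q N)))
    (h N ℕ.≤-refl)

  module _ {σ : ℚ} (0≤σ : 0ℚ ℚ.≤ σ) where
    x : ℕ → ℚ
    x n = (σ ^ℚ n) ℚ.* (σ ^ℚ n)

    0≤x : ∀ n → 0ℚ ℚ.≤ x n
    0≤x n = 0≤* (^-nonNeg 0≤σ n) (^-nonNeg 0≤σ n)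

    0≤bound : ∀ n → 0ℚ ℚ.≤ fromℕ 2 ℚ.* x n
    0≤bound n = 0≤* (ℚ.nonNegative⁻¹ (fromℕ 2)) (0≤x n)

    power : 1ℚ ℚ.- δ ℚ.≤ (σ ℚ.* σ) ℚ.* (σ ℚ.* σ) → ∀ k → N ℕ.≤ k → ∀ n → ∣ q ^ n ∣² k ℚ.≤ x n ℚ.* x n
    power 1-δ≤ k N≤k zero    = ℚ.≤-refl
    power 1-δ≤ k N≤k (suc n) = begin
      ∣ q * q ^ n ∣² k
        ≡⟨ norm²-* q (q ^ n) k ⟩
      (∣ q ∣² k) ℚ.* (∣ q ^ n ∣² k)
        ≤⟨ *-mono₂-≤ (0≤norm² (q ^ n) k) (0≤* (0≤* 0≤σ 0≤σ) (0≤* 0≤σ 0≤σ)) q≤ (power 1-δ≤ k N≤k n) ⟩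
      ((σ ℚ.* σ) ℚ.* (σ ℚ.* σ)) ℚ.* (x n ℚ.* x n)
        ≡⟨ solve 2 (λ s y → ((s :* s) :* (s :* s)) :* ((y :* y) :* (y :* y)) :=
             ((s :* y) :* (s :* y)) :* ((s :* y) :* (s :* y))) refl σ (σ ^ℚ n) ⟩
      x (suc n) ℚ.* x (suc n)
        ∎
      where
      q≤ : ∣ q ∣² k ℚ.≤ (σ ℚ.* σ) ℚ.* (σ ℚ.* σ)
      q≤ = ℚ.≤-trans
        (≡.subst (ℚ._≤ 1ℚ ℚ.- δ) (solve 2 (λ a d → (a :+ d) :- d := a) refl (∣ q ∣² k) δ)
          (ℚ.+-monoˡ-≤ (ℚ.- δ) (h k N≤k)))
        1-δ≤

    norm-bound : ∀ n k → ∣ q ^ n ∣² k ℚ.≤ x n ℚ.* x n →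
      ∥ q ^ n ∥ k ℚ.* ∥ q ^ n ∥ k ℚ.≤ (fromℕ 2 ℚ.* x n) ℚ.* (fromℕ 2 ℚ.* x n)
    norm-bound n k le = begin
      ∥ q ^ n ∥ k ℚ.* ∥ q ^ n ∥ k
        ≤⟨ ∥∥²≤2square ((q ^ n) ʳ k) ((q ^ n) ⁱ k) ⟩
      fromℕ 2 ℚ.* (∣ q ^ n ∣² k)
        ≤⟨ ℚ.*-monoˡ-≤-nonNeg (fromℕ 2) le ⟩
      fromℕ 2 ℚ.* (x n ℚ.* x n)
        ≤⟨ p≤p+q _ (0≤* (ℚ.nonNegative⁻¹ (fromℕ 2)) (0≤* (0≤x n) (0≤x n))) ⟩
      fromℕ 2 ℚ.* (x n ℚ.* x n) ℚ.+ fromℕ 2 ℚ.* (x n ℚ.* x n)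
        ≡⟨ solve 1 (λ y → con (fromℕ 2) :* (y :* y) :+ con (fromℕ 2) :* (y :* y) :=
             (con (fromℕ 2) :* y) :* (con (fromℕ 2) :* y)) refl (x n) ⟩
      (fromℕ 2 ℚ.* x n) ℚ.* (fromℕ 2 ℚ.* x n)
        ∎

-- Transfer to the limits and quotients of the statement

module ComplexEvaluation
  {σ : ℚ} (0≤σ : 0ℚ ℚ.≤ σ) (σ<1 : σ ℚ.< 1ℚ) {q x₃ x₁₅ x₁₈ : ℂ}
  (ev : QSeries.Evaluation ℂ-completeNormedRing σ 0≤σ σ<1 q x₃ x₁₅ x₁₈) where

  open GeometricLimits ℂ-completeNormedRing σ 0≤σ σ<1
  open QSeries ℂ-completeNormedRing σ 0≤σ σ<1
  open FiniteIdentities ℂ-commutativeRing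
  private module CR = CommutativeRing ℂ-commutativeRing
  open Evaluation ev using (A; B; C; D; E; D*E≈1) public
  private module Ev = Evaluation ev

  ⇝⇒⟶ : ∀ {s l} → s ⇝ l → s ⟶ l
  ⇝⇒⟶ {s} {l} s⇝l ε 0<ε =
    let N , h = null-eventually {s = λ n → s n - l} s⇝l (ε ℚ.* ½ ℚ.* ½) (0<half (0<half 0<ε))
    in N , λ n N≤n → ≼⇒∣∣< 0<ε (h n N≤n)

  ⟨⨾⟩≈poch : ∀ x p n → ⟨ x ⨾ p ⟩ n ≈ poch x p n
  ⟨⨾⟩≈poch x p = product≈∏ (λ j → 1# - x * p ^ j)

  poch⟶ : ∀ {x p l} → poch x p ⇝ l → ⟨ x ⨾ p ⟩∞≔ l
  poch⟶ {x} {p} {l} h = ⇝⇒⟶ (⇝-cong {s = poch x p} {t = λ n → ⟨ x ⨾ p ⟩ n} {l = l}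
    (λ n → CR.sym {⟨ x ⨾ p ⟩ n} {poch x p n} (⟨⨾⟩≈poch x p n)) h)

  den den′ : ℕ → ℂ
  den n  = ⟨ - q ⨾ q ⟩ n * ⟨ q ⨾ q ⟩ (2 ℕ.* n ℕ.+ 1)
  den′ n = poch (- q) q n * poch q q (2 ℕ.* n ℕ.+ 1)

  den′≈den : ∀ n → den′ n ≈ den n
  den′≈den n = CR.sym {den n} {den′ n}
    (CR.*-cong {⟨ - q ⨾ q ⟩ n} {poch (- q) q n} {⟨ q ⨾ q ⟩ (2 ℕ.* n ℕ.+ 1)} {poch q q (2 ℕ.* n ℕ.+ 1)}
      (⟨⨾⟩≈poch (- q) q n) (⟨⨾⟩≈poch q q (2 ℕ.* n ℕ.+ 1)))

  den#0 : ∀ n → den n #0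
  den#0 n = unit⇒#0 {den n} (unit-resp {den′ n} {den n} (den′≈den n) (Ev.den-unit n))

  num t : ℕ → ℂ
  num n = q ^ (n ℕ.* (n ℕ.+ 1)) * ⟨ - x₃ ⨾ x₃ ⟩ n
  t n   = num n / den n [ den#0 n ]

  D#0 : D #0
  D#0 = unit⇒#0 {D} (E , D*E≈1)

  t-equation : ∀ n → den′ n * t n ≈ q ^ (n ℕ.* (n ℕ.+ 1)) * poch (- x₃) x₃ n
  t-equation n = begin
    den′ n * t n
      ≈⟨ CR.*-congʳ {t n} {den′ n} {den n} (den′≈den n) ⟩
    den n * (num n * inverse (den n) (den#0 n))
      ≈⟨ *-quotient {den n} {inverse (den n) (den#0 n)} (num n) (*-inverse (den n) (den#0 n)) ⟩
    q ^ (n ℕ.* (n ℕ.+ 1)) * ⟨ - x₃ ⨾ x₃ ⟩ n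
      ≈⟨ CR.*-congˡ {q ^ (n ℕ.* (n ℕ.+ 1))} {⟨ - x₃ ⨾ x₃ ⟩ n} {poch (- x₃) x₃ n}
           (⟨⨾⟩≈poch (- x₃) x₃ n) ⟩
    q ^ (n ℕ.* (n ℕ.+ 1)) * poch (- x₃) x₃ n
      ∎
    where open import Relation.Binary.Reasoning.Setoid CR.setoid

  series⟶ : Series t ≔ A * B * C / D [ D#0 ]
  series⟶ = ⇝⇒⟶ {λ N → sum {N} (λ i → t (toℕ i))} {A * B * C / D [ D#0 ]}
    (⇝-cong {s = ∑ t} {λ N → sum {N} (λ i → t (toℕ i))} {A * B * C / D [ D#0 ]}
      (λ N → CR.sym {sum {N} (λ i → t (toℕ i))} {∑ t N} (sum≈∑ t N))
      (⇝-congʳ {s = ∑ t} {A * B * C * E} {A * B * C / D [ D#0 ]}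
        -- `E` and `inverse D D#0` are both inverses of `D`, hence equal.
        (CR.*-congˡ {A * B * C} {E} {inverse D D#0} (unit-cancel {D} {E} {inverse D D#0} (E , D*E≈1)
          (CR.trans {D * E} {1#} {D * inverse D D#0} D*E≈1
            (CR.sym {D * inverse D D#0} {1#} (*-inverse D D#0)))))
        (Ev.series-limit {t} t-equation)))

  -- The theorem with q³, q¹⁵, q¹⁸ abstracted to variables, so that checking its proof does not
  -- multiply the powers out.
  Identity : Set
  Identity =
    Σ[ den#0 ∈ (∀ n → (⟨ - q ⨾ q ⟩ n * ⟨ q ⨾ q ⟩ (2 ℕ.* n ℕ.+ 1)) #0) ]
    ∃[ A ] ∃[ B ] ∃[ C ] ∃[ D ] Σ[ D#0 ∈ D #0 ]
    ( (⟨ x₃ ⨾ x₃ ⟩∞≔ A)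
    × (⟨ x₃ ⨾ x₁₈ ⟩∞≔ B)
    × (⟨ x₁₅ ⨾ x₁₈ ⟩∞≔ C)
    × (⟨ q ⨾ q ⟩∞≔ D)
    × (Series (λ n → q ^ (n ℕ.* (n ℕ.+ 1)) * ⟨ - x₃ ⨾ x₃ ⟩ n
    / (⟨ - q ⨾ q ⟩ n * ⟨ q ⨾ q ⟩ (2 ℕ.* n ℕ.+ 1)) [ den#0 n ])
    ≔ A * B * C / D [ D#0 ]) )

  identity : Identity
  identity = den#0 , A , B , C , D , D#0
    , poch⟶ {x₃} {x₃} {A} Ev.A-limit , poch⟶ {x₃} {x₁₈} {B} Ev.B-limit
    , poch⟶ {x₁₅} {x₁₈} {C} Ev.C-limit , poch⟶ {q} {q} {D} Ev.D-limit , series⟶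

private
  module CR = CommutativeRing ℂ-commutativeRing
  open import Algebra.Properties.Semiring.Exp CR.semiring using () renaming (_^_ to _^ᶜ_)

  -- Both powers are the same recursion over definitionally equal structures; the variable exponent
  -- keeps them from unfolding.
  ^-agree : ∀ q n → q ^ n ≈ q ^ᶜ n
  ^-agree q n = CR.refl {q ^ n}

theorem3p3 : (q : ℂ) → ∣ q ∣< 1ℚ →
    Σ[ den#0 ∈ (∀ n → (⟨ - q ⨾ q ⟩ n * ⟨ q ⨾ q ⟩ (2 ℕ.* n ℕ.+ 1)) #0) ]
    ∃[ A ] ∃[ B ] ∃[ C ] ∃[ D ] Σ[ D#0 ∈ D #0 ]
    ( (⟨ q ^ 3 ⨾ q ^ 3 ⟩∞≔ A)
    × (⟨ q ^ 3 ⨾ q ^ 18 ⟩∞≔ B)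
    × (⟨ q ^ 15 ⨾ q ^ 18 ⟩∞≔ C)
    × (⟨ q ⨾ q ⟩∞≔ D)
    × (Series (λ n → q ^ (n ℕ.* (n ℕ.+ 1)) * ⟨ - (q ^ 3) ⨾ q ^ 3 ⟩ n
    / (⟨ - q ⨾ q ⟩ n * ⟨ q ⨾ q ⟩ (2 ℕ.* n ℕ.+ 1)) [ den#0 n ])
    ≔ A * B * C / D [ D#0 ]) )
theorem3p3 q ∣q∣<1 =
  let σ , 0≤σ , σ<1 , decay = geometric-decay {q} ∣q∣<1
  in ComplexEvaluation.identity 0≤σ σ<1 (QSeries.evaluation ℂ-completeNormedRing σ 0≤σ σ<1
       {q} {q ^ 3} {q ^ 15} {q ^ 18} decay (^-agree q 3) (^-agree q 15) (^-agree q 18))
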